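{- Let $n$ be a positive integer. Then $$t(1,5,5,5;n)=\sum_{d\mid 8n+16}(-1)^{d}\Big(\Big(\frac 5d\Big)+\Big(\frac 5{(8n+16)/d}\Big)\Big)d-\sum_{d\mid 2n+4}(-1)^{d}\Big(\Big(\frac 5d\Big)+\Big(\frac 5{(2n+4)/d}\Big)\Big)d,$$ where the sums are over positive divisors $d$.
   Context: $\left(\frac{a}{m}\right)$ is the Legendre–Jacobi–Kronecker symbol. For positive integers $a,b,c,d$ and a nonnegative integer $n$, $t(a,b,c,d;n)$ denotes the number of $(x,y,z,w)\in\mathbb Z^4$ with $n=a\frac{x(x-1)}2+b\frac{y(y-1)}2+c\frac{z(z-1)}2+d\frac{w(w-1)}2$. -}

module Defs where

open import Data.Nat as ℕ using (ℕ; zero; suc; _∸_; _^_; _%_; _/_; _≤ᵇ_)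
open import Data.Nat.Divisibility using (_∣_; _∣?_)
open import Data.Integer as ℤ using (ℤ; +_; -_; 1ℤ; 0ℤ; -1ℤ)
open import Data.List using (List; []; _∷_; map; filter; upTo; foldr)
open import Data.Bool using (Bool; true; false; if_then_else_)
open import Relation.Nullary using (does)
open import Data.Product using (Σ; _×_; _,_)
open import Relation.Binary.PropositionalEquality using (_≡_)

-- Legendre/Kronecker symbol (a/p) for a prime p (a ∈ ℕ):
--   p = 2 : Kronecker convention: 0 if a even, 1 if a ≡ ±1 (mod 8), -1 if a ≡ ±3 (mod 8)
--   p odd : Euler's criterion a^((p-1)/2) mod p ∈ {0, 1, p-1}
legendre : ℕ → ℕ → ℤ
legendre a 0 = 0ℤ
legendre a 1 = 1ℤ
legendre a 2 with a % 8
... | 1 = 1ℤ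
... | 7 = 1ℤ
... | 3 = -1ℤ
... | 5 = -1ℤ
... | _ = 0ℤ
legendre a p@(suc (suc (suc k))) with (a ^ ((p ∸ 1) / 2)) % p
... | 0 = 0ℤ
... | 1 = 1ℤ
... | _ = -1ℤ

leastDivFrom : ℕ → ℕ → ℕ → ℕ
leastDivFrom zero    i m = m
leastDivFrom (suc f) i m = if does (i ∣? m) then i else leastDivFrom f (suc i) m

leastPrimeFactor : ℕ → ℕ
leastPrimeFactor m = leastDivFrom m 2 m

-- Jacobi–Kronecker symbol (a/m) for m ≥ 1, defined multiplicatively over the
-- prime factorisation of m: (a/m) = ∏_{p^e ∥ m} (a/p)^e, (a/1) = 1.
-- fuel ≥ number of prime factors of m (m itself suffices).
kroneckerFuel : ℕ → ℕ → ℕ → ℤ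
kroneckerFuel zero    a m = 1ℤ
kroneckerFuel (suc f) a m with m ℕ.≤ᵇ 1
... | true  = 1ℤ
... | false = legendre a p ℤ.* kroneckerFuel f a (m / suc (ℕ.pred p))
  where
  -- p ≥ 2 here, so suc (pred p) = p (written this way only to make division total)
  p = leastPrimeFactor m

kronecker : ℕ → ℕ → ℤ
kronecker a m = kroneckerFuel m a m

divisorSum : ℕ → (ℕ → ℕ → ℤ) → ℤ
divisorSum N f = foldr ℤ._+_ 0ℤ
  (map (λ k → f (suc k) (N / suc k)) (filter (λ k → suc k ∣? N) (upTo N)))

sgnPow : ℕ → ℤ
sgnPow d = if does (2 ∣? d) then 1ℤ else -1ℤ

twoTri : ℤ → ℤ
twoTri x = x ℤ.* (x ℤ.- 1ℤ)

-- solutions (x,y,z,w) ∈ ℤ⁴ of n = a x(x-1)/2 + b y(y-1)/2 + c z(z-1)/2 + d w(w-1)/2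
-- (equation multiplied by 2, which is equivalent)
Sol : ℕ → ℕ → ℕ → ℕ → ℕ → Set
Sol a b c d n = Σ (ℤ × ℤ × ℤ × ℤ) λ where
  (x , y , z , w) → + (2 ℕ.* n) ≡
      (+ a) ℤ.* twoTri x ℤ.+ (+ b) ℤ.* twoTri y ℤ.+ (+ c) ℤ.* twoTri z ℤ.+ (+ d) ℤ.* twoTri w

summand5 : ℕ → ℕ → ℤ
summand5 d e = sgnPow d ℤ.* (kronecker 5 d ℤ.+ kronecker 5 e) ℤ.* (+ d)

module Submission where

-- Put ψ(q) = Σ_{n ≥ 0} q^(n(n+1)/2) and ψ₅ = ψ(q⁵). Every exponent of ψ comes from two integers x, so t(1,5,5,5;n) is
-- 16 times the coefficient of qⁿ in ψ ψ₅³. The key identity is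
--   Σ_{M} Σ_{xy = M, x odd} (5/x) y q^M = q ψ ψ₅ (ψ² - q ψ₅²).
-- Its left side is a difference of two values of the Weierstrass function, hence a product of theta functions; this
-- rests on the symmetry n ↦ 2k + 1 - n of a theta series at its zero k and on rotations of ℤ². The right side becomes a
-- product of theta functions through multiplication by 2 + i on ℤ[i], and the products are compared through
-- their logarithmic derivatives. The two terms ψ³ψ₅ and ψψ₅³ are then separated by passing from M to 5M: the vectors of
-- 𝔽₅³ are counted along the isotropic lines of x² + z² + w². Finally (5/x) is identified with the quadratic character
-- mod 5 by means of the Gauss sum in the group ring ℤ[C₅].

open import Defs

-- Exponents are doubled throughout, so that `mono 2` stands for q. Infinite products never occur: a
-- theta function is known by its constant term and its logarithmic derivative, a combination of
-- Lambert series. The difference of two values of ℘ factors for a linear reason. On rotating ℤ²,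
-- both J² and J²℘ become combinations of the same two series `G₀` and `G₁`, with coefficients that
-- do not depend on the point; hence the difference of two quotients is governed by a product of two
-- 2 × 2 determinants. The modulus 10 comes from the odd x and the character mod 5, and the points
-- are q and q³, whose product and quotient are q⁴ and q². The obstacle at the end is that the key
-- identity only gives the difference `ρ` - `τ` of two representation numbers as a divisor sum. The
-- second relation depends on M mod 5: `τ` vanishes at 2M when M is a nonzero square, `ρ` = 3 `τ`
-- there when M is a nonsquare, and `τ` at 5N is `ρ` at N.

module Proof where

  open import Algebra using (CommutativeRing)
  open import Algebra using (CommutativeSemiring)
  open import Axiom.UniquenessOfIdentityProofs using (module Decidable⇒UIP)
  open import Data.Bool using (Bool; true; false; if_then_else_)
  open import Data.Fin using (Fin)
  open import Data.Integer using (ℤ; +_; -[1+_]; _+_; _*_; -_; _-_; 0ℤ; 1ℤ; -1ℤ; _≟_; ∣_∣; _≤_; _<_; +≤+; _⊖_)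
  open import Data.Integer.Tactic.RingSolver using (solve-∀)
  open import Data.List using (List; []; _∷_; _++_; map; filter; upTo; foldr; length; lookup; cartesianProduct)
  open import Data.List.Membership.Propositional using (_∈_)
  open import Data.List.Relation.Unary.All as All using (All; []; _∷_)
  open import Data.List.Relation.Unary.AllPairs using ([]; _∷_)
  open import Data.List.Relation.Unary.Any as Any using (here; there)
  open import Data.List.Relation.Unary.Unique.Propositional using (Unique)
  open import Data.Nat as ℕ using (ℕ; zero; suc; z≤n; s≤s)
  open import Data.Nat.Combinatorics using (nCk+nC[k+1]≡[n+1]C[k+1]; nCn≡1) renaming (_C_ to _choose_)
  open import Data.Nat.Primality using (Prime; prime?; prime[2]; euclidsLemma)
  open import Data.Product using (Σ; _×_; _,_; proj₁; proj₂)
  open import Data.Sum using (_⊎_; inj₁; inj₂; [_,_]′)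
  open import Data.Unit using (⊤; tt)
  open import Function using (_∘_; id; case_of_)
  open import Function.Bundles using (_↔_; mk↔ₛ′)
  open import Relation.Binary using (IsEquivalence)
  open import Relation.Binary.PropositionalEquality using (_≡_; _≢_; refl; sym; trans; cong; cong₂; subst; isEquivalence; module ≡-Reasoning)
  open import Relation.Nullary using (¬_; Dec; yes; no; does; contradiction)
  open import Relation.Nullary.Decidable using (True; toWitness; _→-dec_; ¬?)
  import Algebra.Properties.CommutativeMonoid.Mult as CommutativeMonoidMult
  import Algebra.Properties.CommutativeSemiring.Binomial as Binomial
  import Algebra.Properties.Group as GroupProperties
  import Algebra.Properties.Ring as RingProperties
  import Algebra.Properties.Semiring.Exp as Exp
  import Algebra.Properties.Semiring.Mult as Mult
  import Algebra.Properties.Semiring.Sum as Sum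
  import Algebra.Solver.Ring.NaturalCoefficients.Default as NaturalSolver
  import Data.Fin as Fin
  import Data.Fin.Properties as FinP
  import Data.Integer.DivMod as ℤDM
  import Data.Integer.Properties as ℤP
  import Data.List.Membership.Propositional.Properties as MemP
  import Data.List.Relation.Unary.All.Properties as AllP
  import Data.List.Relation.Unary.Any.Properties as AnyP
  import Data.List.Relation.Unary.Unique.Propositional.Properties as UniqueP
  import Data.Nat.DivMod as ℕDM
  import Data.Nat.Divisibility as ℕDiv
  import Data.Nat.Primality as Primality
  import Data.Nat.Properties as ℕP
  import Data.Nat.Tactic.RingSolver as ℕSolver
  import Relation.Binary.Reasoning.Setoid as SetoidReasoning

  -- Finite sums over duplicate-free lists.

  +-congʳ : ∀ a {b c : ℤ} → b ≡ c → a + b ≡ a + c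
  +-congʳ a = cong (λ b → a + b)

  +-cancelˡ : ∀ a b c → a + b ≡ a + c → b ≡ c
  +-cancelˡ = GroupProperties.∙-cancelˡ (CommutativeRing.+-group ℤP.+-*-commutativeRing)

  sumL : {I : Set} → (I → ℤ) → List I → ℤ
  sumL f []       = 0ℤ
  sumL f (x ∷ xs) = f x + sumL f xs

  module _ {I : Set} where

    sumL-cong : {f g : I → ℤ} → (∀ i → f i ≡ g i) → ∀ L → sumL f L ≡ sumL g L
    sumL-cong e []       = refl
    sumL-cong e (x ∷ xs) = cong₂ _+_ (e x) (sumL-cong e xs)

    sumL-cong∈ : {f g : I → ℤ} (L : List I) → (∀ i → i ∈ L → f i ≡ g i) → sumL f L ≡ sumL g L
    sumL-cong∈ []      e = refl
    sumL-cong∈ (x ∷ L) e = cong₂ _+_ (e x (here refl)) (sumL-cong∈ L (λ i p → e i (there p)))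

    sumL-zero : (f : I → ℤ) (L : List I) → (∀ i → i ∈ L → f i ≡ 0ℤ) → sumL f L ≡ 0ℤ
    sumL-zero f []       z = refl
    sumL-zero f (x ∷ xs) z = cong₂ _+_ (z x (here refl)) (sumL-zero f xs (λ i p → z i (there p)))

    sumL-+ : (f g : I → ℤ) (L : List I) → sumL (λ i → f i + g i) L ≡ sumL f L + sumL g L
    sumL-+ f g []       = refl
    sumL-+ f g (x ∷ xs) rewrite sumL-+ f g xs = lemma (f x) (g x) (sumL f xs) (sumL g xs)
      where
      lemma : ∀ a b c d → a + b + (c + d) ≡ a + c + (b + d)
      lemma = solve-∀

    sumL-* : (k : ℤ) (f : I → ℤ) (L : List I) → sumL (λ i → k * f i) L ≡ k * sumL f L
    sumL-* k f []       = sym (ℤP.*-zeroʳ k)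
    sumL-* k f (x ∷ xs) rewrite sumL-* k f xs = sym (ℤP.*-distribˡ-+ k (f x) (sumL f xs))

    sumL-++ : (f : I → ℤ) (L M : List I) → sumL f (L ++ M) ≡ sumL f L + sumL f M
    sumL-++ f []      M = sym (ℤP.+-identityˡ _)
    sumL-++ f (x ∷ L) M rewrite sumL-++ f L M = sym (ℤP.+-assoc (f x) _ _)

    -- The remaining list is described by membership alone, because the two lists compared in
    -- `sumL-support` come in unrelated orders.
    record Removed (f : I → ℤ) (x : I) (L : List I) : Set where
      field
        rest   : List I
        uniq   : Unique rest
        sum≡   : sumL f L ≡ f x + sumL f rest
        keep   : ∀ i → i ∈ L → i ≢ x → i ∈ rest
        from   : ∀ i → i ∈ rest → i ∈ L × i ≢ x

    remove : (f : I → ℤ) {x : I} {L : List I} → Unique L → x ∈ L → Removed f x L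
    remove f {L = y ∷ ys} (y∉ ∷ u) (here refl) = record
      { rest = ys ; uniq = u ; sum≡ = refl
      ; keep = λ { i (here e) i≢ → contradiction e i≢ ; i (there p) _ → p }
      ; from = λ i p → there p , λ e → All.lookup y∉ p (sym e) }
    remove f {x} {y ∷ ys} (y∉ ∷ u) (there p) = record
      { rest = y ∷ R.rest
      ; uniq = All.tabulate (λ q → All.lookup y∉ (proj₁ (R.from _ q))) ∷ R.uniq
      ; sum≡ = trans (+-congʳ (f y) R.sum≡) (lemma (f y) (f x) (sumL f R.rest))
      ; keep = λ { i (here e) _ → here e ; i (there q) i≢ → there (R.keep i q i≢) }
      ; from = λ { i (here refl) → here refl , All.lookup y∉ p
                 ; i (there q) → there (proj₁ (R.from i q)) , proj₂ (R.from i q) } }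
      where
      module R = Removed (remove f u p)
      lemma : ∀ a b c → a + (b + c) ≡ b + (a + c)
      lemma = solve-∀

    -- Indices with value 0 do not affect a sum, so each nonzero entry of `L` can be looked up in
    -- `M` and removed there. This makes a coefficient independent of the list from which it is
    -- computed.
    sumL-support : (f : I → ℤ) (L M : List I) → Unique L → Unique M →
                   (∀ i → f i ≢ 0ℤ → i ∈ L → i ∈ M) → (∀ i → f i ≢ 0ℤ → i ∈ M → i ∈ L) →
                   sumL f L ≡ sumL f M
    sumL-support f [] M uL uM LM ML = sym (sumL-zero f M zero-on)
      where
      zero-on : ∀ i → i ∈ M → f i ≡ 0ℤ
      zero-on i p with f i ≟ 0ℤ
      ... | yes z = z
      ... | no nz = case ML i nz p of λ ()
    sumL-support f (x ∷ L) M (x∉ ∷ uL) uM LM ML with f x ≟ 0ℤ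
    ... | yes z = trans (cong (_+ sumL f L) z) (trans (ℤP.+-identityˡ _)
        (sumL-support f L M uL uM (λ i nz p → LM i nz (there p)) ML'))
      where
      ML' : ∀ i → f i ≢ 0ℤ → i ∈ M → i ∈ L
      ML' i nz p with ML i nz p
      ... | here refl = contradiction z nz
      ... | there q   = q
    ... | no nz = trans (+-congʳ (f x) (sumL-support f L R.rest uL R.uniq LM' ML')) (sym R.sum≡)
      where
      module R = Removed (remove f uM (LM x nz (here refl)))
      LM' : ∀ i → f i ≢ 0ℤ → i ∈ L → i ∈ R.rest
      LM' i nz′ p = R.keep i (LM i nz′ (there p)) (λ e → All.lookup x∉ p (sym e))
      ML' : ∀ i → f i ≢ 0ℤ → i ∈ R.rest → i ∈ L
      ML' i nz′ p with R.from i p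
      ... | q , i≢ with ML i nz′ q
      ...   | here e  = contradiction e i≢
      ...   | there r = r

    nonzero? : (f : I → ℤ) (i : I) → Dec (f i ≢ 0ℤ)
    nonzero? f i with f i ≟ 0ℤ
    ... | yes z = no (λ nz → nz z)
    ... | no nz = yes nz

    sumL-filter : (f g : I → ℤ) → (∀ i → g i ≡ 0ℤ → f i ≡ 0ℤ) → ∀ L → sumL f (filter (nonzero? g) L) ≡ sumL f L
    sumL-filter f g z [] = refl
    sumL-filter f g z (x ∷ L) with g x ≟ 0ℤ
    ... | yes p = trans (sumL-filter f g z L) (sym (trans (cong (_+ sumL f L) (z x p)) (ℤP.+-identityˡ _)))
    ... | no p  = +-congʳ (f x) (sumL-filter f g z L)

  sumL-map : {I J : Set} (f : J → ℤ) (φ : I → J) (L : List I) → sumL f (map φ L) ≡ sumL (f ∘ φ) L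
  sumL-map f φ []      = refl
  sumL-map f φ (x ∷ L) = +-congʳ (f (φ x)) (sumL-map f φ L)

  module _ {I J : Set} where

    unique-map : (φ : I → J) (ψ : J → I) (L : List I) → (∀ i → i ∈ L → ψ (φ i) ≡ i) →
                 Unique L → Unique (map φ L)
    unique-map φ ψ [] inv [] = []
    unique-map φ ψ (x ∷ L) inv (x∉ ∷ u) =
      AllP.map⁺ (All.tabulate λ {i} p e → All.lookup x∉ p
        (trans (sym (inv x (here refl))) (trans (cong ψ e) (inv i (there p)))))
      ∷ unique-map φ ψ L (λ i p → inv i (there p)) u

    sumL-cartesian : (f : I × J → ℤ) (L : List I) (M : List J) →
                     sumL f (cartesianProduct L M) ≡ sumL (λ i → sumL (λ j → f (i , j)) M) L
    sumL-cartesian f []      M = refl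
    sumL-cartesian f (x ∷ L) M = trans (sumL-++ f (map (x ,_) M) _)
      (cong₂ _+_ (sumL-map f (x ,_) M) (sumL-cartesian f L M))

  ≢0-*ˡ : ∀ {a b} → a * b ≢ 0ℤ → a ≢ 0ℤ
  ≢0-*ˡ {a} {b} nz refl = nz refl

  ≢0-*ʳ : ∀ {a b} → a * b ≢ 0ℤ → b ≢ 0ℤ
  ≢0-*ʳ {a} {b} nz refl = nz (ℤP.*-zeroʳ a)

  𝟙 : {P : Set} → Dec P → ℤ
  𝟙 d = if does d then 1ℤ else 0ℤ

  𝟙-yes : {P : Set} (d : Dec P) → P → 𝟙 d ≡ 1ℤ
  𝟙-yes (yes _) p = refl
  𝟙-yes (no n)  p = contradiction p n

  𝟙-≢0 : {P : Set} (d : Dec P) → 𝟙 d ≢ 0ℤ → P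
  𝟙-≢0 (yes p) nz = p
  𝟙-≢0 (no _)  nz = contradiction refl nz

  ind : ℤ → ℕ → ℤ
  ind e N = 𝟙 (e ≟ + N)

  ind-≢0 : ∀ e N → ind e N ≢ 0ℤ → e ≡ + N
  ind-≢0 e N = 𝟙-≢0 (e ≟ + N)

  -- Power series as generating functions of indexed families.

  Series : Set
  Series = ℕ → ℤ

  infix 4 _≈_
  _≈_ : Series → Series → Set
  f ≈ g = ∀ n → f n ≡ g n

  -- A family of terms w i · q^(E i) with only finitely many nonzero terms of each exponent.
  record Cov {I : Set} (w E : I → ℤ) : Set where
    field
      nonneg : ∀ i → w i ≢ 0ℤ → Σ ℕ λ k → E i ≡ + k
      list   : ℕ → List I
      uniq   : ∀ N → Unique (list N)
      covers : ∀ N i → w i ≢ 0ℤ → E i ≤ + N → i ∈ list N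

  opaque
    gf : {I : Set} {w E : I → ℤ} → Cov w E → Series
    gf {w = w} {E} c N = sumL (λ i → w i * ind (E i) N) (Cov.list c N)

    gf-def : {I : Set} {w E : I → ℤ} (c : Cov w E) (N : ℕ) → gf c N ≡ sumL (λ i → w i * ind (E i) N) (Cov.list c N)
    gf-def c N = refl

  module _ {I : Set} {w E : I → ℤ} (c : Cov w E) where
    open Cov c

    -- An index of another exponent contributes 0 through `ind`, so the list may be too long; it
    -- only has to contain every index of exponent N.
    coef : ∀ N L → Unique L → (∀ i → w i ≢ 0ℤ → E i ≡ + N → i ∈ L) →
           sumL (λ i → w i * ind (E i) N) L ≡ gf c N
    coef N L u cov = trans (sumL-support _ L (list N) u (uniq N)
      (λ i nz _ → covers N i (≢0-*ˡ nz) (ℤP.≤-reflexive (ind-≢0 _ N (≢0-*ʳ {w i} nz))))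
      (λ i nz _ → cov i (≢0-*ˡ nz) (ind-≢0 _ N (≢0-*ʳ {w i} nz)))) (sym (gf-def c N))

    -- Shrinking the support keeps every bound. Finiteness is therefore shown for the weight 1 and
    -- inherited by other weights; the recurring argument `λ _ ()` says that 1 is not 0.
    cov-sub : {v : I → ℤ} → (∀ i → w i ≡ 0ℤ → v i ≡ 0ℤ) → Cov v E
    cov-sub z = record { nonneg = λ i nz → nonneg i (nz ∘ z i) ; list = list ; uniq = uniq
                       ; covers = λ N i nz → covers N i (nz ∘ z i) }

    gf-+ : {u v t : I → ℤ} (zu : ∀ i → w i ≡ 0ℤ → u i ≡ 0ℤ) (zv : ∀ i → w i ≡ 0ℤ → v i ≡ 0ℤ)
           (zt : ∀ i → w i ≡ 0ℤ → t i ≡ 0ℤ) → (∀ i → t i ≡ u i + v i) →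
           ∀ N → gf (cov-sub {t} zt) N ≡ gf (cov-sub {u} zu) N + gf (cov-sub {v} zv) N
    gf-+ {u} {v} {t} zu zv zt e N = trans (gf-def (cov-sub zt) N) (trans (trans
      (sumL-cong (λ i → trans (cong (_* ind (E i) N) (e i)) (ℤP.*-distribʳ-+ (ind (E i) N) (u i) (v i))) (list N))
      (sumL-+ _ _ (list N))) (sym (cong₂ _+_ (gf-def (cov-sub zu) N) (gf-def (cov-sub zv) N))))

  -- A bijection of the supports only. Outside them `to` and `from` may take arbitrary values, so
  -- that a partial change of variables can be written with total functions.
  record Match {I J : Set} (w E : I → ℤ) (v F : J → ℤ) : Set where
    field
      to   : I → J
      from : J → I
      to-ok   : ∀ i → w i ≢ 0ℤ → v (to i) ≡ w i × F (to i) ≡ E i × from (to i) ≡ i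
      from-ok : ∀ j → v j ≢ 0ℤ → w (from j) ≡ v j × to (from j) ≡ j

  module _ {I J : Set} {w E : I → ℤ} {v F : J → ℤ} (c : Cov w E) (m : Match w E v F) where
    open Match m
    private
      L : ℕ → List I
      L N = filter (nonzero? w) (Cov.list c N)

      from-E : ∀ j → v j ≢ 0ℤ → E (from j) ≡ F j
      from-E j nz with from-ok j nz
      ... | p , q = trans (sym (proj₁ (proj₂ (to-ok (from j) (λ z → nz (trans (sym p) z)))))) (cong F q)

      from-nz : ∀ j → v j ≢ 0ℤ → w (from j) ≢ 0ℤ
      from-nz j nz z = nz (trans (sym (proj₁ (from-ok j nz))) z)

      in-L : ∀ {N i} → i ∈ L N → w i ≢ 0ℤ
      in-L {N} p = proj₂ (MemP.∈-filter⁻ (nonzero? w) {xs = Cov.list c N} p)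

    cov-match : Cov v F
    cov-match = record
      { nonneg = λ j nz → proj₁ (Cov.nonneg c _ (from-nz j nz)) ,
                   trans (sym (from-E j nz)) (proj₂ (Cov.nonneg c _ (from-nz j nz)))
      ; list = λ N → map to (L N)
      ; uniq = λ N → unique-map to from (L N) (λ i p → proj₂ (proj₂ (to-ok i (in-L {N} p))))
                       (UniqueP.filter⁺ (nonzero? w) (Cov.uniq c N))
      ; covers = λ N j nz le → subst (_∈ map to (L N)) (proj₂ (from-ok j nz))
          (MemP.∈-map⁺ to (MemP.∈-filter⁺ (nonzero? w)
            (Cov.covers c N (from j) (from-nz j nz) (ℤP.≤-trans (ℤP.≤-reflexive (from-E j nz)) le)) (from-nz j nz))) }

    gf-match : (d : Cov v F) → gf c ≈ gf d
    gf-match d N = trans (trans (trans (gf-def c N) (sym (sumL-filter _ w (λ i z → cong (_* ind (E i) N) z) (Cov.list c N))))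
        (trans (sumL-eq (L N) (λ i p → in-L {N} p)) (sym (sumL-map _ to (L N)))))
      (coef d N (map to (L N)) (Cov.uniq cov-match N)
        (λ j nz e → Cov.covers cov-match N j nz (ℤP.≤-reflexive e)))
      where
      sumL-eq : ∀ M → (∀ i → i ∈ M → w i ≢ 0ℤ) →
                sumL (λ i → w i * ind (E i) N) M ≡ sumL (λ i → v (to i) * ind (F (to i)) N) M
      sumL-eq []      h = refl
      sumL-eq (x ∷ M) h with to-ok x (h x (here refl))
      ... | p , q , _ = cong₂ _+_ (sym (cong₂ (λ a e → a * ind e N) p q)) (sumL-eq M (λ i z → h i (there z)))

  bijection-match : {I J : Set} {w E : I → ℤ} {v F : J → ℤ} (to : I → J) (from : J → I) →
                    (∀ i → v (to i) ≡ w i) → (∀ i → F (to i) ≡ E i) →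
                    (∀ i → from (to i) ≡ i) → (∀ j → to (from j) ≡ j) → Match w E v F
  bijection-match {w = w} {v = v} to from p q r s = record
    { to = to ; from = from ; to-ok = λ i _ → p i , q i , r i
    ; from-ok = λ j _ → trans (sym (p (from j))) (cong v (s j)) , s j }

  gf-cong : {I : Set} {w E v F : I → ℤ} (c : Cov w E) (d : Cov v F) →
            (∀ i → w i ≡ v i) → (∀ i → E i ≡ F i) → gf c ≈ gf d
  gf-cong c d p q = gf-match c (bijection-match id id (sym ∘ p) (sym ∘ q) (λ _ → refl) (λ _ → refl)) d

  gf-irr : {I : Set} {w E : I → ℤ} (c d : Cov w E) → gf c ≈ gf d
  gf-irr c d = gf-cong c d (λ _ → refl) (λ _ → refl)

  gf-sum : {I : Set} {m u v t E : I → ℤ} (b : Cov m E) (c : Cov u E) (d : Cov v E) (e : Cov t E) →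
           (∀ i → m i ≡ 0ℤ → u i ≡ 0ℤ) → (∀ i → m i ≡ 0ℤ → v i ≡ 0ℤ) → (∀ i → t i ≡ u i + v i) →
           ∀ N → gf e N ≡ gf c N + gf d N
  gf-sum {u = u} {v} {t} b c d e zu zv s N =
    trans (gf-irr e (cov-sub b zt) N) (trans (gf-+ b {u} {v} {t} zu zv zt s N)
      (cong₂ _+_ (gf-irr (cov-sub b zu) c N) (gf-irr (cov-sub b zv) d N)))
    where
    zt : ∀ i → _ → t i ≡ 0ℤ
    zt i z = trans (s i) (cong₂ _+_ (zu i z) (zv i z))

  -- The ring of power series.

  -- Convolution by recursion on the degree, so that the ring laws are one-line inductions.
  infixl 7 _⊛_
  _⊛_ : Series → Series → Series
  (f ⊛ g) zero    = f 0 * g 0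
  (f ⊛ g) (suc n) = f 0 * g (suc n) + ((f ∘ suc) ⊛ g) n

  infixl 6 _⊞_
  _⊞_ : Series → Series → Series
  (f ⊞ g) n = f n + g n

  ⊟_ : Series → Series
  (⊟ f) n = - f n

  𝟎 𝟏 : Series
  𝟎 n = 0ℤ
  𝟏 zero    = 1ℤ
  𝟏 (suc n) = 0ℤ

  infixl 7 _·_
  _·_ : ℤ → Series → Series
  (k · f) n = k * f n

  ⊛-cong≤ : ∀ {f f′ g g′} N → (∀ k → k ℕ.≤ N → f k ≡ f′ k) → (∀ k → k ℕ.≤ N → g k ≡ g′ k) →
            (f ⊛ g) N ≡ (f′ ⊛ g′) N
  ⊛-cong≤ zero    p q = cong₂ _*_ (p 0 z≤n) (q 0 z≤n)
  ⊛-cong≤ (suc N) p q = cong₂ _+_ (cong₂ _*_ (p 0 z≤n) (q (suc N) ℕP.≤-refl))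
    (⊛-cong≤ N (λ k le → p (suc k) (s≤s le)) (λ k le → q k (ℕP.m≤n⇒m≤1+n le)))

  ⊛-cong : ∀ {f f′ g g′} → f ≈ f′ → g ≈ g′ → f ⊛ g ≈ f′ ⊛ g′
  ⊛-cong p q N = ⊛-cong≤ N (λ k _ → p k) (λ k _ → q k)

  ⊛-distribʳ : ∀ f g h → (g ⊞ h) ⊛ f ≈ g ⊛ f ⊞ h ⊛ f
  ⊛-distribʳ f g h zero    = ℤP.*-distribʳ-+ (f 0) (g 0) (h 0)
  ⊛-distribʳ f g h (suc n) = trans (cong₂ _+_ (ℤP.*-distribʳ-+ (f (suc n)) (g 0) (h 0))
      (⊛-distribʳ f (g ∘ suc) (h ∘ suc) n))
    (lemma (g 0 * f (suc n)) (h 0 * f (suc n)) (((g ∘ suc) ⊛ f) n) (((h ∘ suc) ⊛ f) n))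
    where
    lemma : ∀ a b c d → a + b + (c + d) ≡ a + c + (b + d)
    lemma = solve-∀

  ⊛-suc : ∀ f g n → (f ⊛ g) (suc n) ≡ (f ⊛ (g ∘ suc)) n + f (suc n) * g 0
  ⊛-suc f g zero    = refl
  ⊛-suc f g (suc n) = trans (+-congʳ (f 0 * g (suc (suc n))) (⊛-suc (f ∘ suc) g n))
    (sym (ℤP.+-assoc (f 0 * g (suc (suc n))) _ _))

  ⊛-comm : ∀ f g → f ⊛ g ≈ g ⊛ f
  ⊛-comm f g zero    = ℤP.*-comm (f 0) (g 0)
  ⊛-comm f g (suc n) = trans (+-congʳ (f 0 * g (suc n)) (⊛-comm (f ∘ suc) g n))
    (trans (trans (ℤP.+-comm (f 0 * g (suc n)) _) (+-congʳ ((g ⊛ (f ∘ suc)) n) (ℤP.*-comm (f 0) (g (suc n)))))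
      (sym (⊛-suc g f n)))

  ⊛-scaleˡ : ∀ k f g → (k · f) ⊛ g ≈ k · (f ⊛ g)
  ⊛-scaleˡ k f g zero    = ℤP.*-assoc k (f 0) (g 0)
  ⊛-scaleˡ k f g (suc n) = trans (cong₂ _+_ (ℤP.*-assoc k (f 0) (g (suc n))) (⊛-scaleˡ k (f ∘ suc) g n))
    (sym (ℤP.*-distribˡ-+ k (f 0 * g (suc n)) _))

  ⊛-assoc : ∀ f g h → (f ⊛ g) ⊛ h ≈ f ⊛ (g ⊛ h)
  ⊛-assoc f g h zero    = ℤP.*-assoc (f 0) (g 0) (h 0)
  ⊛-assoc f g h (suc n) = begin
    f 0 * g 0 * h (suc n) + ((f 0 · (g ∘ suc) ⊞ (f ∘ suc) ⊛ g) ⊛ h) n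
      ≡⟨ +-congʳ (f 0 * g 0 * h (suc n)) (trans (⊛-distribʳ h (f 0 · (g ∘ suc)) ((f ∘ suc) ⊛ g) n)
           (cong₂ _+_ (⊛-scaleˡ (f 0) (g ∘ suc) h n) (⊛-assoc (f ∘ suc) g h n))) ⟩
    f 0 * g 0 * h (suc n) + (f 0 * ((g ∘ suc) ⊛ h) n + ((f ∘ suc) ⊛ (g ⊛ h)) n)
      ≡⟨ lemma (f 0) (g 0) (h (suc n)) (((g ∘ suc) ⊛ h) n) (((f ∘ suc) ⊛ (g ⊛ h)) n) ⟩
    f 0 * (g 0 * h (suc n) + ((g ∘ suc) ⊛ h) n) + ((f ∘ suc) ⊛ (g ⊛ h)) n ∎
    where
    open ≡-Reasoning
    lemma : ∀ a b c x y → a * b * c + (a * x + y) ≡ a * (b * c + x) + y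
    lemma = solve-∀

  ⊛-zeroˡ : ∀ g → 𝟎 ⊛ g ≈ 𝟎
  ⊛-zeroˡ g zero    = refl
  ⊛-zeroˡ g (suc n) = trans (ℤP.+-identityˡ _) (⊛-zeroˡ g n)

  ⊛-identityˡ : ∀ g → 𝟏 ⊛ g ≈ g
  ⊛-identityˡ g zero    = ℤP.*-identityˡ (g 0)
  ⊛-identityˡ g (suc n) = trans (cong₂ _+_ (ℤP.*-identityˡ (g (suc n))) (⊛-zeroˡ g n)) (ℤP.+-identityʳ (g (suc n)))

  ≈-isEquivalence : IsEquivalence _≈_
  ≈-isEquivalence = record { refl = λ _ → refl ; sym = λ p n → sym (p n) ; trans = λ p q n → trans (p n) (q n) }

  ⊛-identityʳ : ∀ g → g ⊛ 𝟏 ≈ g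
  ⊛-identityʳ g n = trans (⊛-comm g 𝟏 n) (⊛-identityˡ g n)

  ⊛-distribˡ : ∀ f g h → f ⊛ (g ⊞ h) ≈ f ⊛ g ⊞ f ⊛ h
  ⊛-distribˡ f g h n = trans (⊛-comm f (g ⊞ h) n) (trans (⊛-distribʳ f g h n) (cong₂ _+_ (⊛-comm g f n) (⊛-comm h f n)))

  seriesRing : CommutativeRing _ _
  seriesRing = record
    { Carrier = Series ; _≈_ = _≈_ ; _+_ = _⊞_ ; _*_ = _⊛_ ; -_ = ⊟_ ; 0# = 𝟎 ; 1# = 𝟏
    ; isCommutativeRing = record
      { isRing = record
        { +-isAbelianGroup = record
          { isGroup = record
            { isMonoid = record
              { isSemigroup = record
                { isMagma = record { isEquivalence = ≈-isEquivalence ; ∙-cong = λ p q n → cong₂ _+_ (p n) (q n) }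
                ; assoc = λ f g h n → ℤP.+-assoc (f n) (g n) (h n) }
              ; identity = (λ f n → ℤP.+-identityˡ (f n)) , (λ f n → ℤP.+-identityʳ (f n)) }
            ; inverse = (λ f n → ℤP.+-inverseˡ (f n)) , (λ f n → ℤP.+-inverseʳ (f n))
            ; ⁻¹-cong = λ p n → cong -_ (p n) }
          ; comm = λ f g n → ℤP.+-comm (f n) (g n) }
        ; *-cong = ⊛-cong
        ; *-assoc = ⊛-assoc
        ; *-identity = ⊛-identityˡ , ⊛-identityʳ
        ; distrib = ⊛-distribˡ , ⊛-distribʳ }
      ; *-comm = ⊛-comm } }

  module ≈-Reasoning = SetoidReasoning (CommutativeRing.setoid seriesRing)
  open CommutativeRing seriesRing public using () renaming (refl to ≈-refl; sym to ≈-sym; trans to ≈-trans; +-cong to ⊞-cong; -‿cong to ⊟-cong)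

  module SeriesSolver = NaturalSolver (CommutativeRing.commutativeSemiring seriesRing)
  open SeriesSolver public using (solve; _:=_; _:+_; _:*_)

  conv-sumˡ : {I : Set} (h : I → Series) (g : Series) (L : List I) (N : ℕ) →
              ((λ k → sumL (λ i → h i k) L) ⊛ g) N ≡ sumL (λ i → (h i ⊛ g) N) L
  conv-sumˡ h g []      N = ⊛-zeroˡ g N
  conv-sumˡ h g (x ∷ L) N = trans (⊛-distribʳ g (h x) (λ k → sumL (λ i → h i k) L) N) (+-congʳ ((h x ⊛ g) N) (conv-sumˡ h g L N))

  conv-sumʳ : {I : Set} (f : Series) (h : I → Series) (L : List I) (N : ℕ) →
              (f ⊛ (λ k → sumL (λ i → h i k) L)) N ≡ sumL (λ i → (f ⊛ h i) N) L
  conv-sumʳ f h L N = trans (⊛-comm f (λ k → sumL (λ i → h i k) L) N)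
    (trans (conv-sumˡ h f L N) (sumL-cong (λ i → ⊛-comm (h i) f N) L))

  mono : ℕ → Series
  mono a N = ind (+ a) N

  mono-⊛ : ∀ a b N → (mono a ⊛ mono b) N ≡ mono (a ℕ.+ b) N
  mono-⊛ zero    b zero    = ℤP.*-identityˡ (mono b 0)
  mono-⊛ zero    b (suc N) = trans (cong₂ _+_ (ℤP.*-identityˡ (mono b (suc N))) (⊛-zeroˡ (mono b) N)) (ℤP.+-identityʳ (mono b (suc N)))
  mono-⊛ (suc a) b zero    = refl
  mono-⊛ (suc a) b (suc N) = trans (ℤP.+-identityˡ _) (mono-⊛ a b N)

  module _ {I J : Set} {w E : I → ℤ} {v F : J → ℤ} (c : Cov w E) (d : Cov v F) where
    private
      module C = Cov c
      module D = Cov d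

      le-split : ∀ {x y : ℤ} {a b N} → x ≡ + a → y ≡ + b → x + y ≤ + N → x ≤ + N × y ≤ + N
      le-split {a = a} {b} refl refl (+≤+ le) =
        +≤+ (ℕP.≤-trans (ℕP.m≤m+n a b) le) , +≤+ (ℕP.≤-trans (ℕP.m≤n+m b a) le)

    cov-⊗ : Cov (λ (i , j) → w i * v j) (λ (i , j) → E i + F j)
    cov-⊗ = record
      { nonneg = λ (i , j) nz → let (a , p) = C.nonneg i (≢0-*ˡ nz) ; (b , q) = D.nonneg j (≢0-*ʳ {w i} nz) in
                   a ℕ.+ b , cong₂ _+_ p q
      ; list = λ N → cartesianProduct (C.list N) (D.list N)
      ; uniq = λ N → UniqueP.cartesianProduct⁺ (C.uniq N) (D.uniq N)
      ; covers = λ N (i , j) nz le →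
          let nzi = ≢0-*ˡ nz ; nzj = ≢0-*ʳ {w i} nz
              (p , q) = le-split (proj₂ (C.nonneg i nzi)) (proj₂ (D.nonneg j nzj)) le
          in MemP.∈-cartesianProduct⁺ (C.covers N i nzi p) (D.covers N j nzj q) }

    gf-⊗ : gf cov-⊗ ≈ gf c ⊛ gf d
    gf-⊗ N = begin
      gf cov-⊗ N
        ≡⟨ trans (gf-def cov-⊗ N) (sumL-cartesian _ (C.list N) (D.list N)) ⟩
      sumL (λ i → sumL (λ j → w i * v j * ind (E i + F j) N) (D.list N)) (C.list N)
        ≡⟨ sumL-cong (λ i → sumL-cong (λ j → term i j) (D.list N)) (C.list N) ⟩
      sumL (λ i → sumL (λ j → ((w i · e i) ⊛ (v j · f j)) N) (D.list N)) (C.list N)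
        ≡⟨ sumL-cong (λ i → sym (conv-sumʳ (w i · e i) (λ j → v j · f j) (D.list N) N)) (C.list N) ⟩
      sumL (λ i → ((w i · e i) ⊛ (λ k → sumL (λ j → v j * f j k) (D.list N))) N) (C.list N)
        ≡⟨ sym (conv-sumˡ (λ i → w i · e i) _ (C.list N) N) ⟩
      ((λ k → sumL (λ i → w i * e i k) (C.list N)) ⊛ (λ k → sumL (λ j → v j * f j k) (D.list N))) N
        -- The lists chosen for N also compute every lower coefficient, because `covers` speaks of
        -- all exponents up to N.
        ≡⟨ ⊛-cong≤ N
             (λ k le → coef c k (C.list N) (C.uniq N) (λ i nz e → C.covers N i nz (ℤP.≤-trans (ℤP.≤-reflexive e) (+≤+ le))))
             (λ k le → coef d k (D.list N) (D.uniq N) (λ j nz e → D.covers N j nz (ℤP.≤-trans (ℤP.≤-reflexive e) (+≤+ le)))) ⟩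
      (gf c ⊛ gf d) N ∎
      where
      open ≡-Reasoning
      e : I → Series
      e i = ind (E i)
      f : J → Series
      f j = ind (F j)
      ⊛-scaleʳ : ∀ k g h → g ⊛ (k · h) ≈ k · (g ⊛ h)
      ⊛-scaleʳ k g h n = trans (⊛-comm g (k · h) n) (trans (⊛-scaleˡ k h g n) (cong (k *_) (⊛-comm h g n)))
      scaled : ∀ i j → ((w i · e i) ⊛ (v j · f j)) N ≡ w i * (v j * (e i ⊛ f j) N)
      scaled i j = trans (⊛-scaleˡ (w i) (e i) (v j · f j) N) (cong (w i *_) (⊛-scaleʳ (v j) (e i) (f j) N))
      term : ∀ i j → w i * v j * ind (E i + F j) N ≡ ((w i · e i) ⊛ (v j · f j)) N
      -- Exponents are known to be nonnegative only where the weight is nonzero, so a vanishing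
      -- weight has to be treated separately.
      term i j with w i ≟ 0ℤ | v j ≟ 0ℤ
      ... | yes p | _     = trans (cong (λ z → z * v j * ind (E i + F j) N) p) (sym (trans (scaled i j) (cong (λ z → z * (v j * (e i ⊛ f j) N)) p)))
      ... | no _  | yes q = trans (cong (λ z → w i * z * ind (E i + F j) N) q)
                             (trans (cong (_* ind (E i + F j) N) (ℤP.*-zeroʳ (w i))) (sym (trans (scaled i j)
                               (trans (cong (λ z → w i * (z * (e i ⊛ f j) N)) q) (ℤP.*-zeroʳ (w i))))))
      ... | no p  | no q with C.nonneg i p | D.nonneg j q
      ...   | a , ea | b , eb = trans (ℤP.*-assoc (w i) (v j) _) (trans (cong (λ z → w i * (v j * z)) conv) (sym (scaled i j)))
        where
        conv : ind (E i + F j) N ≡ (e i ⊛ f j) N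
        conv = trans (cong (λ z → ind z N) (cong₂ _+_ ea eb)) (trans (sym (mono-⊛ a b N))
          (⊛-cong (λ k → cong (λ z → ind z k) (sym ea)) (λ k → cong (λ z → ind z k) (sym eb)) N))

  -- The derivation q d/dq and logarithmic derivatives.

  gf-scale : {I : Set} {w E v : I → ℤ} (k : ℤ) (c : Cov w E) (d : Cov v E) → (∀ i → v i ≡ k * w i) → gf d ≈ k · gf c
  gf-scale {w = w} {E} {v} k c d e N = begin
    gf d N ≡⟨ gf-irr d (cov-sub c z) N ⟩
    gf (cov-sub c z) N ≡⟨ gf-def (cov-sub c z) N ⟩
    sumL (λ i → v i * ind (E i) N) (Cov.list c N) ≡⟨ sumL-cong (λ i → trans (cong (_* ind (E i) N) (e i)) (ℤP.*-assoc k (w i) _)) (Cov.list c N) ⟩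
    sumL (λ i → k * (w i * ind (E i) N)) (Cov.list c N) ≡⟨ trans (sumL-* k _ (Cov.list c N)) (cong (k *_) (sym (gf-def c N))) ⟩
    k * gf c N ∎
    where
    open ≡-Reasoning
    z : ∀ i → w i ≡ 0ℤ → _ ≡ 0ℤ
    z i p = trans (e i) (trans (cong (k *_) p) (ℤP.*-zeroʳ k))

  -- D f = q·df/dq
  D : Series → Series
  D f n = + n * f n

  gf-D : {I : Set} {w E v : I → ℤ} (c : Cov w E) (d : Cov v E) → (∀ i → v i ≡ E i * w i) → gf d ≈ D (gf c)
  gf-D {w = w} {E} {v} c d e N = begin
    gf d N ≡⟨ gf-irr d (cov-sub c z) N ⟩
    gf (cov-sub c z) N ≡⟨ gf-def (cov-sub c z) N ⟩
    sumL (λ i → v i * ind (E i) N) (Cov.list c N) ≡⟨ sumL-cong term (Cov.list c N) ⟩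
    sumL (λ i → + N * (w i * ind (E i) N)) (Cov.list c N) ≡⟨ trans (sumL-* (+ N) _ (Cov.list c N)) (cong (λ z → + N * z) (sym (gf-def c N))) ⟩
    + N * gf c N ∎
    where
    open ≡-Reasoning
    z : ∀ i → w i ≡ 0ℤ → _ ≡ 0ℤ
    z i p = trans (e i) (trans (cong (E i *_) p) (ℤP.*-zeroʳ (E i)))
    term : ∀ i → v i * ind (E i) N ≡ + N * (w i * ind (E i) N)
    term i with E i ≟ + N
    ... | yes p = trans (cong (_* 1ℤ) (trans (e i) (cong (_* w i) p))) (ℤP.*-assoc (+ N) (w i) 1ℤ)
    ... | no _  = trans (ℤP.*-zeroʳ (v i)) (sym (trans (cong (λ z → + N * z) (ℤP.*-zeroʳ (w i))) (ℤP.*-zeroʳ (+ N))))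

  D-⊛ : ∀ f g → D (f ⊛ g) ≈ D f ⊛ g ⊞ f ⊛ D g
  D-⊛ f g zero    = lemma (f 0) (g 0)
    where
    lemma : ∀ a b → 0ℤ * (a * b) ≡ 0ℤ * a * b + a * (0ℤ * b)
    lemma = solve-∀
  D-⊛ f g (suc n) = begin
    + suc n * (f 0 * g (suc n) + S) ≡⟨ lemma₁ (+ n) (f 0) (g (suc n)) S ⟩
    0ℤ * f 0 * g (suc n) + f 0 * (+ suc n * g (suc n)) + (+ n * S + S)
      ≡⟨ +-congʳ (0ℤ * f 0 * g (suc n) + f 0 * (+ suc n * g (suc n))) (cong (_+ S) (D-⊛ (f ∘ suc) g n)) ⟩
    0ℤ * f 0 * g (suc n) + f 0 * (+ suc n * g (suc n)) + ((D (f ∘ suc) ⊛ g) n + ((f ∘ suc) ⊛ D g) n + S)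
      ≡⟨ lemma₂ (0ℤ * f 0 * g (suc n)) (f 0 * (+ suc n * g (suc n))) ((D (f ∘ suc) ⊛ g) n) (((f ∘ suc) ⊛ D g) n) S ⟩
    (0ℤ * f 0 * g (suc n) + ((D (f ∘ suc) ⊛ g) n + S)) + (f 0 * (+ suc n * g (suc n)) + ((f ∘ suc) ⊛ D g) n)
      ≡⟨ cong (λ z → 0ℤ * f 0 * g (suc n) + z + (f 0 * (+ suc n * g (suc n)) + ((f ∘ suc) ⊛ D g) n)) shift ⟩
    (D f ⊛ g) (suc n) + (f ⊛ D g) (suc n) ∎
    where
    open ≡-Reasoning
    S = ((f ∘ suc) ⊛ g) n
    lemma₁ : ∀ n a b s → (1ℤ + n) * (a * b + s) ≡ 0ℤ * a * b + a * ((1ℤ + n) * b) + (n * s + s)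
    lemma₁ = solve-∀
    lemma₂ : ∀ a b x y s → a + b + (x + y + s) ≡ a + (x + s) + (b + y)
    lemma₂ = solve-∀
    shift : (D (f ∘ suc) ⊛ g) n + S ≡ ((D f ∘ suc) ⊛ g) n
    shift = trans (sym (⊛-distribʳ g (D (f ∘ suc)) (f ∘ suc) n))
      (⊛-cong {f = D (f ∘ suc) ⊞ (f ∘ suc)} (λ k → lemma₃ (+ k) (f (suc k))) (λ _ → refl) n)
      where
      lemma₃ : ∀ k a → k * a + a ≡ (1ℤ + k) * a
      lemma₃ = solve-∀

  -- Since h has constant term 1, the coefficient of a product with h at n + 1 is the coefficient of
  -- the other factor there plus terms in its lower coefficients; strong induction then determines
  -- that factor.
  ⊛-cancelʳ : ∀ f g h → h 0 ≡ 1ℤ → f ⊛ h ≈ g ⊛ h → f ≈ g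
  ⊛-cancelʳ f g h h0 e n = agree n n ℕP.≤-refl
    where
    open ≡-Reasoning
    top : ∀ f n → (f ⊛ h) (suc n) ≡ (f ⊛ (h ∘ suc)) n + f (suc n)
    top f n = trans (⊛-suc f h n) (+-congʳ ((f ⊛ (h ∘ suc)) n) (trans (cong (f (suc n) *_) h0) (ℤP.*-identityʳ (f (suc n)))))
    agree : ∀ N k → k ℕ.≤ N → f k ≡ g k
    agree N zero le = begin
      f 0       ≡⟨ sym (ℤP.*-identityʳ (f 0)) ⟩
      f 0 * 1ℤ  ≡⟨ cong (f 0 *_) (sym h0) ⟩
      f 0 * h 0 ≡⟨ e 0 ⟩
      g 0 * h 0 ≡⟨ cong (g 0 *_) h0 ⟩
      g 0 * 1ℤ  ≡⟨ ℤP.*-identityʳ (g 0) ⟩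
      g 0       ∎
    agree (suc N) (suc k) (s≤s le) = +-cancelˡ ((g ⊛ (h ∘ suc)) k) (f (suc k)) (g (suc k)) (begin
      (g ⊛ (h ∘ suc)) k + f (suc k) ≡⟨ cong (_+ f (suc k)) (⊛-cong≤ {g} {f} {h ∘ suc} {h ∘ suc} k
                                         (λ j lj → sym (agree N j (ℕP.≤-trans lj le))) (λ _ _ → refl)) ⟩
      (f ⊛ (h ∘ suc)) k + f (suc k) ≡⟨ sym (top f k) ⟩
      (f ⊛ h) (suc k)               ≡⟨ e (suc k) ⟩
      (g ⊛ h) (suc k)               ≡⟨ top g k ⟩
      (g ⊛ (h ∘ suc)) k + g (suc k) ∎)

  -- With `c 0` zero, the equation expresses n · f n through the coefficients of f below n, and n
  -- can be cancelled in ℤ. This lemma replaces every comparison of infinite products.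
  logDer-unique : ∀ f g c → f 0 ≡ g 0 → c 0 ≡ 0ℤ → D f ≈ f ⊛ c → D g ≈ g ⊛ c → f ≈ g
  logDer-unique f g c e c0 p q n = agree n n ℕP.≤-refl
    where
    open ≡-Reasoning
    top : ∀ f n → (f ⊛ c) (suc n) ≡ (f ⊛ (c ∘ suc)) n
    top f n = trans (⊛-suc f c n) (trans (+-congʳ ((f ⊛ (c ∘ suc)) n) (trans (cong (f (suc n) *_) c0) (ℤP.*-zeroʳ (f (suc n))))) (ℤP.+-identityʳ _))
    agree : ∀ N k → k ℕ.≤ N → f k ≡ g k
    agree N zero le = e
    agree (suc N) (suc k) (s≤s le) = ℤP.*-cancelˡ-≡ (+ suc k) (f (suc k)) (g (suc k)) (begin
      + suc k * f (suc k)  ≡⟨ p (suc k) ⟩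
      (f ⊛ c) (suc k)      ≡⟨ top f k ⟩
      (f ⊛ (c ∘ suc)) k    ≡⟨ ⊛-cong≤ {f} {g} {c ∘ suc} {c ∘ suc} k (λ j lj → agree N j (ℕP.≤-trans lj le)) (λ _ _ → refl) ⟩
      (g ⊛ (c ∘ suc)) k    ≡⟨ sym (top g k) ⟩
      (g ⊛ c) (suc k)      ≡⟨ sym (q (suc k)) ⟩
      + suc k * g (suc k)  ∎)

  logDer-⊛ : ∀ {f g c d} → D f ≈ f ⊛ c → D g ≈ g ⊛ d → D (f ⊛ g) ≈ (f ⊛ g) ⊛ (c ⊞ d)
  logDer-⊛ {f} {g} {c} {d} p q = begin
    D (f ⊛ g)                     ≈⟨ D-⊛ f g ⟩
    D f ⊛ g ⊞ f ⊛ D g             ≈⟨ ⊞-cong (⊛-cong p ≈-refl) (⊛-cong {f = f} ≈-refl q) ⟩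
    (f ⊛ c) ⊛ g ⊞ f ⊛ (g ⊛ d)     ≈⟨ lemma f g c d ⟩
    (f ⊛ g) ⊛ (c ⊞ d)             ∎
    where
    open ≈-Reasoning
    lemma : ∀ f g c d → (f ⊛ c) ⊛ g ⊞ f ⊛ (g ⊛ d) ≈ (f ⊛ g) ⊛ (c ⊞ d)
    lemma = solve 4 (λ f g c d → f :* c :* g :+ f :* (g :* d) := (f :* g) :* (c :+ d)) ≈-refl

  -- The reflection symmetry of a theta series multiplied by its poles.

  flip : ℤ → ℤ
  flip (+ p)    = -[1+ p ]
  flip -[1+ p ] = + p

  σ : ℕ → ℤ
  σ zero    = 1ℤ
  σ (suc n) = - σ n

  dbl : ℕ → ℕ
  dbl zero    = zero
  dbl (suc n) = suc (suc (dbl n))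

  +dbl : ∀ n → + dbl n ≡ + n + + n
  +dbl n = cong +_ (dbl≡ n)
    where
    dbl≡ : ∀ n → dbl n ≡ n ℕ.+ n
    dbl≡ zero    = refl
    dbl≡ (suc n) = cong suc (trans (cong suc (dbl≡ n)) (sym (ℕP.+-suc n n)))

  σ-dbl : ∀ n m → σ (dbl n ℕ.+ m) ≡ σ m
  σ-dbl zero    m = refl
  σ-dbl (suc n) m = trans (ℤP.neg-involutive _) (σ-dbl n m)

  -- The position of d relative to 2r: below (2r < d, with d = 2r + 1 + d′), on it, or above it
  -- (2r > d, with d = 2a + 1 or d = 2b, and r = a + b + 1).
  data Region : Set where
    below    : ℕ → Region
    on       : ℕ → Region
    oddAbove evenAbove : ℕ → ℕ → Region

  shift : Region → Region
  shift (below x)       = below x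
  shift (on r)          = on (suc r)
  shift (oddAbove a b)  = oddAbove (suc a) b
  shift (evenAbove a b) = evenAbove a (suc b)

  region⁺ : ℕ → ℕ → Region
  region⁺ zero          zero    = on 0
  region⁺ zero          (suc p) = evenAbove p 0
  region⁺ (suc zero)    zero    = below 0
  region⁺ (suc zero)    (suc p) = oddAbove 0 p
  region⁺ (suc (suc d)) zero    = below (suc d)
  region⁺ (suc (suc d)) (suc p) = shift (region⁺ d p)

  region : ℕ → ℤ → Region
  region d (+ p)    = region⁺ d p
  -- For r = -1 - p the partner d - 2r - 1 equals 2p + d + 1, which is never negative.
  region d -[1+ p ] = below (dbl p ℕ.+ suc d)

  Located : Region → ℕ → ℕ → Set
  Located (below x)       d p = d ≡ dbl p ℕ.+ suc x
  Located (on r)          d p = d ≡ dbl r × p ≡ r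
  Located (oddAbove a b)  d p = d ≡ suc (dbl a) × p ≡ suc (a ℕ.+ b)
  Located (evenAbove a b) d p = d ≡ dbl b × p ≡ suc (b ℕ.+ a)

  located : ∀ d p → Located (region⁺ d p) d p
  located zero          zero    = refl , refl
  located zero          (suc p) = refl , refl
  located (suc zero)    zero    = refl
  located (suc zero)    (suc p) = refl , refl
  located (suc (suc d)) zero    = refl
  located (suc (suc d)) (suc p) with region⁺ d p | located d p
  ... | below x       | e     = cong (λ z → suc (suc z)) e
  ... | on r          | e , f = cong (λ z → suc (suc z)) e , cong suc f
  ... | oddAbove a b  | e , f = cong (λ z → suc (suc z)) e , cong suc f
  ... | evenAbove a b | e , f = cong (λ z → suc (suc z)) e , cong suc f

  region-below : ∀ x p → region⁺ (dbl p ℕ.+ suc x) p ≡ below x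
  region-below zero    zero    = refl
  region-below (suc x) zero    = refl
  region-below x       (suc p) = cong shift (region-below x p)

  region-on : ∀ r → region⁺ (dbl r) r ≡ on r
  region-on zero    = refl
  region-on (suc r) = cong shift (region-on r)

  region-odd : ∀ a b → region⁺ (suc (dbl a)) (suc (a ℕ.+ b)) ≡ oddAbove a b
  region-odd zero    b = refl
  region-odd (suc a) b = cong shift (region-odd a b)

  region-even : ∀ a b → region⁺ (dbl b) (suc (b ℕ.+ a)) ≡ evenAbove a b
  region-even a zero    = refl
  region-even a (suc b) = cong shift (region-even a b)

  below-flip : ∀ d r d′ → region d r ≡ below d′ → region d′ (flip r) ≡ below d
  below-flip d (+ p) d′ e = cong below (sym (subst (λ t → Located t d p) e (located d p)))
  below-flip d -[1+ p ] .(dbl p ℕ.+ suc d) refl = region-below d p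

  below-≡ : ∀ d r d′ → region d r ≡ below d′ → + d ≡ r + r + 1ℤ + + d′
  below-≡ d (+ p) d′ e = trans (cong +_ (subst (λ t → Located t d p) e (located d p)))
    (trans (cong (_+ + suc d′) (+dbl p)) (sym (ℤP.+-assoc (+ p + + p) 1ℤ (+ d′))))
  below-≡ d -[1+ p ] .(dbl p ℕ.+ suc d) refl = sym (trans (cong (λ z → -[1+ p ] + -[1+ p ] + 1ℤ + (z + + suc d)) (+dbl p)) (lemma (+ p) (+ d)))
    where
    lemma : ∀ p d → - (1ℤ + p) + - (1ℤ + p) + 1ℤ + (p + p + (1ℤ + d)) ≡ d
    lemma = solve-∀

  -- d + d′ + 1 = 2(d - r) is even, so the parities of d and d′ differ. This is the sign that makes
  -- the reflected terms cancel.
  below-σ : ∀ d r d′ → region d r ≡ below d′ → σ d′ ≡ - σ d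
  below-σ d (+ p) d′ e = sym (trans (cong (-_ ∘ σ) (subst (λ t → Located t d p) e (located d p)))
    (trans (cong -_ (σ-dbl p (suc d′))) (ℤP.neg-involutive (σ d′))))
  below-σ d -[1+ p ] .(dbl p ℕ.+ suc d) refl = σ-dbl p (suc d)

  -- The match makes the series equal to its own negative, and ℤ has no 2-torsion.
  involution-zero : {I : Set} {w E : I → ℤ} (c : Cov w E) → Match w E (λ i → - w i) E → gf c ≈ 𝟎
  involution-zero {w = w} {E} c m N = double-zero (gf c N) (trans (gf-match c m neg N)
      (trans (gf-scale -1ℤ c neg (λ i → sym (ℤP.-1*i≡-i (w i))) N) (ℤP.-1*i≡-i (gf c N))))
    where
    neg : Cov (λ i → - w i) E
    neg = cov-sub c (λ i z → cong -_ z)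
    double-zero : ∀ x → x ≡ - x → x ≡ 0ℤ
    double-zero (+ zero) e = refl
    double-zero (+ suc n) ()
    double-zero -[1+ n ] ()

  sgn : ℤ → ℤ
  sgn (+ _)    = 1ℤ
  sgn -[1+ _ ] = -1ℤ

  -- The signed step δ = ±(d + 1). It takes the sign of k so that δ(αk + β) is positive for 0 < β <
  -- α: each pole is expanded as a geometric series in the direction in which it converges.
  toward : ℤ → ℕ → ℤ
  toward (+ _)    d = + suc d
  toward -[1+ _ ] d = -[1+ d ]

  -- k ≥ 0 is sent to k + 1, so that the sign of the result records the sign of k.
  out : ℤ → ℕ → ℤ
  out (+ j)    r = + suc (r ℕ.+ j)
  out -[1+ j ] r = -[1+ r ℕ.+ j ]

  inn : ℤ → ℤ
  inn (+ j)    = + j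
  inn -[1+ j ] = - + j

  away : ℤ → ℤ
  away (+ j)    = + suc j
  away -[1+ j ] = -[1+ suc j ]

  out-suc : ∀ k r → out k (suc r) ≡ out (away k) r
  out-suc (+ j)    r = cong (+_ ∘ suc) (sym (ℕP.+-suc r j))
  out-suc -[1+ j ] r = cong -[1+_] (sym (ℕP.+-suc r j))

  inn-away : ∀ k → inn (away k) ≡ out k 0
  inn-away (+ j)    = refl
  inn-away -[1+ j ] = refl

  σ-even : ∀ n → σ (dbl n) ≡ 1ℤ
  σ-even zero    = refl
  σ-even (suc n) = trans (ℤP.neg-involutive _) (σ-even n)

  module Reflection (α β : ℤ) where

    -- Twice the exponent α n(n-1)/2 + β n.
    thetaExp : ℤ → ℤ
    thetaExp n = α * (n * (n - 1ℤ)) + + 2 * (β * n)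

    poleExp : ℤ × ℕ → ℤ
    poleExp (k , d) = + 2 * (toward k d * (α * k + β))

    -- This is α |δ δ′|, where δ′ is the reflected step: above the boundary one of |δ|, |δ′| is the
    -- even number 2a + 2 and the other the odd number 2b + 1.
    lambertExp : ℕ × ℕ → ℤ
    lambertExp (a , b) = α * (+ 2 * (+ suc a * (1ℤ + (+ b + + b))))

    shiftedExp : ℤ × ℕ × ℤ → ℤ
    shiftedExp (+ j , d , r)      = thetaExp (+ j - r) + poleExp (+ j , d)
    shiftedExp (-[1+ j ] , d , r) = thetaExp (r - + j) + poleExp (-[1+ j ] , d)

    outExp : ℤ × ℕ → ℤ
    outExp (k , r) = thetaExp (out k r)

    aboveExp : ℤ × ℕ × ℕ → ℤ
    aboveExp (m , i) = thetaExp m + lambertExp i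

    -- The number m = n + δ, which the reflection leaves fixed.
    centre : ℤ × ℕ × ℤ → ℤ
    centre (+ j , d , r)      = + j - r + + suc d
    centre (-[1+ j ] , d , r) = r - + j + -[1+ d ]

    -- H is a discrete primitive of h. Two choices matter: h = 1 with H = id, which yields
    -- derivatives in z = q^β, and h the slope of `thetaExp` with H = `thetaExp`, which yields the
    -- derivation `D`.
    module _ (φ h H : ℤ → ℤ) (H0 : H 0ℤ ≡ 0ℤ) (Hs : ∀ m → H (1ℤ + m) ≡ H m + h m) where

      -- φ is taken at n + δ, not at n, so that it is constant along the reflection and may be
      -- arbitrary.
      poleWeight : ℤ × ℤ × ℕ → ℤ
      poleWeight (n , k , d) = φ (n + toward k d) * (σ (suc d) * (sgn k * h k))

      shiftedWeight : ℤ × ℕ × ℤ → ℤ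
      shiftedWeight i@(k , d , r) = φ (centre i) * (σ (suc d) * (sgn k * h k))

      to-shifted : Match poleWeight (λ (n , i) → thetaExp n + poleExp i) shiftedWeight shiftedExp
      to-shifted = bijection-match to from w-ok E-ok left right
        where
        to : ℤ × ℤ × ℕ → ℤ × ℕ × ℤ
        to (n , + j , d)      = + j , d , + j - n
        to (n , -[1+ j ] , d) = -[1+ j ] , d , + j + n
        from : ℤ × ℕ × ℤ → ℤ × ℤ × ℕ
        from (+ j , d , r)      = + j - r , + j , d
        from (-[1+ j ] , d , r) = r - + j , -[1+ j ] , d
        cancel₁ : ∀ j n → j - (j - n) ≡ n
        cancel₁ = solve-∀
        cancel₂ : ∀ j n → j + n - j ≡ n
        cancel₂ = solve-∀
        cancel₃ : ∀ j r → j + (r - j) ≡ r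
        cancel₃ = solve-∀
        w-ok : ∀ i → shiftedWeight (to i) ≡ poleWeight i
        w-ok (n , + j , d)      = cong (λ z → φ (z + + suc d) * (σ (suc d) * (1ℤ * h (+ j)))) (cancel₁ (+ j) n)
        w-ok (n , -[1+ j ] , d) = cong (λ z → φ (z + -[1+ d ]) * (σ (suc d) * (-1ℤ * h -[1+ j ]))) (cancel₂ (+ j) n)
        E-ok : ∀ i → shiftedExp (to i) ≡ thetaExp (proj₁ i) + poleExp (proj₂ i)
        E-ok (n , + j , d)      = cong (λ z → thetaExp z + poleExp (+ j , d)) (cancel₁ (+ j) n)
        E-ok (n , -[1+ j ] , d) = cong (λ z → thetaExp z + poleExp (-[1+ j ] , d)) (cancel₂ (+ j) n)
        left : ∀ i → from (to i) ≡ i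
        left (n , + j , d)      = cong (_, + j , d) (cancel₁ (+ j) n)
        left (n , -[1+ j ] , d) = cong (_, -[1+ j ] , d) (cancel₂ (+ j) n)
        right : ∀ i → to (from i) ≡ i
        right (+ j , d , r)      = cong (λ z → + j , d , z) (cancel₁ (+ j) r)
        right (-[1+ j ] , d , r) = cong (λ z → -[1+ j ] , d , z) (cancel₃ (+ j) r)

      isBelow isOn isFirst isSecond : ℤ → Region → ℤ
      isBelow k (below _) = 1ℤ
      isBelow k _         = 0ℤ
      isOn k (on _) = 1ℤ
      isOn k _      = 0ℤ
      isFirst (+ _)    (oddAbove _ _)  = 1ℤ
      isFirst -[1+ _ ] (evenAbove _ _) = 1ℤ
      isFirst _        _               = 0ℤ
      isSecond (+ _)    (evenAbove _ _) = 1ℤ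
      isSecond -[1+ _ ] (oddAbove _ _)  = 1ℤ
      isSecond _        _               = 0ℤ

      part : (ℤ → Region → ℤ) → ℤ × ℕ × ℤ → ℤ
      part t i@(k , d , r) = t k (region d r) * shiftedWeight i

      parts : ∀ i → shiftedWeight i ≡ part isBelow i + part isOn i + (part isFirst i + part isSecond i)
      parts i@(k , d , r) = trans (sym (ℤP.*-identityˡ (shiftedWeight i))) (trans (cong (_* shiftedWeight i) (sym (total k (region d r))))
          (distrib (isBelow k (region d r)) (isOn k (region d r)) (isFirst k (region d r)) (isSecond k (region d r)) (shiftedWeight i)))
        where
        total : ∀ k t → isBelow k t + isOn k t + (isFirst k t + isSecond k t) ≡ 1ℤ
        total (+ _)    (below _)       = refl
        total (+ _)    (on _)          = refl
        total (+ _)    (oddAbove _ _)  = refl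
        total (+ _)    (evenAbove _ _) = refl
        total -[1+ _ ] (below _)       = refl
        total -[1+ _ ] (on _)          = refl
        total -[1+ _ ] (oddAbove _ _)  = refl
        total -[1+ _ ] (evenAbove _ _) = refl
        distrib : ∀ a b c d w → (a + b + (c + d)) * w ≡ a * w + b * w + (c * w + d * w)
        distrib = solve-∀

      -- In the coordinate r = k - n for k ≥ 0, and r = n - k - 1 for k < 0, the reflection n ↦ 2k +
      -- 1 - n becomes r ↦ -1 - r in both cases.
      flip≡ : ∀ r → flip r ≡ - (1ℤ + r)
      flip≡ (+ p)    = refl
      flip≡ -[1+ zero ]  = refl
      flip≡ -[1+ suc p ] = refl

      flip-centre : ∀ k d r d′ → region d r ≡ below d′ → centre (k , d′ , flip r) ≡ centre (k , d , r)
      flip-centre (+ j) d r d′ e = trans (cong (λ z → + j - z + + suc d′) (flip≡ r))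
        (trans (lemma (+ j) r (+ d′)) (cong (λ z → + j - r + (1ℤ + z)) (sym (below-≡ d r d′ e))))
        where
        lemma : ∀ j r d′ → j - (- (1ℤ + r)) + (1ℤ + d′) ≡ j - r + (1ℤ + (r + r + 1ℤ + d′))
        lemma = solve-∀
      flip-centre -[1+ j ] d r d′ e = trans (cong (λ z → z - + j + -[1+ d′ ]) (flip≡ r))
        (trans (lemma (+ j) r (+ d′)) (cong (λ z → r - + j + - (1ℤ + z)) (sym (below-≡ d r d′ e))))
        where
        lemma : ∀ j r d′ → - (1ℤ + r) - j + - (1ℤ + d′) ≡ r - j + - (1ℤ + (r + r + 1ℤ + d′))
        lemma = solve-∀

      -- Expanding around m = n + δ leaves -α δ δ′, where δ′ is the step after reflection. This is
      -- symmetric in δ and δ′, so the exponent is invariant.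
      shiftedExp≡ : ∀ k d r → shiftedExp (k , d , r) ≡ thetaExp (centre (k , d , r)) + α * ((1ℤ + + d) * (+ 2 * r - + d))
      shiftedExp≡ (+ j) d r = lemma α β (+ j) (+ d) r
        where
        lemma : ∀ α β j d r → α * ((j - r) * (j - r - 1ℤ)) + + 2 * (β * (j - r)) + + 2 * ((1ℤ + d) * (α * j + β)) ≡
          α * ((j - r + (1ℤ + d)) * (j - r + (1ℤ + d) - 1ℤ)) + + 2 * (β * (j - r + (1ℤ + d))) + α * ((1ℤ + d) * (+ 2 * r - d))
        lemma = solve-∀
      shiftedExp≡ -[1+ j ] d r = lemma α β (+ j) (+ d) r
        where
        lemma : ∀ α β j d r → α * ((r - j) * (r - j - 1ℤ)) + + 2 * (β * (r - j)) + + 2 * (- (1ℤ + d) * (α * - (1ℤ + j) + β)) ≡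
          α * ((r - j + - (1ℤ + d)) * (r - j + - (1ℤ + d) - 1ℤ)) + + 2 * (β * (r - j + - (1ℤ + d))) + α * ((1ℤ + d) * (+ 2 * r - d))
        lemma = solve-∀

      flip-exp : ∀ k d r d′ → region d r ≡ below d′ → shiftedExp (k , d′ , flip r) ≡ shiftedExp (k , d , r)
      flip-exp k d r d′ e = trans (shiftedExp≡ k d′ (flip r)) (trans (cong₂ (λ c x → thetaExp c + α * x) (flip-centre k d r d′ e)
          (trans (cong (λ z → (1ℤ + + d′) * (+ 2 * z - + d′)) (flip≡ r)) (trans (lemma r (+ d′)) (cong (λ z → (1ℤ + z) * (+ 2 * r - z)) (sym (below-≡ d r d′ e))))))
        (sym (shiftedExp≡ k d r)))
        where
        lemma : ∀ r d′ → (1ℤ + d′) * (+ 2 * - (1ℤ + r) - d′) ≡ (1ℤ + (r + r + 1ℤ + d′)) * (+ 2 * r - (r + r + 1ℤ + d′))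
        lemma = solve-∀

      -- In the original coordinates this is n ↦ 2k + 1 - n, the symmetry that makes theta vanish at the pole k.
      below-match : Match (part isBelow) shiftedExp (λ i → - part isBelow i) shiftedExp
      below-match = record { to = to ; from = to ; to-ok = to-ok
                           ; from-ok = λ i nz → let (p , _ , q) = to-ok i (λ z → nz (cong -_ z)) in
                               trans (sym (ℤP.neg-involutive _)) (cong -_ p) , q }
        where
        move : ℤ → ℕ → ℤ → Region → ℤ × ℕ × ℤ
        move k d r (below d′)      = k , d′ , flip r
        move k d r (on _)          = k , d , r
        move k d r (oddAbove _ _)  = k , d , r
        move k d r (evenAbove _ _) = k , d , r
        to : ℤ × ℕ × ℤ → ℤ × ℕ × ℤ
        to (k , d , r) = move k d r (region d r)
        flip-flip : ∀ r → flip (flip r) ≡ r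
        flip-flip (+ _)    = refl
        flip-flip -[1+ _ ] = refl
        to-ok : ∀ i → part isBelow i ≢ 0ℤ → - part isBelow (to i) ≡ part isBelow i × shiftedExp (to i) ≡ shiftedExp i × to (to i) ≡ i
        to-ok i@(k , d , r) nz with region d r in e
        ... | on _          = contradiction refl nz
        ... | oddAbove _ _  = contradiction refl nz
        ... | evenAbove _ _ = contradiction refl nz
        ... | below d′ rewrite below-flip d r d′ e = weight-ok , flip-exp k d r d′ e , cong (λ z → k , d , z) (flip-flip r)
          where
          lemma : ∀ f s x → - (1ℤ * (f * (- (- s) * x))) ≡ 1ℤ * (f * (- s * x))
          lemma = solve-∀
          weight-ok : - (1ℤ * (φ (centre (k , d′ , flip r)) * (- σ d′ * (sgn k * h k)))) ≡ 1ℤ * (φ (centre (k , d , r)) * (- σ d * (sgn k * h k)))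
          weight-ok = trans (cong₂ (λ c s → - (1ℤ * (φ c * (- s * (sgn k * h k))))) (flip-centre k d r d′ e) (below-σ d r d′ e))
                            (lemma (φ (centre (k , d , r))) (σ d) (sgn k * h k))

      -- The boundary case δ′ = 0: here d = 2r, so d + 1 is odd, whence the minus sign.
      onWeight : ℤ × ℕ → ℤ
      onWeight (k , r) = - (φ (out k r) * (sgn k * h k))

      out≡ : ∀ k r → centre (k , dbl r , + r) ≡ out k r
      out≡ (+ j) r = trans (cong (λ z → + j - + r + (1ℤ + z)) (+dbl r)) (lemma (+ j) (+ r))
        where
        lemma : ∀ j r → j - r + (1ℤ + (r + r)) ≡ 1ℤ + (r + j)
        lemma = solve-∀
      out≡ -[1+ j ] r = trans (cong (λ z → + r - + j + - (1ℤ + z)) (+dbl r)) (lemma (+ j) (+ r))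
        where
        lemma : ∀ j r → r - j + - (1ℤ + (r + r)) ≡ - (1ℤ + (r + j))
        lemma = solve-∀

      on-match : Match (part isOn) shiftedExp onWeight outExp
      on-match = record { to = to ; from = from ; to-ok = to-ok ; from-ok = from-ok }
        where
        move : ℤ → Region → ℤ × ℕ
        move k (on r) = k , r
        move k _      = k , 0
        to : ℤ × ℕ × ℤ → ℤ × ℕ
        to (k , d , r) = move k (region d r)
        from : ℤ × ℕ → ℤ × ℕ × ℤ
        from (k , r) = k , dbl r , + r
        weight-ok : ∀ k r → onWeight (k , r) ≡ 1ℤ * shiftedWeight (k , dbl r , + r)
        weight-ok k r = trans (lemma (φ (out k r)) (sgn k * h k))
            (cong₂ (λ c s → 1ℤ * (φ c * (- s * (sgn k * h k)))) (sym (out≡ k r)) (sym (σ-even r)))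
          where
          lemma : ∀ f x → - (f * x) ≡ 1ℤ * (f * (-1ℤ * x))
          lemma = solve-∀
        exp-ok : ∀ k r → outExp (k , r) ≡ shiftedExp (k , dbl r , + r)
        exp-ok k r = sym (trans (shiftedExp≡ k (dbl r) (+ r)) (trans (cong₂ (λ c z → thetaExp c + α * ((1ℤ + z) * (+ 2 * + r - z))) (out≡ k r) (+dbl r))
            (lemma (outExp (k , r)) α (+ r))))
          where
          lemma : ∀ e α r → e + α * ((1ℤ + (r + r)) * (+ 2 * r - (r + r))) ≡ e
          lemma = solve-∀
        to-ok : ∀ i → part isOn i ≢ 0ℤ → onWeight (to i) ≡ part isOn i × outExp (to i) ≡ shiftedExp i × from (to i) ≡ i
        to-ok (k , d , r) nz with region d r in e
        to-ok (k , d , r) nz | below _       = contradiction refl nz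
        to-ok (k , d , r) nz | oddAbove _ _  = contradiction refl nz
        to-ok (k , d , r) nz | evenAbove _ _ = contradiction refl nz
        to-ok (k , d , -[1+ p ]) nz | on q with () ← e
        to-ok (k , d , + p) nz | on q with subst (λ t → Located t d p) e (located d p)
        ... | refl , refl = weight-ok k q , exp-ok k q , refl
        from-ok : ∀ j → onWeight j ≢ 0ℤ → part isOn (from j) ≡ onWeight j × to (from j) ≡ j
        from-ok (k , r) nz rewrite region-on r = sym (weight-ok k r) , refl

      -- On both sides the differences of H run outward from 0, so the only inner boundary value is
      -- `H 0ℤ`, which vanishes.
      step : ∀ k → sgn k * h k ≡ H (out k 0) - H (inn k)
      step (+ j) = trans (lemma (h (+ j)) (H (+ j))) (cong (_- H (+ j)) (sym (Hs (+ j))))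
        where
        lemma : ∀ a b → 1ℤ * a ≡ b + a - b
        lemma = solve-∀
      step -[1+ j ] = trans (lemma (h -[1+ j ]) (H -[1+ j ])) (cong (λ z → H -[1+ j ] - z) (sym (trans (cong H (shift-neg (+ j))) (Hs -[1+ j ]))))
        where
        lemma : ∀ a b → -1ℤ * a ≡ b - (b + a)
        lemma = solve-∀
        shift-neg : ∀ j → - j ≡ 1ℤ + - (1ℤ + j)
        shift-neg = solve-∀

      -- Since h is the difference of H, the sum over k telescopes.
      on-sum : (c : Cov onWeight outExp) (ρ : Cov (λ _ → 1ℤ) outExp) (t : Cov (λ m → φ m * H m) thetaExp) → gf c ≈ ⊟ gf t
      on-sum c ρ t N = begin
        gf c N                        ≡⟨ gf-irr c on-cov N ⟩
        gf on-cov N                   ≡⟨ gf-sum ρ neg-cov inn-cov on-cov (λ _ ()) (λ _ ()) split N ⟩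
        gf neg-cov N + gf inn-cov N
          ≡⟨ cong₂ _+_ (gf-scale -1ℤ out-cov neg-cov (λ i → sym (ℤP.-1*i≡-i (outer i))) N)
               (sym (gf-match later-cov later-match inn-cov N)) ⟩
        -1ℤ * gf out-cov N + gf later-cov N
          ≡⟨ cong (λ z → -1ℤ * z + gf later-cov N) (gf-sum ρ first-cov later-cov out-cov (λ _ ()) (λ _ ()) first+later N) ⟩
        -1ℤ * (gf first-cov N + gf later-cov N) + gf later-cov N
          ≡⟨ lemma (gf first-cov N) (gf later-cov N) ⟩
        - gf first-cov N ≡⟨ cong -_ (gf-match first-cov first-match t N) ⟩
        - gf t N ∎
        where
        open ≡-Reasoning
        outer inner first later : ℤ × ℕ → ℤ
        outer (k , r) = φ (out k r) * H (out k 0)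
        inner (k , r) = φ (out k r) * H (inn k)
        first (k , zero)  = φ (out k 0) * H (out k 0)
        first (k , suc r) = 0ℤ
        later (k , zero)  = 0ℤ
        later (k , suc r) = φ (out k (suc r)) * H (out k 0)
        on-cov : Cov onWeight outExp
        on-cov = cov-sub ρ (λ _ ())
        neg-cov : Cov (λ i → - outer i) outExp
        neg-cov = cov-sub ρ (λ _ ())
        out-cov : Cov outer outExp
        out-cov = cov-sub ρ (λ _ ())
        inn-cov : Cov inner outExp
        inn-cov = cov-sub ρ (λ _ ())
        first-cov : Cov first outExp
        first-cov = cov-sub ρ (λ _ ())
        later-cov : Cov later outExp
        later-cov = cov-sub ρ (λ _ ())
        lemma : ∀ a b → -1ℤ * (a + b) + b ≡ - a
        lemma = solve-∀
        split : ∀ i → onWeight i ≡ - outer i + inner i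
        split (k , r) = trans (cong (λ z → - (φ (out k r) * z)) (step k)) (distrib (φ (out k r)) (H (out k 0)) (H (inn k)))
          where
          distrib : ∀ f a b → - (f * (a - b)) ≡ - (f * a) + f * b
          distrib = solve-∀
        first+later : ∀ i → outer i ≡ first i + later i
        first+later (k , zero)  = sym (ℤP.+-identityʳ _)
        first+later (k , suc r) = sym (ℤP.+-identityˡ _)
        zero-weight : ∀ x → φ x * H 0ℤ ≡ 0ℤ
        zero-weight x = trans (cong (φ x *_) H0) (ℤP.*-zeroʳ (φ x))
        first-match : Match first outExp (λ m → φ m * H m) thetaExp
        first-match = record
          { to = λ (k , _) → out k 0
          -- The image of 0 is a placeholder: the weight at m = 0 contains `H 0ℤ`.
          ; from = λ { (+ zero) → + 0 , 0 ; (+ suc j) → + j , 0 ; -[1+ j ] → -[1+ j ] , 0 }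
          ; to-ok = λ { (k , suc r) nz → contradiction refl nz
                      ; (+ j , zero) nz → refl , refl , refl ; (-[1+ j ] , zero) nz → refl , refl , refl }
          ; from-ok = λ { (+ zero) nz → contradiction (zero-weight 0ℤ) nz
                        ; (+ suc j) nz → refl , refl ; -[1+ j ] nz → refl , refl } }
        -- The pairs (k, r + 1) and (`away k`, r) have the same m, and the outer value of H at k is
        -- the inner value at `away k`. Here neighbouring terms of the telescope meet.
        later-match : Match later outExp inner outExp
        later-match = record
          { to = λ { (k , zero) → k , 0 ; (k , suc r) → away k , r }
          ; from = λ { (+ zero , r) → + 0 , 0 ; (+ suc j , r) → + j , suc r
                     ; (-[1+ zero ] , r) → + 0 , 0 ; (-[1+ suc j ] , r) → -[1+ j ] , suc r }
          ; to-ok = λ { (k , zero) nz → contradiction refl nz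
                      ; (+ j , suc r) nz → weight-eq (+ j) r , cong thetaExp (sym (out-suc (+ j) r)) , refl
                      ; (-[1+ j ] , suc r) nz → weight-eq -[1+ j ] r , cong thetaExp (sym (out-suc -[1+ j ] r)) , refl }
          ; from-ok = λ { (+ zero , r) nz → contradiction (zero-weight (out (+ 0) r)) nz
                        ; (-[1+ zero ] , r) nz → contradiction (zero-weight (out -[1+ 0 ] r)) nz
                        ; (+ suc j , r) nz → sym (weight-eq (+ j) r) , refl
                        ; (-[1+ suc j ] , r) nz → sym (weight-eq -[1+ j ] r) , refl } }
          where
          weight-eq : ∀ k r → inner (away k , r) ≡ later (k , suc r)
          weight-eq k r = cong₂ (λ x y → φ x * H y) (sym (out-suc k r)) (inn-away k)

      -- The two kinds are chosen so that k is given by one formula for either sign: k = m + b - a -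
      -- 1 for the first, k = m + a - b for the second. Hence no condition on (m, a, b) remains.
      firstWeight secondWeight : ℤ × ℕ × ℕ → ℤ
      firstWeight (m , a , b)  = φ m * h (m + + b - + a - 1ℤ)
      secondWeight (m , a , b) = - (φ m * h (m + + a - + b))

      centre-odd⁺ : ∀ j a b → centre (+ j , suc (dbl a) , + suc (a ℕ.+ b)) ≡ 1ℤ + (+ j + + a - + b)
      centre-odd⁺ j a b = trans (cong (λ z → + j - (1ℤ + (+ a + + b)) + (1ℤ + (1ℤ + z))) (+dbl a)) (lemma (+ j) (+ a) (+ b))
        where
        lemma : ∀ j a b → j - (1ℤ + (a + b)) + (1ℤ + (1ℤ + (a + a))) ≡ 1ℤ + (j + a - b)
        lemma = solve-∀

      centre-odd⁻ : ∀ j a b → centre (-[1+ j ] , suc (dbl a) , + suc (a ℕ.+ b)) ≡ - (1ℤ + + j) + + b - + a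
      centre-odd⁻ j a b = trans (cong (λ z → 1ℤ + (+ a + + b) - + j + - (1ℤ + (1ℤ + z))) (+dbl a)) (lemma (+ j) (+ a) (+ b))
        where
        lemma : ∀ j a b → 1ℤ + (a + b) - j + - (1ℤ + (1ℤ + (a + a))) ≡ - (1ℤ + j) + b - a
        lemma = solve-∀

      centre-even⁺ : ∀ j a b → centre (+ j , dbl b , + suc (b ℕ.+ a)) ≡ + j + + b - + a
      centre-even⁺ j a b = trans (cong (λ z → + j - (1ℤ + (+ b + + a)) + (1ℤ + z)) (+dbl b)) (lemma (+ j) (+ a) (+ b))
        where
        lemma : ∀ j a b → j - (1ℤ + (b + a)) + (1ℤ + (b + b)) ≡ j + b - a
        lemma = solve-∀

      centre-even⁻ : ∀ j a b → centre (-[1+ j ] , dbl b , + suc (b ℕ.+ a)) ≡ 1ℤ + (- (1ℤ + + j) + + a - + b)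
      centre-even⁻ j a b = trans (cong (λ z → 1ℤ + (+ b + + a) - + j + - (1ℤ + z)) (+dbl b)) (lemma (+ j) (+ a) (+ b))
        where
        lemma : ∀ j a b → 1ℤ + (b + a) - j + - (1ℤ + (b + b)) ≡ 1ℤ + (- (1ℤ + j) + a - b)
        lemma = solve-∀

      odd⁺ odd⁻ even⁺ even⁻ : ℕ → ℕ → ℕ → ℤ × ℕ × ℤ
      odd⁺  j a b = + j , suc (dbl a) , + suc (a ℕ.+ b)
      odd⁻  j a b = -[1+ j ] , suc (dbl a) , + suc (a ℕ.+ b)
      even⁺ j a b = + j , dbl b , + suc (b ℕ.+ a)
      even⁻ j a b = -[1+ j ] , dbl b , + suc (b ℕ.+ a)

      exp-odd : ∀ k a b → aboveExp (centre (k , suc (dbl a) , + suc (a ℕ.+ b)) , a , b) ≡ shiftedExp (k , suc (dbl a) , + suc (a ℕ.+ b))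
      exp-odd k a b = sym (trans (shiftedExp≡ k (suc (dbl a)) (+ suc (a ℕ.+ b))) (cong (λ x → thetaExp (centre (k , suc (dbl a) , + suc (a ℕ.+ b))) + α * x)
          (trans (cong (λ z → (1ℤ + (1ℤ + z)) * (+ 2 * (1ℤ + (+ a + + b)) - (1ℤ + z))) (+dbl a)) (lemma (+ a) (+ b)))))
        where
        lemma : ∀ a b → (1ℤ + (1ℤ + (a + a))) * (+ 2 * (1ℤ + (a + b)) - (1ℤ + (a + a))) ≡ + 2 * ((1ℤ + a) * (1ℤ + (b + b)))
        lemma = solve-∀

      exp-even : ∀ k a b → aboveExp (centre (k , dbl b , + suc (b ℕ.+ a)) , a , b) ≡ shiftedExp (k , dbl b , + suc (b ℕ.+ a))
      exp-even k a b = sym (trans (shiftedExp≡ k (dbl b) (+ suc (b ℕ.+ a))) (cong (λ x → thetaExp (centre (k , dbl b , + suc (b ℕ.+ a))) + α * x)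
          (trans (cong (λ z → (1ℤ + z) * (+ 2 * (1ℤ + (+ b + + a)) - z)) (+dbl b)) (lemma (+ a) (+ b)))))
        where
        lemma : ∀ a b → (1ℤ + (b + b)) * (+ 2 * (1ℤ + (b + a)) - (b + b)) ≡ + 2 * ((1ℤ + a) * (1ℤ + (b + b)))
        lemma = solve-∀

      -- The two kinds of points above, told apart by the parity of the positive one of ±d, ±d′.
      first-match : Match (part isFirst) shiftedExp firstWeight aboveExp
      first-match = record { to = to ; from = from ; to-ok = to-ok ; from-ok = from-ok }
        where
        move : ℤ → ℤ → Region → ℤ × ℕ × ℕ
        move c (+ _)    (oddAbove a b)  = c , a , b
        move c -[1+ _ ] (evenAbove a b) = c , a , b
        move c _        _               = 0ℤ , 0 , 0
        to : ℤ × ℕ × ℤ → ℤ × ℕ × ℕ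
        to i@(k , d , r) = move (centre i) k (region d r)
        build : ℤ → ℕ → ℕ → ℤ × ℕ × ℤ
        build (+ j)    a b = odd⁺ j a b
        build -[1+ j ] a b = even⁻ j a b
        from : ℤ × ℕ × ℕ → ℤ × ℕ × ℤ
        from (m , a , b) = build (m + + b - + a - 1ℤ) a b
        pole⁺ : ∀ j a b → centre (odd⁺ j a b) + + b - + a - 1ℤ ≡ + j
        pole⁺ j a b = trans (cong (λ z → z + + b - + a - 1ℤ) (centre-odd⁺ j a b)) (lemma (+ j) (+ a) (+ b))
          where
          lemma : ∀ j a b → 1ℤ + (j + a - b) + b - a - 1ℤ ≡ j
          lemma = solve-∀
        pole⁻ : ∀ j a b → centre (even⁻ j a b) + + b - + a - 1ℤ ≡ -[1+ j ]
        pole⁻ j a b = trans (cong (λ z → z + + b - + a - 1ℤ) (centre-even⁻ j a b)) (lemma -[1+ j ] (+ a) (+ b))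
          where
          lemma : ∀ j a b → 1ℤ + (j + a - b) + b - a - 1ℤ ≡ j
          lemma = solve-∀
        unpole : ∀ m k a b → m + + b - + a - 1ℤ ≡ k → 1ℤ + (k + + a - + b) ≡ m
        unpole m k a b refl = lemma m (+ a) (+ b)
          where
          lemma : ∀ m a b → 1ℤ + (m + b - a - 1ℤ + a - b) ≡ m
          lemma = solve-∀
        weight⁺ : ∀ m j a b → m ≡ centre (odd⁺ j a b) → firstWeight (m , a , b) ≡ 1ℤ * shiftedWeight (odd⁺ j a b)
        weight⁺ _ j a b refl = trans (cong (λ z → φ (centre (odd⁺ j a b)) * h z) (pole⁺ j a b))
          (trans (lemma (φ (centre (odd⁺ j a b))) (h (+ j))) (cong (λ z → 1ℤ * (φ (centre (odd⁺ j a b)) * (- - z * (1ℤ * h (+ j))))) (sym (σ-even a))))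
          where
          lemma : ∀ f x → f * x ≡ 1ℤ * (f * (1ℤ * (1ℤ * x)))
          lemma = solve-∀
        weight⁻ : ∀ m j a b → m ≡ centre (even⁻ j a b) → firstWeight (m , a , b) ≡ 1ℤ * shiftedWeight (even⁻ j a b)
        weight⁻ _ j a b refl = trans (cong (λ z → φ (centre (even⁻ j a b)) * h z) (pole⁻ j a b))
          (trans (lemma (φ (centre (even⁻ j a b))) (h -[1+ j ])) (cong (λ z → 1ℤ * (φ (centre (even⁻ j a b)) * (- z * (-1ℤ * h -[1+ j ])))) (sym (σ-even b))))
          where
          lemma : ∀ f x → f * x ≡ 1ℤ * (f * (-1ℤ * (-1ℤ * x)))
          lemma = solve-∀
        to-ok : ∀ i → part isFirst i ≢ 0ℤ → firstWeight (to i) ≡ part isFirst i × aboveExp (to i) ≡ shiftedExp i × from (to i) ≡ i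
        to-ok (k , d , r) nz with region d r in e
        to-ok (+ j , d , r) nz      | below _       = contradiction refl nz
        to-ok (+ j , d , r) nz      | on _          = contradiction refl nz
        to-ok (+ j , d , r) nz      | evenAbove _ _ = contradiction refl nz
        to-ok (-[1+ j ] , d , r) nz | below _       = contradiction refl nz
        to-ok (-[1+ j ] , d , r) nz | on _          = contradiction refl nz
        to-ok (-[1+ j ] , d , r) nz | oddAbove _ _  = contradiction refl nz
        to-ok (+ j , d , -[1+ p ]) nz      | oddAbove a b with () ← e
        to-ok (-[1+ j ] , d , -[1+ p ]) nz | evenAbove a b with () ← e
        to-ok (+ j , d , + p) nz | oddAbove a b with subst (λ t → Located t d p) e (located d p)
        ... | refl , refl = weight⁺ _ j a b refl , exp-odd (+ j) a b , cong (λ z → build z a b) (pole⁺ j a b)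
        to-ok (-[1+ j ] , d , + p) nz | evenAbove a b with subst (λ t → Located t d p) e (located d p)
        ... | refl , refl = weight⁻ _ j a b refl , exp-even -[1+ j ] a b , cong (λ z → build z a b) (pole⁻ j a b)
        from-ok : ∀ i → firstWeight i ≢ 0ℤ → part isFirst (from i) ≡ firstWeight i × to (from i) ≡ i
        from-ok (m , a , b) nz with m + + b - + a - 1ℤ in e
        ... | + j rewrite region-odd a b = trans (sym (weight⁺ m j a b m≡)) (cong (λ z → φ m * h z) e) , cong (_, a , b) (sym m≡)
          where
          m≡ : m ≡ centre (odd⁺ j a b)
          m≡ = sym (trans (centre-odd⁺ j a b) (unpole m (+ j) a b e))
        ... | -[1+ j ] rewrite region-even a b = trans (sym (weight⁻ m j a b m≡)) (cong (λ z → φ m * h z) e) , cong (_, a , b) (sym m≡)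
          where
          m≡ : m ≡ centre (even⁻ j a b)
          m≡ = sym (trans (centre-even⁻ j a b) (unpole m -[1+ j ] a b e))

      second-match : Match (part isSecond) shiftedExp secondWeight aboveExp
      second-match = record { to = to ; from = from ; to-ok = to-ok ; from-ok = from-ok }
        where
        move : ℤ → ℤ → Region → ℤ × ℕ × ℕ
        move c (+ _)    (evenAbove a b)  = c , a , b
        move c -[1+ _ ] (oddAbove a b) = c , a , b
        move c _        _               = 0ℤ , 0 , 0
        to : ℤ × ℕ × ℤ → ℤ × ℕ × ℕ
        to i@(k , d , r) = move (centre i) k (region d r)
        build : ℤ → ℕ → ℕ → ℤ × ℕ × ℤ
        build (+ j)    a b = even⁺ j a b
        build -[1+ j ] a b = odd⁻ j a b
        from : ℤ × ℕ × ℕ → ℤ × ℕ × ℤ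
        from (m , a , b) = build (m + + a - + b) a b
        pole⁺ : ∀ j a b → centre (even⁺ j a b) + + a - + b ≡ + j
        pole⁺ j a b = trans (cong (λ z → z + + a - + b) (centre-even⁺ j a b)) (lemma (+ j) (+ a) (+ b))
          where
          lemma : ∀ j a b → j + b - a + a - b ≡ j
          lemma = solve-∀
        pole⁻ : ∀ j a b → centre (odd⁻ j a b) + + a - + b ≡ -[1+ j ]
        pole⁻ j a b = trans (cong (λ z → z + + a - + b) (centre-odd⁻ j a b)) (lemma -[1+ j ] (+ a) (+ b))
          where
          lemma : ∀ j a b → j + b - a + a - b ≡ j
          lemma = solve-∀
        unpole : ∀ m k a b → m + + a - + b ≡ k → k + + b - + a ≡ m
        unpole m k a b refl = lemma m (+ a) (+ b)
          where
          lemma : ∀ m a b → m + a - b + b - a ≡ m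
          lemma = solve-∀
        weight⁺ : ∀ m j a b → m ≡ centre (even⁺ j a b) → secondWeight (m , a , b) ≡ 1ℤ * shiftedWeight (even⁺ j a b)
        weight⁺ _ j a b refl = trans (cong (λ z → - (φ (centre (even⁺ j a b)) * h z)) (pole⁺ j a b))
          (trans (lemma (φ (centre (even⁺ j a b))) (h (+ j))) (cong (λ z → 1ℤ * (φ (centre (even⁺ j a b)) * (- z * (1ℤ * h (+ j))))) (sym (σ-even b))))
          where
          lemma : ∀ f x → - (f * x) ≡ 1ℤ * (f * (-1ℤ * (1ℤ * x)))
          lemma = solve-∀
        weight⁻ : ∀ m j a b → m ≡ centre (odd⁻ j a b) → secondWeight (m , a , b) ≡ 1ℤ * shiftedWeight (odd⁻ j a b)
        weight⁻ _ j a b refl = trans (cong (λ z → - (φ (centre (odd⁻ j a b)) * h z)) (pole⁻ j a b))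
          (trans (lemma (φ (centre (odd⁻ j a b))) (h -[1+ j ])) (cong (λ z → 1ℤ * (φ (centre (odd⁻ j a b)) * (- - z * (-1ℤ * h -[1+ j ])))) (sym (σ-even a))))
          where
          lemma : ∀ f x → - (f * x) ≡ 1ℤ * (f * (1ℤ * (-1ℤ * x)))
          lemma = solve-∀
        to-ok : ∀ i → part isSecond i ≢ 0ℤ → secondWeight (to i) ≡ part isSecond i × aboveExp (to i) ≡ shiftedExp i × from (to i) ≡ i
        to-ok (k , d , r) nz with region d r in e
        to-ok (+ j , d , r) nz      | below _       = contradiction refl nz
        to-ok (+ j , d , r) nz      | on _          = contradiction refl nz
        to-ok (+ j , d , r) nz      | oddAbove _ _ = contradiction refl nz
        to-ok (-[1+ j ] , d , r) nz | below _       = contradiction refl nz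
        to-ok (-[1+ j ] , d , r) nz | on _          = contradiction refl nz
        to-ok (-[1+ j ] , d , r) nz | evenAbove _ _  = contradiction refl nz
        to-ok (+ j , d , -[1+ p ]) nz      | evenAbove a b with () ← e
        to-ok (-[1+ j ] , d , -[1+ p ]) nz | oddAbove a b with () ← e
        to-ok (+ j , d , + p) nz | evenAbove a b with subst (λ t → Located t d p) e (located d p)
        ... | refl , refl = weight⁺ _ j a b refl , exp-even (+ j) a b , cong (λ z → build z a b) (pole⁺ j a b)
        to-ok (-[1+ j ] , d , + p) nz | oddAbove a b with subst (λ t → Located t d p) e (located d p)
        ... | refl , refl = weight⁻ _ j a b refl , exp-odd -[1+ j ] a b , cong (λ z → build z a b) (pole⁻ j a b)
        from-ok : ∀ i → secondWeight i ≢ 0ℤ → part isSecond (from i) ≡ secondWeight i × to (from i) ≡ i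
        from-ok (m , a , b) nz with m + + a - + b in e
        ... | + j rewrite region-even a b = trans (sym (weight⁺ m j a b m≡)) (cong (λ z → - (φ m * h z)) e) , cong (_, a , b) (sym m≡)
          where
          m≡ : m ≡ centre (even⁺ j a b)
          m≡ = sym (trans (centre-even⁺ j a b) (unpole m (+ j) a b e))
        ... | -[1+ j ] rewrite region-odd a b = trans (sym (weight⁻ m j a b m≡)) (cong (λ z → - (φ m * h z)) e) , cong (_, a , b) (sym m≡)
          where
          m≡ : m ≡ centre (odd⁻ j a b)
          m≡ = sym (trans (centre-odd⁻ j a b) (unpole m -[1+ j ] a b e))

      -- For each m, the terms with n + δ = m and pole k cancel under n ↦ 2k + 1 - n as long as δ keeps its sign; what is left
      -- are the terms with n = 2k + 1 - m (first on the right) and those where δ changes sign (second on the right).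
      reflection : (c : Cov poleWeight (λ (n , i) → thetaExp n + poleExp i)) (ρ : Cov (λ _ → 1ℤ) outExp)
                   (t : Cov (λ m → φ m * H m) thetaExp) (e : Cov (λ _ → 1ℤ) aboveExp)
                   (l : Cov (λ (m , a , b) → φ m * (h (m + + b - + a - 1ℤ) - h (m + + a - + b))) aboveExp) →
                   gf c ≈ ⊟ gf t ⊞ gf l
      reflection c ρ t e l N = begin
        gf c N ≡⟨ gf-match c to-shifted s N ⟩
        gf s N ≡⟨ gf-sum s low high s low≪ high≪ parts N ⟩
        gf low N + gf high N ≡⟨ cong₂ _+_
            (gf-sum s below-cov on-cov low (part≪ isBelow) (part≪ isOn) (λ _ → refl) N)
            (gf-sum s first-cov second-cov high (part≪ isFirst) (part≪ isSecond) (λ _ → refl) N) ⟩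
        gf below-cov N + gf on-cov N + (gf first-cov N + gf second-cov N)
          ≡⟨ cong₂ (λ x y → x + y + (gf first-cov N + gf second-cov N)) (involution-zero below-cov below-match N)
               (trans (gf-match on-cov on-match on′ N) (on-sum on′ ρ t N)) ⟩
        0ℤ + - gf t N + (gf first-cov N + gf second-cov N)
          ≡⟨ cong₂ (λ x y → 0ℤ + - gf t N + (x + y)) (gf-match first-cov first-match first′ N) (gf-match second-cov second-match second′ N) ⟩
        0ℤ + - gf t N + (gf first′ N + gf second′ N)
          ≡⟨ cong₂ _+_ (ℤP.+-identityˡ (- gf t N)) (sym (gf-sum e first′ second′ l (λ _ ()) (λ _ ()) l-split N)) ⟩
        - gf t N + gf l N ∎
        where
        open ≡-Reasoning
        s : Cov shiftedWeight shiftedExp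
        s = cov-match c to-shifted
        part≪ : ∀ t i → shiftedWeight i ≡ 0ℤ → part t i ≡ 0ℤ
        part≪ t i@(k , d , r) z = trans (cong (t k (region d r) *_) z) (ℤP.*-zeroʳ (t k (region d r)))
        low≪ : ∀ i → shiftedWeight i ≡ 0ℤ → part isBelow i + part isOn i ≡ 0ℤ
        low≪ i z = cong₂ _+_ (part≪ isBelow i z) (part≪ isOn i z)
        high≪ : ∀ i → shiftedWeight i ≡ 0ℤ → part isFirst i + part isSecond i ≡ 0ℤ
        high≪ i z = cong₂ _+_ (part≪ isFirst i z) (part≪ isSecond i z)
        low : Cov (λ i → part isBelow i + part isOn i) shiftedExp
        low = cov-sub s low≪
        high : Cov (λ i → part isFirst i + part isSecond i) shiftedExp
        high = cov-sub s high≪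
        below-cov : Cov (part isBelow) shiftedExp
        below-cov = cov-sub s (part≪ isBelow)
        on-cov : Cov (part isOn) shiftedExp
        on-cov = cov-sub s (part≪ isOn)
        first-cov : Cov (part isFirst) shiftedExp
        first-cov = cov-sub s (part≪ isFirst)
        second-cov : Cov (part isSecond) shiftedExp
        second-cov = cov-sub s (part≪ isSecond)
        on′ : Cov onWeight outExp
        on′ = cov-match on-cov on-match
        first′ : Cov firstWeight aboveExp
        first′ = cov-match first-cov first-match
        second′ : Cov secondWeight aboveExp
        second′ = cov-match second-cov second-match
        l-split : ∀ i → _
        l-split (m , a , b) = distrib (φ m) (h (m + + b - + a - 1ℤ)) (h (m + + a - + b))
          where
          distrib : ∀ f x y → f * (x - y) ≡ f * x + - (f * y)
          distrib = solve-∀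

  -- Enumerations, and the finiteness of theta and Lambert families.

  record Enum (I : Set) : Set where
    field
      size  : I → ℕ
      range : ℕ → List I
      uniq  : ∀ N → Unique (range N)
      mem   : ∀ N i → size i ℕ.≤ N → i ∈ range N

  enumℕ : Enum ℕ
  enumℕ = record { size = id ; range = upTo ∘ suc ; uniq = UniqueP.upTo⁺ ∘ suc ; mem = λ N i le → MemP.∈-upTo⁺ (s≤s le) }

  enumℤ : Enum ℤ
  enumℤ = record
    { size = ∣_∣
    ; range = λ N → map +_ (upTo (suc N)) ++ map -[1+_] (upTo N)
    ; uniq = λ N → UniqueP.++⁺ (UniqueP.map⁺ ℤP.+-injective (UniqueP.upTo⁺ (suc N))) (UniqueP.map⁺ ℤP.-[1+-injective (UniqueP.upTo⁺ N))
        λ (p , q) → case trans (sym (proj₂ (proj₂ (MemP.∈-map⁻ +_ p)))) (proj₂ (proj₂ (MemP.∈-map⁻ -[1+_] q))) of λ ()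
    ; mem = λ { N (+ n) le → MemP.∈-++⁺ˡ (MemP.∈-map⁺ +_ (MemP.∈-upTo⁺ (s≤s le)))
              ; N -[1+ n ] le → MemP.∈-++⁺ʳ (map +_ (upTo (suc N))) (MemP.∈-map⁺ -[1+_] (MemP.∈-upTo⁺ le)) } }

  enum× : {I J : Set} → Enum I → Enum J → Enum (I × J)
  enum× A B = record
    { size = λ (i , j) → A.size i ℕ.⊔ B.size j
    ; range = λ N → cartesianProduct (A.range N) (B.range N)
    ; uniq = λ N → UniqueP.cartesianProduct⁺ (A.uniq N) (B.uniq N)
    ; mem = λ N (i , j) le → MemP.∈-cartesianProduct⁺ (A.mem N i (ℕP.≤-trans (ℕP.m≤m⊔n _ _) le)) (B.mem N j (ℕP.≤-trans (ℕP.m≤n⊔m (A.size i) _) le)) }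
    where
    module A = Enum A
    module B = Enum B

  NonNeg : ℤ → Set
  NonNeg x = Σ ℕ λ k → x ≡ + k

  nn : ∀ n → NonNeg (+ n)
  nn n = n , refl

  infixl 6 _⊹_
  _⊹_ : ∀ {x y} → NonNeg x → NonNeg y → NonNeg (x + y)
  (a , p) ⊹ (b , q) = a ℕ.+ b , cong₂ _+_ p q

  infixl 7 _⊠_
  _⊠_ : ∀ {x y} → NonNeg x → NonNeg y → NonNeg (x * y)
  (a , p) ⊠ (b , q) = a ℕ.* b , trans (cong₂ _*_ p q) (sym (ℤP.pos-* a b))

  module _ {I : Set} (A : Enum I) {w E : I → ℤ} where
    open Enum A

    -- size i ≤ 1 + E i is shown by exhibiting E i as n plus something nonnegative, with size i ≤ 1 + n.
    opaque
      cov-bounded : (∀ i → w i ≢ 0ℤ → Σ ℕ λ n → Σ ℤ λ y → size i ℕ.≤ suc n × E i ≡ + n + y × NonNeg y) → Cov w E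
      cov-bounded bound = record
        { nonneg = λ i nz → let (n , y , _ , e , k , f) = bound i nz in n ℕ.+ k , trans e (+-congʳ (+ n) f)
        ; list = range ∘ suc
        ; uniq = uniq ∘ suc
        ; covers = λ N i nz le → mem (suc N) i (fits N i nz le) }
        where
        fits : ∀ N i → w i ≢ 0ℤ → E i ≤ + N → size i ℕ.≤ suc N
        fits N i nz le with bound i nz
        ... | n , y , s , e , k , f with subst (_≤ + N) (trans e (+-congʳ (+ n) f)) le
        ...   | +≤+ le′ = ℕP.≤-trans s (s≤s (ℕP.≤-trans (ℕP.m≤m+n n k) le′))

  -- The exponents 2(d + 1)x with x = α j + β.
  residueExp : ℤ → ℤ → ℕ × ℕ → ℤ
  residueExp α β (j , d) = + 2 * (+ suc d * (α * + j + β))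

  cov-residue : ∀ a b {w : ℕ × ℕ → ℤ} → Cov w (residueExp (+ suc a) (+ suc b))
  cov-residue a b = cov-bounded (enum× enumℕ enumℕ) λ (j , d) _ →
    j ℕ.+ d , _ , ℕP.≤-trans (ℕP.m⊔n≤m+n j d) (ℕP.n≤1+n _) , lemma (+ a) (+ b) (+ j) (+ d) ,
    (nn 2 ⊹ nn j ⊹ nn d ⊹ nn 2 ⊠ nn d ⊠ nn j) ⊹ nn 2 ⊠ nn (suc d) ⊠ (nn a ⊠ nn j ⊹ nn b)
    where
    lemma : ∀ a b j d → + 2 * ((1ℤ + d) * ((1ℤ + a) * j + (1ℤ + b))) ≡
            j + d + ((+ 2 + j + d + + 2 * d * j) + + 2 * (1ℤ + d) * (a * j + b))
    lemma = solve-∀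

  module Theta (a b g : ℕ) (eq : + suc a ≡ + b + + g) where

    open Reflection (+ suc a) (+ b) public

    theta-bound : ∀ n → n ≢ 0ℤ → Σ ℕ λ m → Σ ℤ λ y → ∣ n ∣ ≡ suc m × thetaExp n ≡ + m + y × NonNeg y
    theta-bound (+ zero) nz = contradiction refl nz
    theta-bound (+ suc m) _ = m , _ , refl , lemma (+ a) (+ b) (+ m) ,
        nn m ⊠ nn m ⊹ nn a ⊠ (nn (suc m) ⊠ nn m) ⊹ nn 2 ⊠ (nn b ⊠ nn (suc m))
      where
      lemma : ∀ a b m → (1ℤ + a) * ((1ℤ + m) * (1ℤ + m - 1ℤ)) + + 2 * (b * (1ℤ + m)) ≡
              m + (m * m + a * ((1ℤ + m) * m) + + 2 * (b * (1ℤ + m)))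
      lemma = solve-∀
    theta-bound -[1+ m ] _ = m , _ , refl ,
        trans (cong (λ z → + suc a * (-[1+ m ] * (-[1+ m ] - 1ℤ)) + + 2 * (z * -[1+ m ])) b≡) (lemma (+ a) (+ g) (+ m)) ,
        nn m ⊠ nn m ⊹ nn a ⊠ (nn (suc m) ⊠ nn m) ⊹ nn 2 ⊠ (nn g ⊠ nn (suc m))
      where
      cancel : ∀ b g → b ≡ b + g - g
      cancel = solve-∀
      b≡ : + b ≡ + suc a - + g
      b≡ = trans (cancel (+ b) (+ g)) (cong (_- + g) (sym eq))
      lemma : ∀ a g m → (1ℤ + a) * (- (1ℤ + m) * (- (1ℤ + m) - 1ℤ)) + + 2 * ((1ℤ + a - g) * - (1ℤ + m)) ≡
              m + (m * m + a * ((1ℤ + m) * m) + + 2 * (g * (1ℤ + m)))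
      lemma = solve-∀

    cov-theta : ∀ {w} → Cov w thetaExp
    cov-theta = cov-bounded enumℤ bound
      where
      bound : ∀ n → _ → Σ ℕ λ m → Σ ℤ λ y → ∣ n ∣ ℕ.≤ suc m × thetaExp n ≡ + m + y × NonNeg y
      bound n _ with n ≟ 0ℤ
      ... | yes refl = 0 , 0ℤ , z≤n , lemma (+ suc a) (+ b) , nn 0
        where
        lemma : ∀ a b → a * (0ℤ * (0ℤ - 1ℤ)) + + 2 * (b * 0ℤ) ≡ 0ℤ
        lemma = solve-∀
      ... | no nz = let (m , y , s , e , y≥0) = theta-bound n nz in m , y , ℕP.≤-reflexive s , e , y≥0

    cov-out : ∀ {w} → Cov w outExp
    cov-out = cov-bounded (enum× enumℤ enumℕ) bound
      where
      bound : ∀ i → _ → Σ ℕ λ n → Σ ℤ λ y → Enum.size (enum× enumℤ enumℕ) i ℕ.≤ suc n × outExp i ≡ + n + y × NonNeg y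
      bound (+ j , r) _ with theta-bound (+ suc (r ℕ.+ j)) (λ ())
      ... | m , y , refl , e , y≥0 = m , y , ℕP.⊔-lub (ℕP.≤-trans (ℕP.m≤n+m j r) (ℕP.n≤1+n _)) (ℕP.≤-trans (ℕP.m≤m+n r j) (ℕP.n≤1+n _)) , e , y≥0
      bound (-[1+ j ] , r) _ with theta-bound -[1+ r ℕ.+ j ] (λ ())
      ... | m , y , refl , e , y≥0 = m , y , ℕP.⊔-lub (s≤s (ℕP.m≤n+m j r)) (ℕP.≤-trans (ℕP.m≤m+n r j) (ℕP.n≤1+n _)) , e , y≥0

    cov-lambert : ∀ {w} → Cov w lambertExp
    cov-lambert = cov-bounded (enum× enumℕ enumℕ) λ (x , y) _ →
      x ℕ.+ y , _ , ℕP.≤-trans (ℕP.m⊔n≤m+n x y) (ℕP.n≤1+n _) , lemma (+ a) (+ x) (+ y) ,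
      (nn 2 ⊹ nn x ⊹ nn 3 ⊠ nn y ⊹ nn 4 ⊠ nn x ⊠ nn y) ⊹ nn a ⊠ (nn 2 ⊠ (nn (suc x) ⊠ (nn 1 ⊹ nn 2 ⊠ nn y)))
      where
      lemma : ∀ a x y → (1ℤ + a) * (+ 2 * ((1ℤ + x) * (1ℤ + (y + y)))) ≡
              x + y + ((+ 2 + x + + 3 * y + + 4 * x * y) + a * (+ 2 * ((1ℤ + x) * (1ℤ + + 2 * y))))
      lemma = solve-∀

    cov-above : Cov (λ _ → 1ℤ) aboveExp
    cov-above = cov-⊗ {w = λ _ → 1ℤ} {v = λ _ → 1ℤ} cov-theta cov-lambert

    -- For k = -1 - j one has -(αk + β) = αj + (α - β), so the poles with negative k form the
    -- residue class of g = α - β.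
    neg-pole : ∀ j d → poleExp (-[1+ j ] , d) ≡ residueExp (+ suc a) (+ g) (j , d)
    neg-pole j d = trans (cong (λ z → + 2 * (-[1+ d ] * (z * -[1+ j ] + + b))) eq)
        (trans (lemma (+ b) (+ g) (+ j) (+ d)) (cong (λ z → + 2 * (+ suc d * (z * + j + + g))) (sym eq)))
      where
      lemma : ∀ b g j d → + 2 * (- (1ℤ + d) * ((b + g) * - (1ℤ + j) + b)) ≡ + 2 * ((1ℤ + d) * ((b + g) * j + g))
      lemma = solve-∀

    module _ {w : ℤ × ℕ → ℤ} where

      private
        w⁺ w⁻ : ℤ × ℕ → ℤ
        w⁺ (+ j , d)      = w (+ j , d)
        w⁺ (-[1+ j ] , d) = 0ℤ
        w⁻ (+ j , d)      = 0ℤ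
        w⁻ (-[1+ j ] , d) = w (-[1+ j ] , d)

        match⁺ : Match (λ (j , d) → w (+ j , d)) (residueExp (+ suc a) (+ b)) w⁺ poleExp
        match⁺ = record
          { to = λ (j , d) → + j , d ; from = λ { (+ j , d) → j , d ; (-[1+ j ] , d) → j , d }
          ; to-ok = λ _ _ → refl , refl , refl
          ; from-ok = λ { (+ j , d) _ → refl , refl ; (-[1+ j ] , d) nz → contradiction refl nz } }

        match⁻ : Match (λ (j , d) → w (-[1+ j ] , d)) (residueExp (+ suc a) (+ g)) w⁻ poleExp
        match⁻ = record
          { to = λ (j , d) → -[1+ j ] , d ; from = λ { (+ j , d) → j , d ; (-[1+ j ] , d) → j , d }
          ; to-ok = λ (j , d) _ → refl , neg-pole j d , refl
          ; from-ok = λ { (-[1+ j ] , d) _ → refl , refl ; (+ j , d) nz → contradiction refl nz } }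

        w± : ∀ i → w i ≡ w⁺ i + w⁻ i
        w± (+ j , d)      = sym (ℤP.+-identityʳ _)
        w± (-[1+ j ] , d) = sym (ℤP.+-identityˡ _)

      module _ (p : Cov (λ (j , d) → w (+ j , d)) (residueExp (+ suc a) (+ b)))
               (n : Cov (λ (j , d) → w (-[1+ j ] , d)) (residueExp (+ suc a) (+ g))) where

        private
          p′ : Cov w⁺ poleExp
          p′ = cov-match p match⁺
          n′ : Cov w⁻ poleExp
          n′ = cov-match n match⁻

        cov-pole : Cov w poleExp
        cov-pole = record
          { nonneg = λ { (+ j , d) nz → Cov.nonneg p′ (+ j , d) nz ; (-[1+ j ] , d) nz → Cov.nonneg n′ (-[1+ j ] , d) nz }
          ; list = λ N → Cov.list p′ N ++ Cov.list n′ N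
          ; uniq = λ N → UniqueP.++⁺ (Cov.uniq p′ N) (Cov.uniq n′ N) (disjoint N)
          ; covers = λ { N (+ j , d) nz le → MemP.∈-++⁺ˡ (Cov.covers p′ N (+ j , d) nz le)
                       ; N (-[1+ j ] , d) nz le → MemP.∈-++⁺ʳ (Cov.list p′ N) (Cov.covers n′ N (-[1+ j ] , d) nz le) } }
          where
          disjoint : ∀ N {i} → ¬ (i ∈ Cov.list p′ N × i ∈ Cov.list n′ N)
          disjoint N (x , y) = case trans (sym (proj₂ (proj₂ (MemP.∈-map⁻ _ x)))) (proj₂ (proj₂ (MemP.∈-map⁻ _ y))) of λ ()

        pole-split : gf cov-pole ≈ gf p ⊞ gf n
        pole-split N = trans (gf-sum cov-pole c⁺ c⁻ cov-pole
            (λ { (+ j , d) z → z ; (-[1+ j ] , d) z → refl }) (λ { (+ j , d) z → refl ; (-[1+ j ] , d) z → z }) w± N)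
          (cong₂ _+_ (sym (gf-match p match⁺ c⁺ N)) (sym (gf-match n match⁻ c⁻ N)))
          where
          c⁺ : Cov w⁺ poleExp
          c⁺ = p′
          c⁻ : Cov w⁻ poleExp
          c⁻ = n′

  gf-sums : {I C : Set} {m t E : I → ℤ} {u : C → I → ℤ} (b : Cov m E) (cs : List C) (cov : ∀ c → Cov (u c) E) (e : Cov t E) →
            (∀ c i → m i ≡ 0ℤ → u c i ≡ 0ℤ) → (∀ i → t i ≡ sumL (λ c → u c i) cs) →
            ∀ N → gf e N ≡ sumL (λ c → gf (cov c) N) cs
  gf-sums {E = E} b [] cov e z s N = trans (gf-def e N) (sumL-zero _ (Cov.list e N) (λ i _ → cong (_* ind (E i) N) (s i)))
  gf-sums {m = m} {E = E} {u} b (c ∷ cs) cov e z s N =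
    trans (gf-sum b (cov c) rest e (z c) rest≪ s N) (+-congʳ (gf (cov c) N) (gf-sums b cs cov rest z (λ _ → refl) N))
    where
    rest≪ : ∀ i → m i ≡ 0ℤ → sumL (λ c → u c i) cs ≡ 0ℤ
    rest≪ i zi = sumL-zero (λ c → u c i) cs (λ c _ → z c i zi)
    rest : Cov (λ i → sumL (λ c → u c i) cs) E
    rest = cov-sub b rest≪

  -- Parity signs, and Lambert series in residue classes.

  par : ℤ → ℤ
  par (+ n)    = σ n
  par -[1+ n ] = σ (suc n)

  par-suc : ∀ m → par (1ℤ + m) ≡ - par m
  par-suc (+ n)        = refl
  par-suc -[1+ zero ]  = refl
  par-suc -[1+ suc n ] = sym (ℤP.neg-involutive _)

  par-+ : ∀ m d → par (m + + d) ≡ par m * σ d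
  par-+ m zero    = trans (cong par (ℤP.+-identityʳ m)) (sym (ℤP.*-identityʳ (par m)))
  par-+ m (suc d) = trans (cong par (lemma₁ m (+ d))) (trans (par-+ (1ℤ + m) d)
      (trans (cong (_* σ d) (par-suc m)) (lemma₂ (par m) (σ d))))
    where
    lemma₁ : ∀ m d → m + (1ℤ + d) ≡ 1ℤ + m + d
    lemma₁ = solve-∀
    lemma₂ : ∀ p s → - p * s ≡ p * - s
    lemma₂ = solve-∀

  σ-square : ∀ d → σ d * σ d ≡ 1ℤ
  σ-square zero    = refl
  σ-square (suc d) = trans (lemma (σ d)) (σ-square d)
    where
    lemma : ∀ s → - s * - s ≡ s * s
    lemma = solve-∀

  -- δ has the parity of d + 1. For φ = `par` the sign therefore depends on n alone, and the double
  -- sum becomes a product of two series.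
  par-toward : ∀ n k d → par (n + toward k d) * σ (suc d) ≡ par n
  par-toward n (+ j) d = trans (cong (_* σ (suc d)) (par-+ n (suc d))) (trans (ℤP.*-assoc (par n) (σ (suc d)) (σ (suc d)))
    (trans (cong (par n *_) (σ-square (suc d))) (ℤP.*-identityʳ (par n))))
  par-toward n -[1+ j ] d = trans (sym (par-+ (n + -[1+ d ]) (suc d))) (cong par (lemma n (+ suc d)))
    where
    lemma : ∀ n x → n - x + x ≡ n
    lemma = solve-∀

  -- R a b = Σ 2x q^(2xy) over x ≡ b + 1 mod a + 1, x, y ≥ 1; Rσ carries the sign of y as well.
  residueWeight : ℕ → ℕ → ℕ × ℕ → ℤ
  residueWeight a b (j , d) = + 2 * (+ suc a * + j + + suc b)

  signedWeight : ℕ → ℕ → ℕ × ℕ → ℤ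
  signedWeight a b (j , d) = σ (suc d) * residueWeight a b (j , d)

  opaque
    R-cov : ∀ a b → Cov (residueWeight a b) (residueExp (+ suc a) (+ suc b))
    R-cov a b = cov-residue a b

    Rσ-cov : ∀ a b → Cov (signedWeight a b) (residueExp (+ suc a) (+ suc b))
    Rσ-cov a b = cov-residue a b

  R Rσ : ℕ → ℕ → Series
  R a b = gf (R-cov a b)
  Rσ a b = gf (Rσ-cov a b)

  unit-base : ∀ a b → Cov (λ _ → 1ℤ) (residueExp (+ suc a) (+ suc b))
  unit-base a b = cov-residue a b

  -- (-1)^y is 2 · [y even] - 1, and for y = 2y′ the term 2 · 2x · q^(2x · 2y′) is the term of 2x
  -- and y′, whose first entry lies in the doubled class of the doubled modulus.
  signedR : ∀ a b a′ b′ → suc a′ ≡ 2 ℕ.* suc a → suc b′ ≡ 2 ℕ.* suc b → Rσ a b ≈ R a′ b′ ⊞ ⊟ R a b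
  signedR a b a′ b′ ea eb N = trans (gf-sum (unit-base a b) even-cov neg-cov (Rσ-cov a b) (λ _ ()) (λ _ ()) split N)
    (cong₂ _+_ (sym (gf-match (R-cov a′ b′) match even-cov N))
      (trans (gf-scale -1ℤ (R-cov a b) neg-cov (λ i → sym (ℤP.-1*i≡-i (residueWeight a b i))) N) (ℤP.-1*i≡-i (R a b N))))
    where
    odd : ℕ → ℤ
    odd zero          = 0ℤ
    odd (suc zero)    = 1ℤ
    odd (suc (suc d)) = odd d
    odd-dbl : ∀ d → odd (suc (dbl d)) ≡ 1ℤ
    odd-dbl zero    = refl
    odd-dbl (suc d) = odd-dbl d
    half : ℕ → ℕ
    half zero          = zero
    half (suc zero)    = zero
    half (suc (suc d)) = suc (half d)
    half-dbl : ∀ d → half (suc (dbl d)) ≡ d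
    half-dbl zero    = refl
    half-dbl (suc d) = cong suc (half-dbl d)
    dbl-half : ∀ d → odd d ≢ 0ℤ → suc (dbl (half d)) ≡ d
    dbl-half zero          nz = contradiction refl nz
    dbl-half (suc zero)    nz = refl
    dbl-half (suc (suc d)) nz = cong (suc ∘ suc) (dbl-half d nz)
    σ-odd : ∀ d → σ (suc d) ≡ + 2 * odd d + -1ℤ
    σ-odd zero          = refl
    σ-odd (suc zero)    = refl
    σ-odd (suc (suc d)) = trans (cong -_ (ℤP.neg-involutive (σ d))) (σ-odd d)
    evenWeight : ℕ × ℕ → ℤ
    evenWeight (j , d) = odd d * (+ 2 * residueWeight a b (j , d))
    even-cov : Cov evenWeight (residueExp (+ suc a) (+ suc b))
    even-cov = cov-residue a b
    neg-cov : Cov (λ i → - residueWeight a b i) (residueExp (+ suc a) (+ suc b))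
    neg-cov = cov-residue a b
    split : ∀ i → signedWeight a b i ≡ evenWeight i + - residueWeight a b i
    split (j , d) = trans (cong (_* residueWeight a b (j , d)) (σ-odd d)) (lemma (odd d) (residueWeight a b (j , d)))
      where
      lemma : ∀ o w → (+ 2 * o + -1ℤ) * w ≡ o * (+ 2 * w) + - w
      lemma = solve-∀
    +a′ : + suc a′ ≡ + 2 * + suc a
    +a′ = trans (cong +_ ea) (ℤP.pos-* 2 (suc a))
    +b′ : + suc b′ ≡ + 2 * + suc b
    +b′ = trans (cong +_ eb) (ℤP.pos-* 2 (suc b))
    match : Match (residueWeight a′ b′) (residueExp (+ suc a′) (+ suc b′)) evenWeight (residueExp (+ suc a) (+ suc b))
    match = record
      { to = λ (j , d) → j , suc (dbl d) ; from = λ (j , d) → j , half d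
      ; to-ok = λ (j , d) _ → weight-ok j d , exp-ok j d , cong (j ,_) (half-dbl d)
      ; from-ok = λ (j , d) nz → let e = dbl-half d (≢0-*ˡ nz) in
          trans (sym (weight-ok j (half d))) (cong (λ z → evenWeight (j , z)) e) , cong (j ,_) e }
      where
      weight-ok : ∀ j d → evenWeight (j , suc (dbl d)) ≡ residueWeight a′ b′ (j , d)
      weight-ok j d = trans (cong (_* (+ 2 * residueWeight a b (j , d))) (odd-dbl d))
        (trans (lemma (+ suc a) (+ suc b) (+ j)) (sym (cong₂ (λ x y → + 2 * (x * + j + y)) +a′ +b′)))
        where
        lemma : ∀ a b j → 1ℤ * (+ 2 * (+ 2 * (a * j + b))) ≡ + 2 * (+ 2 * a * j + + 2 * b)
        lemma = solve-∀
      exp-ok : ∀ j d → residueExp (+ suc a) (+ suc b) (j , suc (dbl d)) ≡ residueExp (+ suc a′) (+ suc b′) (j , d)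
      exp-ok j d = trans (cong (λ z → + 2 * ((1ℤ + (1ℤ + z)) * (+ suc a * + j + + suc b))) (+dbl d))
        (trans (lemma (+ suc a) (+ suc b) (+ j) (+ d)) (sym (cong₂ (λ x y → + 2 * (+ suc d * (x * + j + y))) +a′ +b′)))
        where
        lemma : ∀ a b j d → + 2 * ((1ℤ + (1ℤ + (d + d))) * (a * j + b)) ≡ + 2 * ((1ℤ + d) * (+ 2 * a * j + + 2 * b))
        lemma = solve-∀

  refineR : ∀ m a b a′ (b′ : ℕ → ℕ) → suc a′ ≡ suc m ℕ.* suc a → (∀ i → suc (b′ i) ≡ suc b ℕ.+ i ℕ.* suc a) →
            ∀ N → R a b N ≡ sumL (λ i → R a′ (b′ i) N) (upTo (suc m))
  refineR m a b a′ b′ ea eb N = trans (gf-sums (unit-base a b) (upTo (suc m)) class-cov (R-cov a b) (λ _ _ ()) split N)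
    (sumL-cong∈ (upTo (suc m)) (λ i i∈ → sym (gf-match (R-cov a′ (b′ i)) (match i (MemP.∈-upTo⁻ i∈)) (class-cov i) N)))
    where
    classWeight : ℕ → ℕ × ℕ → ℤ
    classWeight i (j , d) = 𝟙 (j ℕDM.% suc m ℕP.≟ i) * residueWeight a b (j , d)
    class-cov : ∀ i → Cov (classWeight i) (residueExp (+ suc a) (+ suc b))
    class-cov i = cov-residue a b
    split : ∀ i → residueWeight a b i ≡ sumL (λ c → classWeight c i) (upTo (suc m))
    split (j , d) = sym (trans (sumL-support (λ c → classWeight c (j , d)) (upTo (suc m)) (j ℕDM.% suc m ∷ []) (UniqueP.upTo⁺ (suc m)) ([] ∷ [])
        (λ c nz _ → here (sym (𝟙-≢0 (j ℕDM.% suc m ℕP.≟ c) (≢0-*ˡ nz))))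
        (λ { c _ (here refl) → MemP.∈-upTo⁺ (ℕDM.m%n<n j (suc m)) }))
      (trans (ℤP.+-identityʳ _) (trans (cong (_* residueWeight a b (j , d)) (𝟙-yes (j ℕDM.% suc m ℕP.≟ _) refl)) (ℤP.*-identityˡ _))))
    +a′ : + suc a′ ≡ + suc m * + suc a
    +a′ = trans (cong +_ ea) (ℤP.pos-* (suc m) (suc a))
    +b′ : ∀ i → + suc (b′ i) ≡ + suc b + + i * + suc a
    +b′ i = trans (cong +_ (eb i)) (+-congʳ (+ suc b) (ℤP.pos-* i (suc a)))
    point : ∀ i j → + suc a * + (i ℕ.+ j ℕ.* suc m) + + suc b ≡ + suc a′ * + j + + suc (b′ i)
    point i j = trans (cong (λ z → + suc a * (+ i + z) + + suc b) (ℤP.pos-* j (suc m)))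
      (trans (lemma (+ suc a) (+ suc b) (+ i) (+ j) (+ suc m)) (sym (cong₂ (λ x y → x * + j + y) +a′ (+b′ i))))
      where
      lemma : ∀ a b i j m → a * (i + j * m) + b ≡ m * a * j + (b + i * a)
      lemma = solve-∀
    match : ∀ i → i ℕ.< suc m → Match (residueWeight a′ (b′ i)) (residueExp (+ suc a′) (+ suc (b′ i))) (classWeight i) (residueExp (+ suc a) (+ suc b))
    match i i< = record
      { to = λ (j , d) → i ℕ.+ j ℕ.* suc m , d ; from = λ (j , d) → j ℕDM./ suc m , d
      ; to-ok = λ (j , d) _ → weight-ok j d , cong (λ z → + 2 * (+ suc d * z)) (point i j) , cong (_, d) (quot j)
      ; from-ok = λ (j , d) nz → let e = back j (𝟙-≢0 (j ℕDM.% suc m ℕP.≟ i) (≢0-*ˡ nz)) in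
          trans (sym (weight-ok (j ℕDM./ suc m) d)) (cong (λ z → classWeight i (z , d)) e) , cong (_, d) e }
      where
      rem : ∀ j → (i ℕ.+ j ℕ.* suc m) ℕDM.% suc m ≡ i
      rem j = trans (ℕDM.[m+kn]%n≡m%n i j (suc m)) (ℕDM.m<n⇒m%n≡m i<)
      quot : ∀ j → (i ℕ.+ j ℕ.* suc m) ℕDM./ suc m ≡ j
      quot j = trans (ℕDM.+-distrib-/-∣ʳ i (ℕDiv.divides j refl)) (cong₂ ℕ._+_ (ℕDM.m<n⇒m/n≡0 i<) (ℕDM.m*n/n≡m j (suc m)))
      back : ∀ j → j ℕDM.% suc m ≡ i → i ℕ.+ j ℕDM./ suc m ℕ.* suc m ≡ j
      back j refl = sym (ℕDM.m≡m%n+[m/n]*n j (suc m))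
      weight-ok : ∀ j d → classWeight i (i ℕ.+ j ℕ.* suc m , d) ≡ residueWeight a′ (b′ i) (j , d)
      weight-ok j d = trans (cong₂ _*_ (𝟙-yes ((i ℕ.+ j ℕ.* suc m) ℕDM.% suc m ℕP.≟ i) (rem j)) (cong (+ 2 *_) (point i j))) (ℤP.*-identityˡ _)

  R-half : ∀ a a′ → suc a′ ≡ 2 ℕ.* suc a → R a a ≈ R a′ a ⊞ R a′ a′
  R-half a a′ ea N = trans (refineR 1 a a a′ start ea b-ok N)
      (+-congʳ (R a′ a N) (trans (ℤP.+-identityʳ _) (cong (λ z → R a′ z N) (sym a′≡))))
    where
    start : ℕ → ℕ
    start zero    = a
    start (suc i) = a ℕ.+ suc i ℕ.* suc a
    b-ok : ∀ i → suc (start i) ≡ suc a ℕ.+ i ℕ.* suc a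
    b-ok zero    = sym (ℕP.+-identityʳ (suc a))
    b-ok (suc i) = refl
    a′≡ : a′ ≡ a ℕ.+ 1 ℕ.* suc a
    a′≡ = ℕP.suc-injective ea

  -- Logarithmic derivatives of theta series.

  module LogDer (a b g : ℕ) (eq : + suc a ≡ + b + + g) where

    open Theta a b g eq

    α β : ℤ
    α = + suc a
    β = + b

    poleSlope : ℤ → ℤ
    poleSlope k = + 2 * (α * k + β)

    θ-base : Cov (λ _ → 1ℤ) thetaExp
    θ-base = cov-theta

    J-cov : Cov par thetaExp
    J-cov = cov-theta

    J : Series
    J = gf J-cov

    -- Σ (2x - y) q^(xy) over odd y is Σ x q^(xy) over all y, because a term with even y can be written with 2x and y/2.
    lambert : (l : Cov (λ (x , y) → + 2 * (α * (+ 2 * (+ y - + x) - 1ℤ))) lambertExp) → gf l ≈ ⊟ R a a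
    lambert l N = begin
      gf l N ≡⟨ gf-sum l-base u-cov v-cov l (λ _ ()) (λ _ ()) split N ⟩
      gf u-cov N + gf v-cov N ≡⟨ cong₂ _+_ (sym (gf-match (R-cov a′ a) u-match u-cov N)) (sym (gf-match t-cov v-match v-cov N)) ⟩
      R a′ a N + gf t-cov N ≡⟨ +-congʳ (R a′ a N) (gf-sum (unit-base a a) (Rσ-cov a a) neg-cov t-cov (λ _ ()) (λ _ ()) t-split N) ⟩
      R a′ a N + (Rσ a a N + gf neg-cov N) ≡⟨ cong₂ (λ x y → R a′ a N + (x + y)) (signedR a a a′ a′ ea ea N) neg-R ⟩
      R a′ a N + (R a′ a′ N + - R a a N + - R a a N) ≡⟨ lemma (R a′ a N) (R a′ a′ N) (R a a N) ⟩
      R a′ a N + R a′ a′ N - (R a a N + R a a N) ≡⟨ cong (_- (R a a N + R a a N)) (sym (R-half a a′ ea N)) ⟩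
      R a a N - (R a a N + R a a N) ≡⟨ lemma₂ (R a a N) ⟩
      - R a a N ∎
      where
      open ≡-Reasoning
      lemma : ∀ x y z → x + (y + - z + - z) ≡ x + y - (z + z)
      lemma = solve-∀
      lemma₂ : ∀ z → z - (z + z) ≡ - z
      lemma₂ = solve-∀
      a′ : ℕ
      a′ = suc (a ℕ.+ a)
      ea : suc a′ ≡ 2 ℕ.* suc a
      ea = cong suc (trans (sym (ℕP.+-suc a a)) (cong (λ z → a ℕ.+ suc z) (sym (ℕP.+-identityʳ a))))
      +a′ : + suc a′ ≡ + 2 * α
      +a′ = trans (cong +_ ea) (ℤP.pos-* 2 (suc a))
      l-base : Cov (λ _ → 1ℤ) lambertExp
      l-base = cov-lambert
      u v : ℕ × ℕ → ℤ
      u (x , y) = + 2 * (+ 2 * α * + y + α)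
      v (x , y) = - (+ 2 * (+ 2 * (α * (1ℤ + + x))))
      u-cov : Cov u lambertExp
      u-cov = cov-lambert
      v-cov : Cov v lambertExp
      v-cov = cov-lambert
      split : ∀ i → _ ≡ u i + v i
      split (x , y) = distrib α (+ x) (+ y)
        where
        distrib : ∀ α x y → + 2 * (α * (+ 2 * (y - x) - 1ℤ)) ≡ + 2 * (+ 2 * α * y + α) + - (+ 2 * (+ 2 * (α * (1ℤ + x))))
        distrib = solve-∀
      t : ℕ × ℕ → ℤ
      t (j , d) = (σ (suc d) + -1ℤ) * residueWeight a a (j , d)
      t-cov : Cov t (residueExp α α)
      t-cov = cov-residue a a
      neg-cov : Cov (λ i → - residueWeight a a i) (residueExp α α)
      neg-cov = cov-residue a a
      neg-R : gf neg-cov N ≡ - R a a N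
      neg-R = trans (gf-scale -1ℤ (R-cov a a) neg-cov (λ i → sym (ℤP.-1*i≡-i (residueWeight a a i))) N) (ℤP.-1*i≡-i (R a a N))
      t-split : ∀ i → t i ≡ signedWeight a a i + - residueWeight a a i
      t-split (j , d) = distrib (σ (suc d)) (residueWeight a a (j , d))
        where
        distrib : ∀ s w → (s + -1ℤ) * w ≡ s * w + - w
        distrib = solve-∀
      u-match : Match (residueWeight a′ a) (residueExp (+ suc a′) α) u lambertExp
      u-match = bijection-match (λ (j , d) → d , j) (λ (x , y) → y , x)
        (λ (j , d) → cong (λ z → + 2 * (z * + j + α)) (sym +a′))
        (λ (j , d) → trans (exp-ok α (+ j) (+ d)) (cong (λ z → + 2 * (+ suc d * (z * + j + α))) (sym +a′)))
        (λ _ → refl) (λ _ → refl)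
        where
        exp-ok : ∀ α j d → α * (+ 2 * ((1ℤ + d) * (1ℤ + (j + j)))) ≡ + 2 * ((1ℤ + d) * (+ 2 * α * j + α))
        exp-ok = solve-∀
      half : ℕ → ℕ
      half zero          = zero
      half (suc zero)    = zero
      half (suc (suc d)) = suc (half d)
      half-dbl : ∀ d → half (dbl d) ≡ d
      half-dbl zero    = refl
      half-dbl (suc d) = cong suc (half-dbl d)
      dbl-half : ∀ d → σ (suc d) + -1ℤ ≢ 0ℤ → dbl (half d) ≡ d
      dbl-half zero          nz = refl
      dbl-half (suc zero)    nz = contradiction refl nz
      dbl-half (suc (suc d)) nz = cong (suc ∘ suc) (dbl-half d (nz ∘ trans (cong (λ z → - z + -1ℤ) (ℤP.neg-involutive (σ d)))))
      v-match : Match t (residueExp α α) v lambertExp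
      v-match = record
        { to = λ (j , d) → j , half d ; from = λ (x , y) → x , dbl y
        ; to-ok = λ (j , d) nz → let e = dbl-half d (≢0-*ˡ nz) in
            trans (sym (weight-ok j (half d))) (cong (λ z → t (j , z)) e) ,
            trans (sym (exp-ok j (half d))) (cong (λ z → residueExp α α (j , z)) e) , cong (j ,_) e
        ; from-ok = λ (x , y) _ → weight-ok x y , cong (x ,_) (half-dbl y) }
        where
        weight-ok : ∀ x y → t (x , dbl y) ≡ v (x , y)
        weight-ok x y = trans (cong (λ z → (- z + -1ℤ) * residueWeight a a (x , dbl y)) (σ-even y)) (distrib α (+ x))
          where
          distrib : ∀ α x → (- 1ℤ + -1ℤ) * (+ 2 * (α * x + α)) ≡ - (+ 2 * (+ 2 * (α * (1ℤ + x))))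
          distrib = solve-∀
        exp-ok : ∀ x y → residueExp α α (x , dbl y) ≡ lambertExp (x , y)
        exp-ok x y = trans (cong (λ z → + 2 * ((1ℤ + z) * (α * + x + α))) (+dbl y)) (distrib α (+ x) (+ y))
          where
          distrib : ∀ α x y → + 2 * ((1ℤ + (y + y)) * (α * x + α)) ≡ α * (+ 2 * ((1ℤ + x) * (1ℤ + (y + y))))
          distrib = solve-∀

    thetaExp-0 : thetaExp 0ℤ ≡ 0ℤ
    thetaExp-0 = lemma α β
      where
      lemma : ∀ a b → a * (0ℤ * (0ℤ - 1ℤ)) + + 2 * (b * 0ℤ) ≡ 0ℤ
      lemma = solve-∀

    thetaExp-suc : ∀ m → thetaExp (1ℤ + m) ≡ thetaExp m + poleSlope m
    thetaExp-suc = lemma α β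
      where
      lemma : ∀ a b m → a * ((1ℤ + m) * (1ℤ + m - 1ℤ)) + + 2 * (b * (1ℤ + m)) ≡ a * (m * (m - 1ℤ)) + + 2 * (b * m) + + 2 * (a * m + b)
      lemma = solve-∀

    -- Reflection for h = poleSlope, i.e. for the derivation D.
    reflectD : (φ : ℤ → ℤ) (θ : Cov φ thetaExp)
               (c : Cov (poleWeight φ poleSlope thetaExp thetaExp-0 thetaExp-suc) (λ (n , i) → thetaExp n + poleExp i)) →
               D (gf θ) ⊞ gf c ≈ gf θ ⊛ (⊟ R a a)
    reflectD φ θ c N = begin
      D (gf θ) N + gf c N ≡⟨ +-congʳ (D (gf θ) N) (reflection φ poleSlope thetaExp thetaExp-0 thetaExp-suc c cov-out t cov-above l N) ⟩
      D (gf θ) N + (- gf t N + gf l N) ≡⟨ cong (λ z → D (gf θ) N + (- z + gf l N)) (gf-D θ t (λ m → ℤP.*-comm (φ m) (thetaExp m)) N) ⟩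
      D (gf θ) N + (- D (gf θ) N + gf l N) ≡⟨ cancel (D (gf θ) N) (gf l N) ⟩
      -- For this h the difference h(m + y - x - 1) - h(m + x - y) does not involve m, so the
      -- remaining terms form a product of `gf θ` with a Lambert series.
      gf l N ≡⟨ gf-cong l (cov-⊗ θ l′) weights (λ _ → refl) N ⟩
      gf (cov-⊗ θ l′) N ≡⟨ gf-⊗ θ l′ N ⟩
      (gf θ ⊛ gf l′) N ≡⟨ ⊛-cong {gf θ} (λ _ → refl) (lambert l′) N ⟩
      (gf θ ⊛ (⊟ R a a)) N ∎
      where
      open ≡-Reasoning
      cancel : ∀ x y → x + (- x + y) ≡ y
      cancel = solve-∀
      t : Cov (λ m → φ m * thetaExp m) thetaExp
      t = cov-theta
      l : Cov (λ (m , x , y) → φ m * (poleSlope (m + + y - + x - 1ℤ) - poleSlope (m + + x - + y))) aboveExp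
      l = cov-sub cov-above (λ _ ())
      l′ : Cov (λ (x , y) → + 2 * (α * (+ 2 * (+ y - + x) - 1ℤ))) lambertExp
      l′ = cov-lambert
      weights : ∀ i → _ ≡ _
      weights (m , x , y) = cong (φ m *_) (lemma α β m (+ x) (+ y))
        where
        lemma : ∀ α β m x y → + 2 * (α * (m + y - x - 1ℤ) + β) - + 2 * (α * (m + x - y) + β) ≡ + 2 * (α * (+ 2 * (y - x) - 1ℤ))
        lemma = solve-∀

  cov-cong : {I : Set} {w v E : I → ℤ} → Cov w E → (∀ i → w i ≡ v i) → Cov v E
  cov-cong c e = cov-sub c (λ i z → trans (sym (e i)) z)

  gf-zero : {I : Set} {w E : I → ℤ} (c : Cov w E) → (∀ i → w i ≡ 0ℤ) → gf c ≈ 𝟎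
  gf-zero {E = E} c z N = trans (gf-def c N) (sumL-zero _ (Cov.list c N) (λ i _ → cong (_* ind (E i) N) (z i)))

  ⊛-⊟ : ∀ f g → f ⊛ (⊟ g) ≈ ⊟ (f ⊛ g)
  ⊛-⊟ f g = ≈-sym (RingProperties.-‿distribʳ-* (CommutativeRing.ring seriesRing) f g)

  logDer : ∀ {f p l} → D f ⊞ f ⊛ p ≈ f ⊛ l → D f ≈ f ⊛ (l ⊞ ⊟ p)
  logDer {f} {p} {l} e n = begin
    D f n                                     ≡⟨ lemma (D f n) ((f ⊛ p) n) ⟩
    D f n + (f ⊛ p) n - (f ⊛ p) n             ≡⟨ cong (_- (f ⊛ p) n) (e n) ⟩
    (f ⊛ l) n - (f ⊛ p) n                     ≡⟨ +-congʳ ((f ⊛ l) n) (sym (⊛-⊟ f p n)) ⟩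
    (f ⊛ l) n + (f ⊛ (⊟ p)) n                 ≡⟨ sym (⊛-distribˡ f l (⊟ p) n) ⟩
    (f ⊛ (l ⊞ ⊟ p)) n                         ∎
    where
    open ≡-Reasoning
    lemma : ∀ x y → x ≡ x + y - y
    lemma = solve-∀

  par-neg : ∀ n → par (- n) ≡ par n
  par-neg (+ zero)  = refl
  par-neg (+ suc n) = refl
  par-neg -[1+ n ]  = refl

  par-shift : ∀ n k d → par (n + toward k d) * (n + toward k d) * σ (suc d) ≡ par n * n + par n * toward k d
  par-shift n k d = trans (lemma₁ (par (n + toward k d)) (n + toward k d) (σ (suc d)))
    (trans (cong (_* (n + toward k d)) (par-toward n k d)) (ℤP.*-distribˡ-+ (par n) n (toward k d)))
    where
    lemma₁ : ∀ p x s → p * x * s ≡ p * s * x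
    lemma₁ = solve-∀

  -- S a b = Σ y q^(2xy) over x ≡ b + 1 mod a + 1, x, y ≥ 1.
  cofactor : ℕ × ℕ → ℤ
  cofactor (j , d) = + suc d

  opaque
    S-cov : ∀ a b → Cov cofactor (residueExp (+ suc a) (+ suc b))
    S-cov a b = cov-residue a b

  S : ℕ → ℕ → Series
  S a b = gf (S-cov a b)

  module Positive (a b g : ℕ) (eq : + suc a ≡ + suc b + + suc g) where

    open LogDer a (suc b) (suc g) eq public
    open Theta a (suc b) (suc g) eq public

    cov-pole⁺ : ∀ {w} → Cov w poleExp
    cov-pole⁺ {w} = cov-pole {w} (cov-residue a b) (cov-residue a g)

    pole-sum : ∀ {w} (c : Cov w poleExp) (p : Cov (λ (j , d) → w (+ j , d)) (residueExp α (+ suc b)))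
               (n : Cov (λ (j , d) → w (-[1+ j ] , d)) (residueExp α (+ suc g))) → gf c ≈ gf p ⊞ gf n
    pole-sum {w} c p n N = trans (gf-irr c (cov-pole {w} p n) N) (pole-split {w} p n N)

    neg-slope : ∀ j → -1ℤ * poleSlope -[1+ j ] ≡ + 2 * (α * + j + + suc g)
    neg-slope j = trans (cong (λ z → -1ℤ * (+ 2 * (z * -[1+ j ] + β))) eq) (trans (lemma β (+ suc g) (+ j)) (cong (λ z → + 2 * (z * + j + + suc g)) (sym eq)))
      where
      lemma : ∀ b g j → -1ℤ * (+ 2 * ((b + g) * - (1ℤ + j) + b)) ≡ + 2 * ((b + g) * j + g)
      lemma = solve-∀

    Θ-cov : Cov (λ _ → 1ℤ) thetaExp
    Θ-cov = cov-theta

    Θ : Series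
    Θ = gf Θ-cov

    -- Jacobi's triple product with the factors 1 - q^(αm), 1 - q^(α(m-1)+β) and 1 - q^(αm-β), m ≥
    -- 1, in logarithmic form: one series `R` for each kind of factor.
    J-logDer : D J ≈ J ⊛ (⊟ R a a ⊞ ⊟ (R a b ⊞ R a g))
    J-logDer = logDer λ N → trans (+-congʳ (D J N) (sym (c≈ N))) (reflectD par J-cov c N)
      where
      w : ℤ × ℕ → ℤ
      w (k , d) = sgn k * poleSlope k
      P : Cov w poleExp
      P = cov-pole⁺
      p : Cov (λ (j , d) → w (+ j , d)) (residueExp α β)
      p = cov-residue a b
      n : Cov (λ (j , d) → w (-[1+ j ] , d)) (residueExp α (+ suc g))
      n = cov-residue a g
      weights : ∀ i → par (proj₁ i) * w (proj₂ i) ≡ poleWeight par poleSlope thetaExp thetaExp-0 thetaExp-suc i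
      weights (m , k , d) = sym (trans (sym (ℤP.*-assoc (par (m + toward k d)) (σ (suc d)) (w (k , d)))) (cong (_* w (k , d)) (par-toward m k d)))
      c : Cov (poleWeight par poleSlope thetaExp thetaExp-0 thetaExp-suc) (λ (n , i) → thetaExp n + poleExp i)
      c = cov-cong (cov-⊗ J-cov P) weights
      c≈ : gf c ≈ J ⊛ (R a b ⊞ R a g)
      c≈ N = trans (gf-cong c (cov-⊗ J-cov P) (sym ∘ weights) (λ _ → refl) N) (trans (gf-⊗ J-cov P N)
        (⊛-cong {J} (λ _ → refl) (λ M → trans (pole-sum P p n M) (cong₂ _+_
          (gf-cong p (R-cov a b) (λ (j , d) → ℤP.*-identityˡ (poleSlope (+ j))) (λ _ → refl) M)
          (gf-cong n (R-cov a g) (λ (j , d) → neg-slope j) (λ _ → refl) M))) N))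

    -- The same product with 1 + in place of 1 - in the last two kinds of factors. Here φ = 1, so
    -- the sign of the pole stays and `R` becomes `Rσ`.
    Θ-logDer : D Θ ≈ Θ ⊛ (⊟ R a a ⊞ ⊟ (Rσ a b ⊞ Rσ a g))
    Θ-logDer = logDer λ N → trans (+-congʳ (D Θ N) (sym (c≈ N))) (reflectD (λ _ → 1ℤ) Θ-cov c N)
      where
      w : ℤ × ℕ → ℤ
      w (k , d) = σ (suc d) * (sgn k * poleSlope k)
      P : Cov w poleExp
      P = cov-pole⁺
      p : Cov (λ (j , d) → w (+ j , d)) (residueExp α β)
      p = cov-residue a b
      n : Cov (λ (j , d) → w (-[1+ j ] , d)) (residueExp α (+ suc g))
      n = cov-residue a g
      c : Cov (poleWeight (λ _ → 1ℤ) poleSlope thetaExp thetaExp-0 thetaExp-suc) (λ (n , i) → thetaExp n + poleExp i)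
      c = cov-⊗ Θ-cov P
      c≈ : gf c ≈ Θ ⊛ (Rσ a b ⊞ Rσ a g)
      c≈ N = trans (gf-⊗ Θ-cov P N)
        (⊛-cong {Θ} (λ _ → refl) (λ M → trans (pole-sum P p n M) (cong₂ _+_
          (gf-cong p (Rσ-cov a b) (λ (j , d) → cong (σ (suc d) *_) (ℤP.*-identityˡ (poleSlope (+ j)))) (λ _ → refl) M)
          (gf-cong n (Rσ-cov a g) (λ (j , d) → cong (σ (suc d) *_) (neg-slope j)) (λ _ → refl) M))) N)

    Jz-cov : Cov (λ m → par m * m) thetaExp
    Jz-cov = cov-theta

    Jzz-cov : Cov (λ m → par m * m * m) thetaExp
    Jzz-cov = cov-theta

    Jz Jzz : Series
    Jz = gf Jz-cov
    Jzz = gf Jzz-cov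

    private
      one : ℤ → ℤ
      one _ = 1ℤ
      one-suc : ∀ m → 1ℤ + m ≡ m + one m
      one-suc m = ℤP.+-comm 1ℤ m
      C-cov : Cov (λ (k , d) → sgn k * one k) poleExp
      C-cov = cov-pole⁺
      P-cov : Cov (λ (k , d) → toward k d * (sgn k * one k)) poleExp
      P-cov = cov-pole⁺

      no-points : (φ : ℤ → ℤ) (l : Cov (λ (m , x , y) → φ m * (one (m + + y - + x - 1ℤ) - one (m + + x - + y))) aboveExp) → gf l ≈ 𝟎
      no-points φ l = gf-zero l (λ (m , _) → ℤP.*-zeroʳ (φ m))

      -- Reflection with h = 1; the terms above the boundary cancel because h is constant. As `Jz`
      -- is z dJ/dz for z = q^β, `gf C-cov` is minus the logarithmic derivative of J in z.
      J-C : J ⊛ gf C-cov ≈ ⊟ Jz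
      J-C N = begin
        (J ⊛ gf C-cov) N ≡⟨ sym (gf-⊗ J-cov C-cov N) ⟩
        gf (cov-⊗ J-cov C-cov) N ≡⟨ gf-cong (cov-⊗ J-cov C-cov) c weights (λ _ → refl) N ⟩
        gf c N ≡⟨ reflection par one id refl one-suc c cov-out Jz-cov cov-above l N ⟩
        - Jz N + gf l N ≡⟨ +-congʳ (- Jz N) (no-points par l N) ⟩
        - Jz N + 0ℤ ≡⟨ ℤP.+-identityʳ (- Jz N) ⟩
        - Jz N ∎
        where
        open ≡-Reasoning
        weights : ∀ i → par (proj₁ i) * (sgn (proj₁ (proj₂ i)) * 1ℤ) ≡ poleWeight par one id refl one-suc i
        weights (m , k , d) = sym (trans (sym (ℤP.*-assoc (par (m + toward k d)) (σ (suc d)) (sgn k * 1ℤ))) (cong (_* (sgn k * 1ℤ)) (par-toward m k d)))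
        c : Cov (poleWeight par one id refl one-suc) (λ (n , i) → thetaExp n + poleExp i)
        c = cov-cong (cov-⊗ J-cov C-cov) weights
        l : Cov (λ (m , x , y) → par m * (one (m + + y - + x - 1ℤ) - one (m + + x - + y))) aboveExp
        l = cov-sub cov-above (λ _ ())

      -- The relation `J-C` differentiated once more in z: reflection for φ m = `par m * m`, where
      -- `par-shift` supplies the two terms of the product rule.
      Jz-C : Jz ⊛ gf C-cov ⊞ J ⊛ gf P-cov ≈ ⊟ Jzz
      Jz-C N = begin
        (Jz ⊛ gf C-cov) N + (J ⊛ gf P-cov) N ≡⟨ sym (cong₂ _+_ (gf-⊗ Jz-cov C-cov N) (gf-⊗ J-cov P-cov N)) ⟩
        gf (cov-⊗ Jz-cov C-cov) N + gf (cov-⊗ J-cov P-cov) N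
          ≡⟨ sym (gf-sum base (cov-⊗ Jz-cov C-cov) (cov-⊗ J-cov P-cov) c (λ { (_ , (+ _) , _) () ; (_ , -[1+ _ ] , _) () })
               (λ { (_ , (+ _) , _) () ; (_ , -[1+ _ ] , _) () }) weights N) ⟩
        gf c N ≡⟨ reflection φ one id refl one-suc c cov-out Jzz-cov cov-above l N ⟩
        - Jzz N + gf l N ≡⟨ +-congʳ (- Jzz N) (no-points φ l N) ⟩
        - Jzz N + 0ℤ ≡⟨ ℤP.+-identityʳ (- Jzz N) ⟩
        - Jzz N ∎
        where
        open ≡-Reasoning
        φ : ℤ → ℤ
        φ m = par m * m
        base : Cov (λ i → 1ℤ * (sgn (proj₁ (proj₂ i)) * 1ℤ)) (λ (n , i) → thetaExp n + poleExp i)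
        base = cov-⊗ θ-base C-cov
        weights : ∀ i → poleWeight φ one id refl one-suc i ≡ _
        weights (m , k , d) = trans (sym (ℤP.*-assoc (φ (m + toward k d)) (σ (suc d)) (sgn k * 1ℤ)))
          (trans (cong (_* (sgn k * 1ℤ)) (par-shift m k d)) (lemma (par m) m (toward k d) (sgn k * 1ℤ)))
          where
          lemma : ∀ p m t s → (p * m + p * t) * s ≡ p * m * s + p * (t * s)
          lemma = solve-∀
        c : Cov (poleWeight φ one id refl one-suc) (λ (n , i) → thetaExp n + poleExp i)
        c = cov-sub base (λ { (_ , (+ _) , _) () ; (_ , -[1+ _ ] , _) () })
        l : Cov (λ (m , x , y) → φ m * (one (m + + y - + x - 1ℤ) - one (m + + x - + y))) aboveExp
        l = cov-sub cov-above (λ _ ())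

    -- The second logarithmic derivative of J with respect to z = q^β.
    J-℘ : J ⊛ J ⊛ (S a b ⊞ S a g) ⊞ J ⊛ Jzz ≈ Jz ⊛ Jz
    J-℘ N = begin
      (J ⊛ J ⊛ (S a b ⊞ S a g)) N + (J ⊛ Jzz) N ≡⟨ cong (_+ (J ⊛ Jzz) N) (⊛-cong {J ⊛ J} (λ _ → refl) (λ M → sym (P≈ M)) N) ⟩
      (J ⊛ J ⊛ P) N + (J ⊛ Jzz) N ≡⟨ +-congʳ ((J ⊛ J ⊛ P) N) (trans (double-neg ((J ⊛ Jzz) N)) (cong -_ (sym (⊛-⊟ J Jzz N)))) ⟩
      (J ⊛ J ⊛ P) N - (J ⊛ (⊟ Jzz)) N ≡⟨ cong (λ z → (J ⊛ J ⊛ P) N - z) (⊛-cong {J} (λ _ → refl) (λ M → sym (Jz-C M)) N) ⟩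
      (J ⊛ J ⊛ P) N - (J ⊛ (Jz ⊛ C ⊞ J ⊛ P)) N ≡⟨ cong (λ z → (J ⊛ J ⊛ P) N - z) (expand J Jz C P N) ⟩
      (J ⊛ J ⊛ P) N - ((Jz ⊛ (J ⊛ C)) N + (J ⊛ J ⊛ P) N) ≡⟨ cancel ((J ⊛ J ⊛ P) N) ((Jz ⊛ (J ⊛ C)) N) ⟩
      - (Jz ⊛ (J ⊛ C)) N ≡⟨ cong -_ (⊛-cong {Jz} (λ _ → refl) J-C N) ⟩
      - (Jz ⊛ (⊟ Jz)) N ≡⟨ cong -_ (⊛-⊟ Jz Jz N) ⟩
      - - (Jz ⊛ Jz) N ≡⟨ ℤP.neg-involutive _ ⟩
      (Jz ⊛ Jz) N ∎
      where
      open ≡-Reasoning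
      C P : Series
      C = gf C-cov
      P = gf P-cov
      double-neg : ∀ x → x ≡ - - x
      double-neg x = sym (ℤP.neg-involutive x)
      cancel : ∀ x y → x - (y + x) ≡ - y
      cancel = solve-∀
      expand : ∀ J Z C P → J ⊛ (Z ⊛ C ⊞ J ⊛ P) ≈ Z ⊛ (J ⊛ C) ⊞ J ⊛ J ⊛ P
      expand = solve 4 (λ J Z C P → J :* (Z :* C :+ J :* P) := Z :* (J :* C) :+ J :* J :* P) ≈-refl
      p : Cov (λ (j , d) → + suc d * (1ℤ * 1ℤ)) (residueExp α β)
      p = cov-residue a b
      n : Cov (λ (j , d) → -[1+ d ] * (-1ℤ * 1ℤ)) (residueExp α (+ suc g))
      n = cov-residue a g
      P≈ : P ≈ S a b ⊞ S a g
      P≈ M = trans (pole-sum P-cov p n M) (cong₂ _+_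
        (gf-cong p (S-cov a b) (λ (j , d) → ℤP.*-identityʳ (+ suc d)) (λ _ → refl) M)
        (gf-cong n (S-cov a g) (λ (j , d) → lemma (+ suc d)) (λ _ → refl) M))
        where
        lemma : ∀ x → - x * (-1ℤ * 1ℤ) ≡ x
        lemma = solve-∀

  -- The derivative of theta at its zero, and the cube of Euler's product.

  module Eta (a : ℕ) where

    open LogDer a 0 (suc a) refl public
    open Theta a 0 (suc a) refl public

    T-cov : Cov (λ m → par m * m) thetaExp
    T-cov = cov-theta

    T : Series
    T = gf T-cov

    -- For β = 0 the map n ↦ 1 - n preserves the exponent and reverses the sign. Hence theta
    -- vanishes and its derivative `T` takes its place.
    J≈0 : J ≈ 𝟎
    J≈0 = involution-zero J-cov (bijection-match to to (λ n → trans (cong -_ (trans (par-suc (- n)) (cong -_ (par-neg n)))) (ℤP.neg-involutive (par n)))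
      (λ n → exp-ok α n) invol invol)
      where
      to : ℤ → ℤ
      to n = 1ℤ + - n
      invol : ∀ n → 1ℤ + - (1ℤ + - n) ≡ n
      invol = solve-∀
      exp-ok : ∀ α n → α * ((1ℤ + - n) * (1ℤ + - n - 1ℤ)) + + 2 * (0ℤ * (1ℤ + - n)) ≡ α * (n * (n - 1ℤ)) + + 2 * (0ℤ * n)
      exp-ok = solve-∀

    private
      residue-0 : ∀ j d → residueExp α 0ℤ (suc j , d) ≡ residueExp α α (j , d)
      residue-0 j d = lemma α (+ j) (+ d)
        where
        lemma : ∀ α j d → + 2 * ((1ℤ + d) * (α * (1ℤ + j) + 0ℤ)) ≡ + 2 * ((1ℤ + d) * (α * j + α))
        lemma = solve-∀

      -- For β = 0 the pole k = 0 has exponent 0 for every d, so only weights vanishing there define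
      -- a series.
      module _ {w : ℤ × ℕ → ℤ} (w0 : ∀ d → w (+ 0 , d) ≡ 0ℤ) where

        shift-match : Match (λ (j , d) → w (+ suc j , d)) (residueExp α α) (λ (j , d) → w (+ j , d)) (residueExp α 0ℤ)
        shift-match = record
          { to = λ (j , d) → suc j , d ; from = λ { (zero , d) → zero , d ; (suc j , d) → j , d }
          ; to-ok = λ (j , d) _ → refl , residue-0 j d , refl
          ; from-ok = λ { (zero , d) nz → contradiction (w0 d) nz ; (suc j , d) nz → refl , refl } }

        cov-pole⁰ : Cov w poleExp
        cov-pole⁰ = cov-pole {w} (cov-match (cov-residue a a) shift-match) (cov-residue a a)

        pole-sum⁰ : (c : Cov w poleExp) (p : Cov (λ (j , d) → w (+ suc j , d)) (residueExp α α))
                    (n : Cov (λ (j , d) → w (-[1+ j ] , d)) (residueExp α α)) → gf c ≈ gf p ⊞ gf n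
        pole-sum⁰ c p n N = trans (gf-irr c (cov-pole {w} (cov-match p shift-match) n) N)
          (trans (pole-split {w} (cov-match p shift-match) n N) (cong (_+ gf n N) (sym (gf-match p shift-match (cov-match p shift-match) N))))

    -- Reflection for φ m = `par m * m` yields a second product, but it contains the factor `J`,
    -- which is 0. The result is three times the logarithmic derivative of ∏ (1 - q^(αm)): Jacobi's
    -- formula for the cube of that product.
    T-logDer : D T ≈ T ⊛ (⊟ R a a ⊞ ⊟ (R a a ⊞ R a a))
    T-logDer = logDer λ N → trans (+-congʳ (D T N) (sym (c≈ N))) (reflectD φ T-cov c N)
      where
      φ : ℤ → ℤ
      φ m = par m * m
      slope0 : poleSlope 0ℤ ≡ 0ℤ
      slope0 = lemma α
        where
        lemma : ∀ α → + 2 * (α * 0ℤ + 0ℤ) ≡ 0ℤ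
        lemma = solve-∀
      w w′ : ℤ × ℕ → ℤ
      w (k , d) = sgn k * poleSlope k
      w′ (k , d) = toward k d * (sgn k * poleSlope k)
      w0 : ∀ d → w (+ 0 , d) ≡ 0ℤ
      w0 d = cong (1ℤ *_) slope0
      w′0 : ∀ d → w′ (+ 0 , d) ≡ 0ℤ
      w′0 d = trans (cong (+ suc d *_) (w0 d)) (ℤP.*-zeroʳ (+ suc d))
      P : Cov w poleExp
      P = cov-pole⁰ w0
      P′ : Cov w′ poleExp
      P′ = cov-pole⁰ w′0
      base : Cov (λ i → 1ℤ * w (proj₂ i)) (λ (n , i) → thetaExp n + poleExp i)
      base = cov-⊗ θ-base P
      base≪ : ∀ n i → 1ℤ * w i ≡ 0ℤ → w i ≡ 0ℤ
      base≪ n i z = trans (sym (ℤP.*-identityˡ (w i))) z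
      u≪ : ∀ i → 1ℤ * w (proj₂ i) ≡ 0ℤ → par (proj₁ i) * proj₁ i * w (proj₂ i) ≡ 0ℤ
      u≪ (n , i) z = trans (cong (par n * n *_) (base≪ n i z)) (ℤP.*-zeroʳ (par n * n))
      v≪ : ∀ i → 1ℤ * w (proj₂ i) ≡ 0ℤ → par (proj₁ i) * w′ (proj₂ i) ≡ 0ℤ
      v≪ (n , k , d) z = trans (cong (λ y → par n * (toward k d * y)) (base≪ n (k , d) z)) (lemma (par n) (toward k d))
        where
        lemma : ∀ p t → p * (t * 0ℤ) ≡ 0ℤ
        lemma = solve-∀
      weights : ∀ i → poleWeight φ poleSlope thetaExp thetaExp-0 thetaExp-suc i ≡ par (proj₁ i) * proj₁ i * w (proj₂ i) + par (proj₁ i) * w′ (proj₂ i)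
      weights (m , k , d) = trans (sym (ℤP.*-assoc (φ (m + toward k d)) (σ (suc d)) (w (k , d))))
          (trans (cong (_* w (k , d)) (par-shift m k d)) (lemma (par m) m (toward k d) (w (k , d))))
        where
        lemma : ∀ p m t s → (p * m + p * t) * s ≡ p * m * s + p * (t * s)
        lemma = solve-∀
      c : Cov (poleWeight φ poleSlope thetaExp thetaExp-0 thetaExp-suc) (λ (n , i) → thetaExp n + poleExp i)
      c = cov-sub base (λ i z → trans (weights i) (cong₂ _+_ (u≪ i z) (v≪ i z)))
      p : Cov (λ (j , d) → w (+ suc j , d)) (residueExp α α)
      p = cov-residue a a
      n : Cov (λ (j , d) → w (-[1+ j ] , d)) (residueExp α α)
      n = cov-residue a a
      c≈ : gf c ≈ T ⊛ (R a a ⊞ R a a)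
      c≈ N = begin
        gf c N ≡⟨ gf-sum base (cov-⊗ T-cov P) (cov-⊗ J-cov P′) c u≪ v≪ weights N ⟩
        gf (cov-⊗ T-cov P) N + gf (cov-⊗ J-cov P′) N ≡⟨ cong₂ _+_ (gf-⊗ T-cov P N) (gf-⊗ J-cov P′ N) ⟩
        (T ⊛ gf P) N + (J ⊛ gf P′) N ≡⟨ cong₂ _+_ (⊛-cong {T} (λ _ → refl) P≈ N) (trans (⊛-cong J≈0 (λ _ → refl) N) (⊛-zeroˡ (gf P′) N)) ⟩
        (T ⊛ (R a a ⊞ R a a)) N + 0ℤ ≡⟨ ℤP.+-identityʳ _ ⟩
        (T ⊛ (R a a ⊞ R a a)) N ∎
        where
        open ≡-Reasoning
        P≈ : gf P ≈ R a a ⊞ R a a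
        P≈ M = trans (pole-sum⁰ w0 P p n M) (cong₂ _+_
          (gf-cong p (R-cov a a) (λ (j , d) → lemma⁺ α (+ j)) (λ _ → refl) M)
          (gf-cong n (R-cov a a) (λ (j , d) → lemma⁻ α (+ j)) (λ _ → refl) M))
          where
          lemma⁺ : ∀ α j → 1ℤ * (+ 2 * (α * (1ℤ + j) + 0ℤ)) ≡ + 2 * (α * j + α)
          lemma⁺ = solve-∀
          lemma⁻ : ∀ α j → -1ℤ * (+ 2 * (α * - (1ℤ + j) + 0ℤ)) ≡ + 2 * (α * j + α)
          lemma⁻ = solve-∀

  -- Residue classes, and the rotation of ℤ² by its index-two sublattice.

  div-unique : ∀ m (i j : ℕ) (s t : ℤ) → i ℕ.< suc m → j ℕ.< suc m → + i + s * + suc m ≡ + j + t * + suc m → i ≡ j × s ≡ t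
  div-unique m i j s t i< j< e with ∣ s - t ∣ in abs
  ... | zero  = ℤP.+-injective (trans (sym (lemma₁ (+ i) (s * + suc m)))
                  (trans (cong (_- s * + suc m) (trans e (cong (λ z → + j + z * + suc m) (sym s≡t)))) (lemma₁ (+ j) (s * + suc m)))) , s≡t
    where
    s≡t : s ≡ t
    s≡t = ℤP.i-j≡0⇒i≡j s t (ℤP.∣i∣≡0⇒i≡0 abs)
    lemma₁ : ∀ x y → x + y - y ≡ x
    lemma₁ = solve-∀
  ... | suc k = contradiction (begin-strict
      ∣ + j - + i ∣                ≡⟨ cong ∣_∣ (ℤP.m-n≡m⊖n j i) ⟩
      ∣ j ⊖ i ∣                    ≤⟨ ℤP.∣m⊝n∣≤m⊔n j i ⟩
      j ℕ.⊔ i                      <⟨ ℕP.⊔-lub j< i< ⟩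
      suc m                        ≤⟨ ℕP.m≤m+n (suc m) _ ⟩
      suc k ℕ.* suc m              ≡⟨ cong (ℕ._* suc m) (sym abs) ⟩
      ∣ s - t ∣ ℕ.* suc m          ≡⟨ sym (ℤP.abs-* (s - t) (+ suc m)) ⟩
      ∣ (s - t) * + suc m ∣        ≡⟨ cong ∣_∣ diff ⟩
      ∣ + j - + i ∣                ∎) (ℕP.<-irrefl refl)
    where
    open ℕP.≤-Reasoning
    diff : (s - t) * + suc m ≡ + j - + i
    diff = trans (lemma₁ s t (+ suc m) (+ i)) (trans (cong (λ z → z - t * + suc m - + i) e) (lemma₂ (+ j) (t * + suc m) (+ i)))
      where
      lemma₁ : ∀ s t m i → (s - t) * m ≡ i + s * m - t * m - i
      lemma₁ = solve-∀
      lemma₂ : ∀ j x i → j + x - x - i ≡ j - i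
      lemma₂ = solve-∀

  %-point : ∀ m i t → i ℕ.< suc m → (+ i + t * + suc m) ℤDM.%ℕ suc m ≡ i × (+ i + t * + suc m) ℤDM./ℕ suc m ≡ t
  %-point m i t i< = let (p , q) = div-unique m i (x ℤDM.%ℕ suc m) t (x ℤDM./ℕ suc m) i< (ℤDM.n%ℕd<d x (suc m)) (ℤDM.a≡a%ℕn+[a/ℕn]*n x (suc m)) in sym p , sym q
    where
    x = + i + t * + suc m

  record Cosets (I K : Set) (m : ℕ) : Set where
    field
      class : I → ℕ
      class< : ∀ x → class x ℕ.< suc m
      coord : I → K
      embed : ℕ → K → I
      embed-coord : ∀ x → embed (class x) (coord x) ≡ x
      class-embed : ∀ i y → i ℕ.< suc m → class (embed i y) ≡ i
      coord-embed : ∀ i y → i ℕ.< suc m → coord (embed i y) ≡ y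

  module _ {I K : Set} {m : ℕ} (P : Cosets I K m) {w E : I → ℤ} (c : Cov w E) where
    open Cosets P

    coset-split : (f : ℕ → Series) → (∀ i → i ℕ.< suc m → (d : Cov (w ∘ embed i) (E ∘ embed i)) → gf d ≈ f i) →
                  ∀ N → gf c N ≡ sumL (λ i → f i N) (upTo (suc m))
    coset-split f each N = trans (gf-sums c (upTo (suc m)) class-cov c class≪ split N)
        (sumL-cong∈ (upTo (suc m)) (λ i i∈ → let i< = MemP.∈-upTo⁻ i∈ ; d = cov-match (class-cov i) (match i i<) in
          trans (gf-match (class-cov i) (match i i<) d N) (each i i< d N)))
      where
      classWeight : ℕ → I → ℤ
      classWeight i x = 𝟙 (class x ℕP.≟ i) * w x
      class≪ : ∀ i x → w x ≡ 0ℤ → classWeight i x ≡ 0ℤ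
      class≪ i x z = trans (cong (𝟙 (class x ℕP.≟ i) *_) z) (ℤP.*-zeroʳ (𝟙 (class x ℕP.≟ i)))
      class-cov : ∀ i → Cov (classWeight i) E
      class-cov i = cov-sub c (class≪ i)
      split : ∀ x → w x ≡ sumL (λ i → classWeight i x) (upTo (suc m))
      split x = sym (trans (sumL-support (λ i → classWeight i x) (upTo (suc m)) (class x ∷ []) (UniqueP.upTo⁺ (suc m)) ([] ∷ [])
          (λ i nz _ → here (sym (𝟙-≢0 (class x ℕP.≟ i) (≢0-*ˡ nz))))
          (λ { i _ (here refl) → MemP.∈-upTo⁺ (class< x) }))
        (trans (ℤP.+-identityʳ (classWeight (class x) x))
          (trans (cong (_* w x) (𝟙-yes (class x ℕP.≟ class x) refl)) (ℤP.*-identityˡ (w x)))))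
      match : ∀ i → i ℕ.< suc m → Match (classWeight i) E (w ∘ embed i) (E ∘ embed i)
      match i i< = record
        { to = coord ; from = embed i
        ; to-ok = λ x nz → let e = back x (𝟙-≢0 (class x ℕP.≟ i) (≢0-*ˡ nz)) in
            trans (sym (weight-ok (coord x))) (cong (classWeight i) e) , cong E e , e
        ; from-ok = λ y _ → weight-ok y , coord-embed i y i< }
        where
        back : ∀ x → class x ≡ i → embed i (coord x) ≡ x
        back x refl = embed-coord x
        weight-ok : ∀ y → classWeight i (embed i y) ≡ w (embed i y)
        weight-ok y = trans (cong (_* w (embed i y)) (𝟙-yes (class (embed i y) ℕP.≟ i) (class-embed i y i<))) (ℤP.*-identityˡ (w (embed i y)))

  residues : ∀ m → Cosets ℤ ℤ m
  residues m = record
    { class = ℤDM._%ℕ suc m ; class< = λ x → ℤDM.n%ℕd<d x (suc m) ; coord = ℤDM._/ℕ suc m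
    ; embed = λ i t → + i + t * + suc m
    ; embed-coord = λ x → sym (ℤDM.a≡a%ℕn+[a/ℕn]*n x (suc m))
    ; class-embed = λ i t i< → proj₁ (%-point m i t i<)
    ; coord-embed = λ i t i< → proj₂ (%-point m i t i<) }

  record _≅_ (I J : Set) : Set where
    field
      to      : I → J
      from    : J → I
      from-to : ∀ i → from (to i) ≡ i
      to-from : ∀ j → to (from j) ≡ j

  residues-via : ∀ {I K : Set} m → I ≅ (ℤ × K) → Cosets I (ℤ × K) m
  residues-via {I} {K} m iso = record
    { class = λ x → proj₁ (to x) ℤDM.%ℕ suc m ; class< = λ x → ℤDM.n%ℕd<d (proj₁ (to x)) (suc m)
    ; coord = λ x → proj₁ (to x) ℤDM./ℕ suc m , proj₂ (to x)
    ; embed = λ i (t , k) → from (+ i + t * + suc m , k)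
    ; embed-coord = λ x → trans (cong (λ z → from (z , proj₂ (to x))) (sym (ℤDM.a≡a%ℕn+[a/ℕn]*n (proj₁ (to x)) (suc m)))) (from-to x)
    ; class-embed = λ i (t , k) i< → trans (cong (λ z → proj₁ z ℤDM.%ℕ suc m) (to-from _)) (proj₁ (%-point m i t i<))
    ; coord-embed = λ i (t , k) i< → trans (cong (λ z → proj₁ z ℤDM./ℕ suc m , proj₂ z) (to-from _)) (cong (_, k) (proj₂ (%-point m i t i<))) }
    where open _≅_ iso

  -- The pairs with n ≡ n′ mod 2 are exactly the (s + t, s - t); the other coset is this lattice
  -- moved by 1 in the first coordinate.
  parity-split : {w E : ℤ × ℤ → ℤ} (c : Cov w E)
    {w₀ E₀ w₁ E₁ : ℤ × ℤ → ℤ} (e : Cov w₀ E₀) (o : Cov w₁ E₁) →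
    (∀ s t → w₀ (s , t) ≡ w (s + t , s - t)) → (∀ s t → E₀ (s , t) ≡ E (s + t , s - t)) →
    (∀ s t → w₁ (s , t) ≡ w (s + t + 1ℤ , s - t)) → (∀ s t → E₁ (s , t) ≡ E (s + t + 1ℤ , s - t)) →
    gf c ≈ gf e ⊞ gf o
  parity-split {w} {E} c {w₀} {E₀} {w₁} {E₁} e o we Ee wo Eo N = trans (coset-split P c half each N) (+-congʳ (gf e N) (ℤP.+-identityʳ (gf o N)))
    where
    iso : (ℤ × ℤ) ≅ (ℤ × ℤ)
    iso = record { to = λ (n , n′) → n - n′ , n′ ; from = λ (v , n′) → v + n′ , n′
                 ; from-to = λ (n , n′) → cong (_, n′) (lemma₁ n n′) ; to-from = λ (v , n′) → cong (_, n′) (lemma₂ v n′) }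
      where
      lemma₁ : ∀ n m → n - m + m ≡ n
      lemma₁ = solve-∀
      lemma₂ : ∀ n m → n + m - m ≡ n
      lemma₂ = solve-∀
    P : Cosets (ℤ × ℤ) (ℤ × ℤ) 1
    P = residues-via 1 iso
    module P = Cosets P
    back : ∀ n t → n + t - t ≡ n
    back = solve-∀
    forth : ∀ s t → s - t + t ≡ s
    forth = solve-∀
    half : ℕ → Series
    half zero    = gf e
    half (suc _) = gf o
    match₀ : Match (w ∘ P.embed 0) (E ∘ P.embed 0) w₀ E₀
    match₀ = bijection-match (λ (t , n′) → n′ + t , t) (λ (s , t) → t , s - t)
      (λ (t , n′) → trans (we (n′ + t) t) (cong w (point t n′)))
      (λ (t , n′) → trans (Ee (n′ + t) t) (cong E (point t n′)))
      (λ (t , n′) → cong (t ,_) (back n′ t)) (λ (s , t) → cong (_, t) (forth s t))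
      where
      point : ∀ t n′ → (n′ + t + t , n′ + t - t) ≡ P.embed 0 (t , n′)
      point t n′ = cong₂ _,_ (lemma t n′) (back n′ t)
        where
        lemma : ∀ t n → n + t + t ≡ 0ℤ + t * + 2 + n
        lemma = solve-∀
    match₁ : Match (w ∘ P.embed 1) (E ∘ P.embed 1) w₁ E₁
    match₁ = bijection-match (λ (t , n′) → n′ + t , t) (λ (s , t) → t , s - t)
      (λ (t , n′) → trans (wo (n′ + t) t) (cong w (point t n′)))
      (λ (t , n′) → trans (Eo (n′ + t) t) (cong E (point t n′)))
      (λ (t , n′) → cong (t ,_) (back n′ t)) (λ (s , t) → cong (_, t) (forth s t))
      where
      point : ∀ t n′ → (n′ + t + t + 1ℤ , n′ + t - t) ≡ P.embed 1 (t , n′)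
      point t n′ = cong₂ _,_ (lemma t n′) (back n′ t)
        where
        lemma : ∀ t n → n + t + t + 1ℤ ≡ 1ℤ + t * + 2 + n
        lemma = solve-∀
    each : ∀ i → i ℕ.< 2 → (d : Cov (w ∘ P.embed i) (E ∘ P.embed i)) → gf d ≈ half i
    each zero          _ d = gf-match d match₀ e
    each (suc zero)    _ d = gf-match d match₁ o
    each (suc (suc i)) (s≤s (s≤s ())) d

  par-hom : ∀ x y → par (x + y) ≡ par x * par y
  par-hom x (+ d)    = par-+ x d
  par-hom x -[1+ d ] = trans (lemma (par (x + -[1+ d ])) (σ (suc d)) (σ-square (suc d)))
                             (cong (_* σ (suc d)) (par-toward x -[1+ 0 ] d))
    where
    lemma : ∀ p s → s * s ≡ 1ℤ → p ≡ p * s * s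
    lemma p s e = sym (trans (ℤP.*-assoc p s s) (trans (cong (p *_) e) (ℤP.*-identityʳ p)))

  par-square : ∀ x → par x * par x ≡ 1ℤ
  par-square (+ n)    = σ-square n
  par-square -[1+ n ] = σ-square (suc n)

  par-rotate : ∀ s t → par (s + t) * par (s - t) ≡ 1ℤ
  par-rotate s t = trans (sym (par-hom (s + t) (s - t))) (trans (cong par (lemma s t)) (trans (par-hom s s) (par-square s)))
    where
    lemma : ∀ s t → s + t + (s - t) ≡ s + s
    lemma = solve-∀

  par-rotate′ : ∀ s t → par (s + t + 1ℤ) * par (s - t) ≡ -1ℤ
  par-rotate′ s t = trans (cong (_* par (s - t)) (trans (cong par (ℤP.+-comm (s + t) 1ℤ)) (par-suc (s + t))))
    (trans (lemma (par (s + t)) (par (s - t))) (cong -_ (par-rotate s t)))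
    where
    lemma : ∀ x y → - x * y ≡ - (x * y)
    lemma = solve-∀

  point-cov : ∀ k → Cov {⊤} (λ _ → 1ℤ) (λ _ → + k)
  point-cov k = record { nonneg = λ _ _ → k , refl ; list = λ _ → tt ∷ [] ; uniq = λ _ → [] ∷ [] ; covers = λ _ _ _ _ → here refl }

  gf-point : ∀ k → gf (point-cov k) ≈ mono k
  gf-point k N = trans (gf-def (point-cov k) N) (trans (ℤP.+-identityʳ _) (ℤP.*-identityˡ (mono k N)))

  module _ {I : Set} {w E : I → ℤ} (k : ℕ) (c : Cov w E) where

    private
      match : Match (λ (i : ⊤ × I) → 1ℤ * w (proj₂ i)) (λ i → + k + E (proj₂ i)) w (λ i → + k + E i)
      match = bijection-match proj₂ (tt ,_) (λ (_ , i) → sym (ℤP.*-identityˡ (w i))) (λ _ → refl) (λ _ → refl) (λ _ → refl)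

    cov-shift : Cov w (λ i → + k + E i)
    cov-shift = cov-match (cov-⊗ (point-cov k) c) match

    gf-shift : gf cov-shift ≈ mono k ⊛ gf c
    gf-shift N = trans (sym (gf-match (cov-⊗ (point-cov k) c) match cov-shift N))
      (trans (gf-⊗ (point-cov k) c N) (⊛-cong {g = gf c} (gf-point k) (λ _ → refl) N))

  ⊛-⊟ˡ : ∀ f g → (⊟ f) ⊛ g ≈ ⊟ (f ⊛ g)
  ⊛-⊟ˡ f g N = trans (⊛-comm (⊟ f) g N) (trans (⊛-⊟ g f N) (cong -_ (⊛-comm g f N)))

  gf-neg : {I : Set} {w E : I → ℤ} (c : Cov w E) (d : Cov (λ i → - w i) E) → gf d ≈ ⊟ gf c
  gf-neg {w = w} c d N = trans (gf-scale -1ℤ c d (λ i → sym (ℤP.-1*i≡-i (w i))) N) (ℤP.-1*i≡-i (gf c N))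

  -- Products of two theta series, and the difference of two values of ℘.

  -- q-series in even powers of q, with exponents 20 n(n - 1) + 2 b n.
  module Q (b g : ℕ) (eq : + 20 ≡ + b + + g) where
    open Theta 19 b g eq public using (thetaExp; cov-theta)
    Θ-cov : Cov (λ _ → 1ℤ) thetaExp
    Θ-cov = cov-theta
    Θ : Series
    Θ = gf Θ-cov
    M-cov : Cov (λ n → n) thetaExp
    M-cov = cov-theta
    K-cov : Cov (λ n → n * n) thetaExp
    K-cov = cov-theta
    M K : Series
    M = gf M-cov
    K = gf K-cov

  module Q₀ = Q 0 20 refl
  module Q₂ = Q 2 18 refl
  module Q₆ = Q 6 14 refl
  module Q₈ = Q 8 12 refl
  module Q₁₀ = Q 10 10 refl
  module Q₁₂ = Q 12 8 refl
  module Q₁₆ = Q 16 4 refl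
  module Q₁₈ = Q 18 2 refl
  module Q₂₀ = Q 20 0 refl

  neg-match : {w v E F : ℤ → ℤ} → (∀ n → v (- n) ≡ w n) → (∀ n → F (- n) ≡ E n) → Match w E v F
  neg-match p q = bijection-match -_ -_ p q ℤP.neg-involutive ℤP.neg-involutive

  -- The weights of `B₀` and `B₁` are (n - n′)² in rotated coordinates: n - n′ is 2t on the even
  -- coset and 2t + 1 on the odd one. Like `b₀` and `b₁`, these series are the same for all β.
  B₀-cov : Cov (λ t → + 4 * (t * t)) Q₁₀.thetaExp
  B₀-cov = Q₁₀.cov-theta

  B₁-cov : Cov (λ t → (t + t + 1ℤ) * (t + t + 1ℤ)) Q₂₀.thetaExp
  B₁-cov = Q₂₀.cov-theta

  B₀ B₁ b₀ b₁ : Series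
  B₀ = gf B₀-cov
  B₁ = gf B₁-cov
  b₀ = Q₁₀.Θ
  b₁ = Q₂₀.Θ

  -- `G₀` and `G₁` collect the sums over s and carry all dependence on β. The numbers 2β and 10 +
  -- 2β, and the shift by `k`, come from completing squares on the two cosets.
  module Rotation (b g b₀′ g₀ b₁′ g₁ : ℕ) (eq : + 10 ≡ + suc b + + suc g)
                  (eq₀ : + 20 ≡ + b₀′ + + g₀) (eq₁ : + 20 ≡ + b₁′ + + g₁)
                  (β₀ : + b₀′ ≡ + 2 * + suc b) (β₁ : + b₁′ ≡ + 10 + + 2 * + suc b) (k : ℕ) (k≡ : + k ≡ + 2 * + suc b) where

    open Positive 9 b g eq

    private
      module X = Q b₀′ g₀ eq₀
      module Y = Q b₁′ g₁ eq₁

      G₁-cov : Cov (λ _ → 1ℤ) (λ n → + k + Y.thetaExp n)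
      G₁-cov = cov-shift k Y.Θ-cov

      even-exp : ∀ s t → X.thetaExp s + Q₁₀.thetaExp t ≡ thetaExp (s + t) + thetaExp (s - t)
      even-exp s t = trans (cong (λ z → + 20 * (s * (s - 1ℤ)) + + 2 * (z * s) + Q₁₀.thetaExp t) β₀) (lemma (+ suc b) s t)
        where
        lemma : ∀ β s t → + 20 * (s * (s - 1ℤ)) + + 2 * (+ 2 * β * s) + (+ 20 * (t * (t - 1ℤ)) + + 2 * (+ 10 * t)) ≡
          + 10 * ((s + t) * (s + t - 1ℤ)) + + 2 * (β * (s + t)) + (+ 10 * ((s - t) * (s - t - 1ℤ)) + + 2 * (β * (s - t)))
        lemma = solve-∀

      odd-exp : ∀ s t → + k + Y.thetaExp s + Q₂₀.thetaExp t ≡ thetaExp (s + t + 1ℤ) + thetaExp (s - t)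
      odd-exp s t = trans (cong₂ (λ y z → y + (+ 20 * (s * (s - 1ℤ)) + + 2 * (z * s)) + Q₂₀.thetaExp t) k≡ β₁) (lemma (+ suc b) s t)
        where
        lemma : ∀ β s t → + 2 * β + (+ 20 * (s * (s - 1ℤ)) + + 2 * ((+ 10 + + 2 * β) * s)) + (+ 20 * (t * (t - 1ℤ)) + + 2 * (+ 20 * t)) ≡
          + 10 * ((s + t + 1ℤ) * (s + t + 1ℤ - 1ℤ)) + + 2 * (β * (s + t + 1ℤ)) + (+ 10 * ((s - t) * (s - t - 1ℤ)) + + 2 * (β * (s - t)))
        lemma = solve-∀

    G₀ G₁ : Series
    G₀ = X.Θ
    G₁ = mono k ⊛ Y.Θ

    private
      G₁≈ : gf G₁-cov ≈ G₁
      G₁≈ = gf-shift k Y.Θ-cov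

      rotate : (f : ℤ → ℤ) (c : Cov (λ (n , n′) → par n * par n′ * f (n - n′)) (λ (n , n′) → thetaExp n + thetaExp n′))
               (e : Cov (λ t → f (t + t)) Q₁₀.thetaExp) (o : Cov (λ t → f (t + t + 1ℤ)) Q₂₀.thetaExp) →
               gf c ⊞ G₁ ⊛ gf o ≈ G₀ ⊛ gf e
      rotate f c e o N = begin
        gf c N + (G₁ ⊛ gf o) N
          ≡⟨ cong (_+ (G₁ ⊛ gf o) N) (parity-split c (cov-⊗ X.Θ-cov e) o′ even-weight even-exp odd-weight odd-exp N) ⟩
        gf (cov-⊗ X.Θ-cov e) N + gf o′ N + (G₁ ⊛ gf o) N
          ≡⟨ cong₂ (λ x y → x + y + (G₁ ⊛ gf o) N) (gf-⊗ X.Θ-cov e N)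
               (trans (gf-neg (cov-⊗ G₁-cov o) o′ N) (cong -_ (trans (gf-⊗ G₁-cov o N) (⊛-cong {g = gf o} G₁≈ (λ _ → refl) N)))) ⟩
        (G₀ ⊛ gf e) N + - (G₁ ⊛ gf o) N + (G₁ ⊛ gf o) N ≡⟨ cancel ((G₀ ⊛ gf e) N) ((G₁ ⊛ gf o) N) ⟩
        (G₀ ⊛ gf e) N ∎
        where
        open ≡-Reasoning
        cancel : ∀ x y → x + - y + y ≡ x
        cancel = solve-∀
        o′ : Cov (λ (s , t) → - (1ℤ * f (t + t + 1ℤ))) (λ (s , t) → + k + Y.thetaExp s + Q₂₀.thetaExp t)
        o′ = cov-sub (cov-⊗ G₁-cov o) (λ i z → cong -_ z)
        even-weight : ∀ s t → 1ℤ * f (t + t) ≡ par (s + t) * par (s - t) * f (s + t - (s - t))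
        even-weight s t = sym (cong₂ _*_ (par-rotate s t) (cong f (lemma s t)))
          where
          lemma : ∀ s t → s + t - (s - t) ≡ t + t
          lemma = solve-∀
        odd-weight : ∀ s t → - (1ℤ * f (t + t + 1ℤ)) ≡ par (s + t + 1ℤ) * par (s - t) * f (s + t + 1ℤ - (s - t))
        odd-weight s t = sym (trans (cong₂ _*_ (par-rotate′ s t) (cong f (lemma s t))) (lemma₂ (f (t + t + 1ℤ))))
          where
          lemma : ∀ s t → s + t + 1ℤ - (s - t) ≡ t + t + 1ℤ
          lemma = solve-∀
          lemma₂ : ∀ x → -1ℤ * x ≡ - (1ℤ * x)
          lemma₂ = solve-∀

      JJ-cov : Cov (λ (n , n′) → par n * par n′ * 1ℤ) (λ (n , n′) → thetaExp n + thetaExp n′)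
      JJ-cov = cov-cong (cov-⊗ J-cov J-cov) (λ (n , n′) → sym (ℤP.*-identityʳ (par n * par n′)))

      base : Cov (λ (n , n′) → 1ℤ * 1ℤ) (λ (n , n′) → thetaExp n + thetaExp n′)
      base = cov-⊗ Θ-cov Θ-cov

      W-cov : Cov (λ (n , n′) → par n * par n′ * ((n - n′) * (n - n′))) (λ (n , n′) → thetaExp n + thetaExp n′)
      W-cov = cov-sub base (λ _ ())

    J² : J ⊛ J ⊞ G₁ ⊛ b₁ ≈ G₀ ⊛ b₀
    J² N = trans (cong (_+ (G₁ ⊛ b₁) N) (trans (sym (gf-⊗ J-cov J-cov N))
        (gf-cong (cov-⊗ J-cov J-cov) JJ-cov (λ (n , n′) → sym (ℤP.*-identityʳ (par n * par n′))) (λ _ → refl) N)))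
      (rotate (λ _ → 1ℤ) JJ-cov Q₁₀.Θ-cov Q₂₀.Θ-cov N)

    private
      W≈ : gf W-cov ⊞ G₁ ⊛ B₁ ≈ G₀ ⊛ B₀
      W≈ N = trans (rotate (λ v → v * v) W-cov e B₁-cov N) (⊛-cong {G₀} (λ _ → refl) (gf-cong e B₀-cov square (λ _ → refl)) N)
        where
        square : ∀ t → (t + t) * (t + t) ≡ + 4 * (t * t)
        square = solve-∀
        e : Cov (λ t → (t + t) * (t + t)) Q₁₀.thetaExp
        e = Q₁₀.cov-theta

      -- Expanding (n - n′)² makes the series of `W-cov` equal to 2(J · `Jzz` - `Jz`²), which by
      -- `J-℘` is -2 J² times the value of ℘.
      W-expand : ∀ N → gf W-cov N + + 2 * (Jz ⊛ Jz) N ≡ + 2 * (J ⊛ Jzz) N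
      W-expand N = begin
        gf W-cov N + + 2 * (Jz ⊛ Jz) N ≡⟨ +-congʳ (gf W-cov N) (sym (trans (gf-scale (+ 2) (cov-⊗ Jz-cov Jz-cov) Z-cov (λ _ → refl) N) (cong (+ 2 *_) (gf-⊗ Jz-cov Jz-cov N)))) ⟩
        gf W-cov N + gf Z-cov N ≡⟨ sym (gf-sum base W-cov Z-cov U-cov (λ _ ()) (λ _ ()) (λ _ → refl) N) ⟩
        gf U-cov N ≡⟨ gf-sum base (cov-⊗ J-cov Jzz-cov) (cov-⊗ Jzz-cov J-cov) U-cov (λ _ ()) (λ _ ()) (λ (n , n′) → expand (par n) (par n′) n n′) N ⟩
        gf (cov-⊗ J-cov Jzz-cov) N + gf (cov-⊗ Jzz-cov J-cov) N ≡⟨ cong₂ _+_ (gf-⊗ J-cov Jzz-cov N) (trans (gf-⊗ Jzz-cov J-cov N) (⊛-comm Jzz J N)) ⟩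
        (J ⊛ Jzz) N + (J ⊛ Jzz) N ≡⟨ double ((J ⊛ Jzz) N) ⟩
        + 2 * (J ⊛ Jzz) N ∎
        where
        open ≡-Reasoning
        double : ∀ x → x + x ≡ + 2 * x
        double = solve-∀
        Z-cov : Cov (λ (n , n′) → + 2 * (par n * n * (par n′ * n′))) (λ (n , n′) → thetaExp n + thetaExp n′)
        Z-cov = cov-sub base (λ _ ())
        U-cov : Cov (λ (n , n′) → par n * par n′ * ((n - n′) * (n - n′)) + + 2 * (par n * n * (par n′ * n′))) (λ (n , n′) → thetaExp n + thetaExp n′)
        U-cov = cov-sub base (λ _ ())
        expand : ∀ p p′ n n′ → p * p′ * ((n - n′) * (n - n′)) + + 2 * (p * n * (p′ * n′)) ≡ p * (p′ * n′ * n′) + p * n * n * p′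
        expand = solve-∀

    J²S : ∀ N → + 2 * (J ⊛ J ⊛ (S 9 b ⊞ S 9 g)) N + (G₀ ⊛ B₀) N ≡ (G₁ ⊛ B₁) N
    J²S N = combine ((J ⊛ J ⊛ (S 9 b ⊞ S 9 g)) N) ((J ⊛ Jzz) N) ((Jz ⊛ Jz) N) (gf W-cov N) ((G₀ ⊛ B₀) N) ((G₁ ⊛ B₁) N)
        (J-℘ N) (W-expand N) (W≈ N)
      where
      combine : ∀ x y z w g h → x + y ≡ z → w + + 2 * z ≡ + 2 * y → w + h ≡ g → + 2 * x + g ≡ h
      combine x y _ w _ h refl e refl = trans (lemma₁ x y w h) (trans (cong (λ v → v + h - + 2 * y) e) (lemma₂ y h))
        where
        lemma₁ : ∀ x y w h → + 2 * x + (w + h) ≡ w + + 2 * (x + y) + h - + 2 * y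
        lemma₁ = solve-∀
        lemma₂ : ∀ y h → + 2 * y + h - + 2 * y ≡ h
        lemma₂ = solve-∀

  -- Modulus 10, with β = 1, 2, 3, 4. The points are β = 1 and 3; the product formula also involves
  -- their sum 4 and difference 2.
  module J₁ = Positive 9 0 8 refl
  module J₂ = Positive 9 1 7 refl
  module J₃ = Positive 9 2 6 refl
  module J₄ = Positive 9 3 5 refl
  module η = Eta 9
  module Ra = Rotation 0 8 2 18 12 8 refl refl refl refl refl 2 refl
  module Rb = Rotation 2 6 6 14 16 4 refl refl refl refl refl 6 refl

  -- As 2 + 4 = 2 · 3 and 4 - 2 = 2 · 1, rotating the product of `J₂.J` and `J₄.J` produces, after n
  -- ↦ -n in two of them, the four series that occur in the squares of `J₁.J` and `J₃.J`. It is a 2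
  -- × 2 determinant in these.
  J₂J₄ : mono 2 ⊛ (J₂.J ⊛ J₄.J) ⊞ Rb.G₁ ⊛ Ra.G₀ ≈ Rb.G₀ ⊛ Ra.G₁
  J₂J₄ N = begin
    (mono 2 ⊛ (J₂.J ⊛ J₄.J)) N + (Rb.G₁ ⊛ Ra.G₀) N
      ≡⟨ cong (_+ (Rb.G₁ ⊛ Ra.G₀) N) (⊛-cong {mono 2} (λ _ → refl) product N) ⟩
    (mono 2 ⊛ (Q₆.Θ ⊛ Q₁₂.Θ ⊞ ⊟ (mono 4 ⊛ (Q₁₆.Θ ⊛ Q₂.Θ)))) N + (Rb.G₁ ⊛ Ra.G₀) N
      ≡⟨ cong (_+ (Rb.G₁ ⊛ Ra.G₀) N) (trans (⊛-distribˡ (mono 2) (Q₆.Θ ⊛ Q₁₂.Θ) (⊟ (mono 4 ⊛ (Q₁₆.Θ ⊛ Q₂.Θ))) N)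
           (cong₂ _+_ (swap (mono 2) Q₆.Θ Q₁₂.Θ N) (trans (⊛-⊟ (mono 2) (mono 4 ⊛ (Q₁₆.Θ ⊛ Q₂.Θ)) N) (cong -_ shift6)))) ⟩
    (Rb.G₀ ⊛ Ra.G₁) N + - (Rb.G₁ ⊛ Ra.G₀) N + (Rb.G₁ ⊛ Ra.G₀) N ≡⟨ cancel ((Rb.G₀ ⊛ Ra.G₁) N) ((Rb.G₁ ⊛ Ra.G₀) N) ⟩
    (Rb.G₀ ⊛ Ra.G₁) N ∎
    where
    open ≡-Reasoning
    cancel : ∀ x y → x + - y + y ≡ x
    cancel = solve-∀
    swap : ∀ x y z → x ⊛ (y ⊛ z) ≈ y ⊛ (x ⊛ z)
    swap = solve 3 (λ x y z → x :* (y :* z) := y :* (x :* z)) ≈-refl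
    reassoc : ∀ x y z w → x ⊛ (y ⊛ (z ⊛ w)) ≈ x ⊛ y ⊛ z ⊛ w
    reassoc = solve 4 (λ x y z w → x :* (y :* (z :* w)) := x :* y :* z :* w) ≈-refl
    shift6 : (mono 2 ⊛ (mono 4 ⊛ (Q₁₆.Θ ⊛ Q₂.Θ))) N ≡ (Rb.G₁ ⊛ Ra.G₀) N
    shift6 = trans (reassoc (mono 2) (mono 4) Q₁₆.Θ Q₂.Θ N)
      (⊛-cong {g = Q₂.Θ} (⊛-cong {g = Q₁₆.Θ} (mono-⊛ 2 4) (λ _ → refl)) (λ _ → refl) N)
    e : Cov (λ (s , t) → 1ℤ * 1ℤ) (λ (s , t) → Q₆.thetaExp s + Q₈.thetaExp t)
    e = cov-⊗ Q₆.Θ-cov Q₈.Θ-cov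
    o : Cov (λ (s , t) → 1ℤ * 1ℤ) (λ (s , t) → + 4 + Q₁₆.thetaExp s + Q₁₈.thetaExp t)
    o = cov-⊗ (cov-shift 4 Q₁₆.Θ-cov) Q₁₈.Θ-cov
    o′ : Cov (λ (s , t) → -1ℤ) (λ (s , t) → + 4 + Q₁₆.thetaExp s + Q₁₈.thetaExp t)
    o′ = cov-sub o (λ _ ())
    even-exp : ∀ s t → Q₆.thetaExp s + Q₈.thetaExp t ≡ J₂.thetaExp (s + t) + J₄.thetaExp (s - t)
    even-exp = lemma
      where
      lemma : ∀ s t → + 20 * (s * (s - 1ℤ)) + + 2 * (+ 6 * s) + (+ 20 * (t * (t - 1ℤ)) + + 2 * (+ 8 * t)) ≡
        + 10 * ((s + t) * (s + t - 1ℤ)) + + 2 * (+ 2 * (s + t)) + (+ 10 * ((s - t) * (s - t - 1ℤ)) + + 2 * (+ 4 * (s - t)))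
      lemma = solve-∀
    odd-exp : ∀ s t → + 4 + Q₁₆.thetaExp s + Q₁₈.thetaExp t ≡ J₂.thetaExp (s + t + 1ℤ) + J₄.thetaExp (s - t)
    odd-exp = lemma
      where
      lemma : ∀ s t → + 4 + (+ 20 * (s * (s - 1ℤ)) + + 2 * (+ 16 * s)) + (+ 20 * (t * (t - 1ℤ)) + + 2 * (+ 18 * t)) ≡
        + 10 * ((s + t + 1ℤ) * (s + t + 1ℤ - 1ℤ)) + + 2 * (+ 2 * (s + t + 1ℤ)) + (+ 10 * ((s - t) * (s - t - 1ℤ)) + + 2 * (+ 4 * (s - t)))
      lemma = solve-∀
    reflect₈ : Q₈.Θ ≈ Q₁₂.Θ
    reflect₈ = gf-match Q₈.Θ-cov (neg-match (λ _ → refl) lemma) Q₁₂.Θ-cov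
      where
      lemma : ∀ n → + 20 * (- n * (- n - 1ℤ)) + + 2 * (+ 12 * - n) ≡ + 20 * (n * (n - 1ℤ)) + + 2 * (+ 8 * n)
      lemma = solve-∀
    reflect₁₈ : Q₁₈.Θ ≈ Q₂.Θ
    reflect₁₈ = gf-match Q₁₈.Θ-cov (neg-match (λ _ → refl) lemma) Q₂.Θ-cov
      where
      lemma : ∀ n → + 20 * (- n * (- n - 1ℤ)) + + 2 * (+ 2 * - n) ≡ + 20 * (n * (n - 1ℤ)) + + 2 * (+ 18 * n)
      lemma = solve-∀
    product : J₂.J ⊛ J₄.J ≈ Q₆.Θ ⊛ Q₁₂.Θ ⊞ ⊟ (mono 4 ⊛ (Q₁₆.Θ ⊛ Q₂.Θ))
    product M = trans (sym (gf-⊗ J₂.J-cov J₄.J-cov M))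
      (trans (parity-split (cov-⊗ J₂.J-cov J₄.J-cov) e o′ (λ s t → sym (par-rotate s t)) even-exp (λ s t → sym (par-rotate′ s t)) odd-exp M)
        (cong₂ _+_ (trans (gf-⊗ Q₆.Θ-cov Q₈.Θ-cov M) (⊛-cong {Q₆.Θ} (λ _ → refl) reflect₈ M))
          (trans (gf-neg o o′ M) (cong -_ (trans (gf-⊗ (cov-shift 4 Q₁₆.Θ-cov) Q₁₈.Θ-cov M)
            (trans (⊛-cong (gf-shift 4 Q₁₆.Θ-cov) reflect₁₈ M) (⊛-assoc (mono 4) Q₁₆.Θ Q₂.Θ M)))))))

  -- Jacobi's derivative formula, in the form of a Wronskian.
  T² : ∀ N → + 2 * (η.T ⊛ η.T) N + (B₀ ⊛ b₁) N ≡ (B₁ ⊛ b₀) N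
  T² N = combine ((η.T ⊛ η.T) N) ((Q₂₀.K ⊛ b₀) N) ((b₁ ⊛ Q₁₀.K) N) ((b₀ ⊛ Q₂₀.M) N) ((b₁ ⊛ b₀) N) ((B₀ ⊛ b₁) N) ((B₁ ⊛ b₀) N)
      (trans (sym (gf-⊗ η.T-cov η.T-cov N)) (trans (parity-split (cov-⊗ η.T-cov η.T-cov) e o even-weight even-exp odd-weight odd-exp N) (cong₂ _+_ even-part odd-part)))
      4K₀ 4K₁ 2M
    where
    combine : ∀ t x y m b u v → t ≡ x + - y + (- y + x + m) → u ≡ + 4 * y → v ≡ + 4 * x + + 4 * m + b → + 2 * m ≡ - b → + 2 * t + u ≡ v
    combine _ x y m b _ _ refl refl refl e = trans (lemma₁ x y m) (trans (+-congʳ (+ 4 * x) (trans e (lemma₂ b))) (trans (+-congʳ (+ 4 * x) (cong (λ z → + 2 * z + b) (sym e))) (lemma₃ x m b)))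
      where
      lemma₁ : ∀ x y m → + 2 * (x + - y + (- y + x + m)) + + 4 * y ≡ + 4 * x + + 2 * m
      lemma₁ = solve-∀
      lemma₂ : ∀ b → - b ≡ + 2 * - b + b
      lemma₂ = solve-∀
      lemma₃ : ∀ x m b → + 4 * x + (+ 2 * (+ 2 * m) + b) ≡ + 4 * x + + 4 * m + b
      lemma₃ = solve-∀
    even-base : Cov (λ (s , t) → 1ℤ * 1ℤ) (λ (s , t) → Q₀.thetaExp s + Q₁₀.thetaExp t)
    even-base = cov-⊗ Q₀.Θ-cov Q₁₀.Θ-cov
    odd-base : Cov (λ (s , t) → 1ℤ * 1ℤ) (λ (s , t) → Q₁₀.thetaExp s + Q₂₀.thetaExp t)
    odd-base = cov-⊗ Q₁₀.Θ-cov Q₂₀.Θ-cov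
    e : Cov (λ (s , t) → (s + t) * (s - t)) (λ (s , t) → Q₀.thetaExp s + Q₁₀.thetaExp t)
    e = cov-sub even-base (λ _ ())
    o : Cov (λ (s , t) → - ((s + t + 1ℤ) * (s - t))) (λ (s , t) → Q₁₀.thetaExp s + Q₂₀.thetaExp t)
    o = cov-sub odd-base (λ _ ())
    even-weight : ∀ s t → (s + t) * (s - t) ≡ par (s + t) * (s + t) * (par (s - t) * (s - t))
    even-weight s t = sym (trans (lemma (par (s + t)) (s + t) (par (s - t)) (s - t)) (trans (cong (_* ((s + t) * (s - t))) (par-rotate s t)) (ℤP.*-identityˡ _)))
      where
      lemma : ∀ p x q y → p * x * (q * y) ≡ p * q * (x * y)
      lemma = solve-∀
    odd-weight : ∀ s t → - ((s + t + 1ℤ) * (s - t)) ≡ par (s + t + 1ℤ) * (s + t + 1ℤ) * (par (s - t) * (s - t))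
    odd-weight s t = sym (trans (lemma (par (s + t + 1ℤ)) (s + t + 1ℤ) (par (s - t)) (s - t)) (trans (cong (_* ((s + t + 1ℤ) * (s - t))) (par-rotate′ s t)) (ℤP.-1*i≡-i _)))
      where
      lemma : ∀ p x q y → p * x * (q * y) ≡ p * q * (x * y)
      lemma = solve-∀
    even-exp : ∀ s t → Q₀.thetaExp s + Q₁₀.thetaExp t ≡ η.thetaExp (s + t) + η.thetaExp (s - t)
    even-exp = lemma
      where
      lemma : ∀ s t → + 20 * (s * (s - 1ℤ)) + + 2 * (+ 0 * s) + (+ 20 * (t * (t - 1ℤ)) + + 2 * (+ 10 * t)) ≡
        + 10 * ((s + t) * (s + t - 1ℤ)) + + 2 * (+ 0 * (s + t)) + (+ 10 * ((s - t) * (s - t - 1ℤ)) + + 2 * (+ 0 * (s - t)))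
      lemma = solve-∀
    odd-exp : ∀ s t → Q₁₀.thetaExp s + Q₂₀.thetaExp t ≡ η.thetaExp (s + t + 1ℤ) + η.thetaExp (s - t)
    odd-exp = lemma
      where
      lemma : ∀ s t → + 20 * (s * (s - 1ℤ)) + + 2 * (+ 10 * s) + (+ 20 * (t * (t - 1ℤ)) + + 2 * (+ 20 * t)) ≡
        + 10 * ((s + t + 1ℤ) * (s + t + 1ℤ - 1ℤ)) + + 2 * (+ 0 * (s + t + 1ℤ)) + (+ 10 * ((s - t) * (s - t - 1ℤ)) + + 2 * (+ 0 * (s - t)))
      lemma = solve-∀
    reflect-exp : ∀ n → Q₂₀.thetaExp (- n) ≡ Q₀.thetaExp n
    reflect-exp = lemma
      where
      lemma : ∀ n → + 20 * (- n * (- n - 1ℤ)) + + 2 * (+ 20 * - n) ≡ + 20 * (n * (n - 1ℤ)) + + 2 * (+ 0 * n)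
      lemma = solve-∀
    neg-square : ∀ n → - n * - n ≡ n * n
    neg-square = solve-∀
    reflect-Θ : Q₀.Θ ≈ b₁
    reflect-Θ = gf-match Q₀.Θ-cov (neg-match (λ _ → refl) reflect-exp) Q₂₀.Θ-cov
    reflect-K : Q₀.K ≈ Q₂₀.K
    reflect-K = gf-match Q₀.K-cov (neg-match neg-square reflect-exp) Q₂₀.K-cov
    even-part : gf e N ≡ (Q₂₀.K ⊛ b₀) N + - (b₁ ⊛ Q₁₀.K) N
    even-part = trans (gf-sum even-base (cov-⊗ Q₀.K-cov Q₁₀.Θ-cov) neg e (λ _ ()) (λ _ ()) (λ (s , t) → lemma s t) N)
      (cong₂ _+_ (trans (gf-⊗ Q₀.K-cov Q₁₀.Θ-cov N) (⊛-cong {g = b₀} reflect-K (λ _ → refl) N))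
        (trans (gf-neg (cov-⊗ Q₀.Θ-cov Q₁₀.K-cov) neg N) (cong -_ (trans (gf-⊗ Q₀.Θ-cov Q₁₀.K-cov N) (⊛-cong {g = Q₁₀.K} reflect-Θ (λ _ → refl) N)))))
      where
      lemma : ∀ s t → (s + t) * (s - t) ≡ s * s * 1ℤ + - (1ℤ * (t * t))
      lemma = solve-∀
      neg : Cov (λ (s , t) → - (1ℤ * (t * t))) (λ (s , t) → Q₀.thetaExp s + Q₁₀.thetaExp t)
      neg = cov-sub even-base (λ _ ())
    M₁₀≈0 : Q₁₀.M ≈ 𝟎
    M₁₀≈0 = involution-zero Q₁₀.M-cov (neg-match ℤP.neg-involutive lemma)
      where
      lemma : ∀ n → + 20 * (- n * (- n - 1ℤ)) + + 2 * (+ 10 * - n) ≡ + 20 * (n * (n - 1ℤ)) + + 2 * (+ 10 * n)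
      lemma = solve-∀
    odd-part : gf o N ≡ - (b₁ ⊛ Q₁₀.K) N + (Q₂₀.K ⊛ b₀) N + (b₀ ⊛ Q₂₀.M) N
    odd-part = begin
      gf o N ≡⟨ gf-sum odd-base o₁ o₂ o (λ _ ()) (λ _ ()) (λ (s , t) → lemma s t) N ⟩
      gf o₁ N + gf o₂ N ≡⟨ cong₂ _+_ (gf-sum odd-base o₁₁ (cov-⊗ Q₁₀.Θ-cov Q₂₀.K-cov) o₁ (λ _ ()) (λ _ ()) (λ _ → refl) N)
                                    (gf-sum odd-base o₂₁ (cov-⊗ Q₁₀.Θ-cov Q₂₀.M-cov) o₂ (λ _ ()) (λ _ ()) (λ _ → refl) N) ⟩
      gf o₁₁ N + gf (cov-⊗ Q₁₀.Θ-cov Q₂₀.K-cov) N + (gf o₂₁ N + gf (cov-⊗ Q₁₀.Θ-cov Q₂₀.M-cov) N)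
        ≡⟨ cong₂ _+_
             (cong₂ _+_ (trans (gf-neg (cov-⊗ Q₁₀.K-cov Q₂₀.Θ-cov) o₁₁ N) (cong -_ (trans (gf-⊗ Q₁₀.K-cov Q₂₀.Θ-cov N) (⊛-comm Q₁₀.K b₁ N))))
                        (trans (gf-⊗ Q₁₀.Θ-cov Q₂₀.K-cov N) (⊛-comm b₀ Q₂₀.K N)))
             (cong₂ _+_ (trans (gf-neg (cov-⊗ Q₁₀.M-cov Q₂₀.Θ-cov) o₂₁ N) (cong -_ (trans (gf-⊗ Q₁₀.M-cov Q₂₀.Θ-cov N)
                          (trans (⊛-cong {g = b₁} M₁₀≈0 (λ _ → refl) N) (⊛-zeroˡ b₁ N)))))
                        (gf-⊗ Q₁₀.Θ-cov Q₂₀.M-cov N)) ⟩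
      - (b₁ ⊛ Q₁₀.K) N + (Q₂₀.K ⊛ b₀) N + (0ℤ + (b₀ ⊛ Q₂₀.M) N) ≡⟨ +-congʳ (- (b₁ ⊛ Q₁₀.K) N + (Q₂₀.K ⊛ b₀) N) (ℤP.+-identityˡ ((b₀ ⊛ Q₂₀.M) N)) ⟩
      - (b₁ ⊛ Q₁₀.K) N + (Q₂₀.K ⊛ b₀) N + (b₀ ⊛ Q₂₀.M) N ∎
      where
      open ≡-Reasoning
      X : ℤ × ℤ → ℤ
      X (s , t) = Q₁₀.thetaExp s + Q₂₀.thetaExp t
      o₁ : Cov (λ (s , t) → - (s * s * 1ℤ) + 1ℤ * (t * t)) X
      o₁ = cov-sub odd-base (λ _ ())
      o₂ : Cov (λ (s , t) → - (s * 1ℤ) + 1ℤ * t) X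
      o₂ = cov-sub odd-base (λ _ ())
      o₁₁ : Cov (λ (s , t) → - (s * s * 1ℤ)) X
      o₁₁ = cov-sub odd-base (λ _ ())
      o₂₁ : Cov (λ (s , t) → - (s * 1ℤ)) X
      o₂₁ = cov-sub odd-base (λ _ ())
      lemma : ∀ s t → - ((s + t + 1ℤ) * (s - t)) ≡ - (s * s * 1ℤ) + 1ℤ * (t * t) + (- (s * 1ℤ) + 1ℤ * t)
      lemma = solve-∀
    4K₀ : (B₀ ⊛ b₁) N ≡ + 4 * (b₁ ⊛ Q₁₀.K) N
    4K₀ = trans (⊛-cong {g = b₁} (gf-scale (+ 4) Q₁₀.K-cov B₀-cov (λ _ → refl)) (λ _ → refl) N)
      (trans (⊛-scaleˡ (+ 4) Q₁₀.K b₁ N) (cong (+ 4 *_) (⊛-comm Q₁₀.K b₁ N)))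
    4K₁ : (B₁ ⊛ b₀) N ≡ + 4 * (Q₂₀.K ⊛ b₀) N + + 4 * (b₀ ⊛ Q₂₀.M) N + (b₁ ⊛ b₀) N
    4K₁ = trans (⊛-cong {g = b₀} expand (λ _ → refl) N) (trans (⊛-distribʳ b₀ (+ 4 · Q₂₀.K ⊞ + 4 · Q₂₀.M) b₁ N)
        (cong (_+ (b₁ ⊛ b₀) N) (trans (⊛-distribʳ b₀ (+ 4 · Q₂₀.K) (+ 4 · Q₂₀.M) N)
          (cong₂ _+_ (⊛-scaleˡ (+ 4) Q₂₀.K b₀ N) (trans (⊛-scaleˡ (+ 4) Q₂₀.M b₀ N) (cong (+ 4 *_) (⊛-comm Q₂₀.M b₀ N)))))))
      where
      expand : B₁ ≈ + 4 · Q₂₀.K ⊞ + 4 · Q₂₀.M ⊞ b₁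
      expand M = trans (gf-sum Q₂₀.Θ-cov c₁ Q₂₀.Θ-cov B₁-cov (λ _ ()) (λ _ ()) lemma M)
          (cong (_+ b₁ M) (trans (gf-sum Q₂₀.Θ-cov c₂ c₃ c₁ (λ _ ()) (λ _ ()) (λ _ → refl) M)
            (cong₂ _+_ (gf-scale (+ 4) Q₂₀.K-cov c₂ (λ _ → refl) M) (gf-scale (+ 4) Q₂₀.M-cov c₃ (λ _ → refl) M))))
        where
        lemma : ∀ t → (t + t + 1ℤ) * (t + t + 1ℤ) ≡ + 4 * (t * t) + + 4 * t + 1ℤ
        lemma = solve-∀
        c₁ : Cov (λ t → + 4 * (t * t) + + 4 * t) Q₂₀.thetaExp
        c₁ = Q₂₀.cov-theta
        c₂ : Cov (λ t → + 4 * (t * t)) Q₂₀.thetaExp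
        c₂ = Q₂₀.cov-theta
        c₃ : Cov (λ t → + 4 * t) Q₂₀.thetaExp
        c₃ = Q₂₀.cov-theta
    -- n ↦ -1 - n preserves the exponents of `Q₂₀`, so the weight n may be replaced by its average
    -- -1/2.
    2M : + 2 * (b₀ ⊛ Q₂₀.M) N ≡ - (b₁ ⊛ b₀) N
    2M = trans (sym (trans (⊛-scaleˡ (+ 2) Q₂₀.M b₀ N) (cong (+ 2 *_) (⊛-comm Q₂₀.M b₀ N))))
        (trans (⊛-cong {g = b₀} half (λ _ → refl) N) (⊛-⊟ˡ b₁ b₀ N))
      where
      neg : Cov (λ n → - 1ℤ) Q₂₀.thetaExp
      neg = Q₂₀.cov-theta
      negM : Cov (λ n → - n) Q₂₀.thetaExp
      negM = Q₂₀.cov-theta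
      c : Cov (λ n → -1ℤ + - n) Q₂₀.thetaExp
      c = Q₂₀.cov-theta
      invol : ∀ n → -1ℤ + - (-1ℤ + - n) ≡ n
      invol = solve-∀
      exp-ok : ∀ n → + 20 * ((-1ℤ + - n) * (-1ℤ + - n - 1ℤ)) + + 2 * (+ 20 * (-1ℤ + - n)) ≡ + 20 * (n * (n - 1ℤ)) + + 2 * (+ 20 * n)
      exp-ok = solve-∀
      half : + 2 · Q₂₀.M ≈ ⊟ b₁
      half M = solve-for (Q₂₀.M M) (b₁ M) (trans (gf-match Q₂₀.M-cov (bijection-match (λ n → -1ℤ + - n) (λ n → -1ℤ + - n) invol exp-ok invol invol) c M)
          (trans (gf-sum Q₂₀.Θ-cov neg negM c (λ _ ()) (λ _ ()) (λ _ → refl) M) (cong₂ _+_ (gf-neg Q₂₀.Θ-cov neg M) (gf-neg Q₂₀.M-cov negM M))))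
        where
        solve-for : ∀ x y → x ≡ - y + - x → + 2 * x ≡ - y
        solve-for x y e = trans (lemma₁ x) (trans (cong (_+ x) e) (lemma₂ x y))
          where
          lemma₁ : ∀ x → + 2 * x ≡ x + x
          lemma₁ = solve-∀
          lemma₂ : ∀ x y → - y + - x + x ≡ - y
          lemma₂ = solve-∀

  -- (v - u)(y - x), without subtraction.
  difference-product : ∀ {p u v j x y} → p ⊞ u ≈ v → j ⊞ x ≈ y → p ⊛ j ⊞ (u ⊛ y ⊞ v ⊛ x) ≈ v ⊛ y ⊞ u ⊛ x
  difference-product {p} {u} {v} {j} {x} {y} e f = begin
    p ⊛ j ⊞ (u ⊛ y ⊞ v ⊛ x)                       ≈⟨ ⊞-cong (≈-refl {p ⊛ j}) (⊞-cong (⊛-cong {u} ≈-refl (≈-sym f)) (⊛-cong {g = x} (≈-sym e) ≈-refl)) ⟩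
    p ⊛ j ⊞ (u ⊛ (j ⊞ x) ⊞ (p ⊞ u) ⊛ x)           ≈⟨ lemma p u j x ⟩
    (p ⊞ u) ⊛ (j ⊞ x) ⊞ u ⊛ x                     ≈⟨ ⊞-cong (⊛-cong e f) (≈-refl {u ⊛ x}) ⟩
    v ⊛ y ⊞ u ⊛ x                                 ∎
    where
    open ≈-Reasoning
    lemma : ∀ p u j x → p ⊛ j ⊞ (u ⊛ (j ⊞ x) ⊞ (p ⊞ u) ⊛ x) ≈ (p ⊞ u) ⊛ (j ⊞ x) ⊞ u ⊛ x
    lemma = solve 4 (λ p u j x → p :* j :+ (u :* (j :+ x) :+ (p :+ u) :* x) := (p :+ u) :* (j :+ x) :+ u :* x) ≈-refl

  Sa Sb Ja² Jb² : Series
  Sa = S 9 0 ⊞ S 9 8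
  Sb = S 9 2 ⊞ S 9 6
  Ja² = J₁.J ⊛ J₁.J
  Jb² = J₃.J ⊛ J₃.J

  -- The product formula for the difference of two values of the Weierstrass function.
  ℘-difference : ∀ N → (Ja² ⊛ Sa ⊛ Jb²) N ≡ (Jb² ⊛ Sb ⊛ Ja²) N + (mono 2 ⊛ (J₂.J ⊛ J₄.J) ⊛ (η.T ⊛ η.T)) N
  ℘-difference N = halve (X N) (Y N) (Z N) (combine (+ 2 * X N) (+ 2 * Y N) (+ 2 * Z N) (c N) (a N) (a′ N) (e₁ N) (e₂ N) (e₃ N))
    where
    open ≡-Reasoning
    X Y Z : Series
    X = Ja² ⊛ Sa ⊛ Jb²
    Y = Jb² ⊛ Sb ⊛ Ja²
    Z = mono 2 ⊛ (J₂.J ⊛ J₄.J) ⊛ (η.T ⊛ η.T)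
    c a a′ : Series
    -- The part common to both cross products. It cancels in the difference, and `a` - `a′` is the
    -- product of the two determinants computed in `J₂J₄` and `T²`.
    c = (Ra.G₀ ⊛ B₀) ⊛ (Rb.G₀ ⊛ b₀) ⊞ (Ra.G₁ ⊛ B₁) ⊛ (Rb.G₁ ⊛ b₁)
    a = (Ra.G₁ ⊛ B₁) ⊛ (Rb.G₀ ⊛ b₀) ⊞ (Ra.G₀ ⊛ B₀) ⊛ (Rb.G₁ ⊛ b₁)
    a′ = (Rb.G₁ ⊛ B₁) ⊛ (Ra.G₀ ⊛ b₀) ⊞ (Rb.G₀ ⊛ B₀) ⊛ (Ra.G₁ ⊛ b₁)
    e₁ : ∀ N → + 2 * X N + c N ≡ a N
    e₁ N = trans (cong (_+ c N) (sym (⊛-scaleˡ (+ 2) (Ja² ⊛ Sa) Jb² N)))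
      (difference-product {+ 2 · (Ja² ⊛ Sa)} {Ra.G₀ ⊛ B₀} {Ra.G₁ ⊛ B₁} {Jb²} {Rb.G₁ ⊛ b₁} {Rb.G₀ ⊛ b₀} Ra.J²S Rb.J² N)
    rearrange : ∀ g h k l m n o p → (g ⊛ h) ⊛ (k ⊛ l) ⊞ (m ⊛ n) ⊛ (o ⊛ p) ≈ (k ⊛ h) ⊛ (g ⊛ l) ⊞ (o ⊛ n) ⊛ (m ⊛ p)
    rearrange = solve 8 (λ g h k l m n o p → (g :* h) :* (k :* l) :+ (m :* n) :* (o :* p) := (k :* h) :* (g :* l) :+ (o :* n) :* (m :* p)) ≈-refl
    e₂ : ∀ N → + 2 * Y N + c N ≡ a′ N
    e₂ N = trans (cong₂ _+_ (sym (⊛-scaleˡ (+ 2) (Jb² ⊛ Sb) Ja² N)) (rearrange Ra.G₀ B₀ Rb.G₀ b₀ Ra.G₁ B₁ Rb.G₁ b₁ N))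
      (difference-product {+ 2 · (Jb² ⊛ Sb)} {Rb.G₀ ⊛ B₀} {Rb.G₁ ⊛ B₁} {Ja²} {Ra.G₁ ⊛ b₁} {Ra.G₀ ⊛ b₀} Rb.J²S Ra.J² N)
    cross : ∀ x y u v b₀ b₁ B₀ B₁ → (y ⊛ x) ⊛ (B₁ ⊛ b₀) ⊞ (u ⊛ v) ⊛ (B₀ ⊛ b₁) ≈ (x ⊛ B₁) ⊛ (y ⊛ b₀) ⊞ (v ⊛ B₀) ⊛ (u ⊛ b₁)
    cross = solve 8 (λ x y u v b₀ b₁ B₀ B₁ → (y :* x) :* (B₁ :* b₀) :+ (u :* v) :* (B₀ :* b₁) := (x :* B₁) :* (y :* b₀) :+ (v :* B₀) :* (u :* b₁)) ≈-refl
    cross′ : ∀ x y u v b₀ b₁ B₀ B₁ → (u ⊛ v) ⊛ (B₁ ⊛ b₀) ⊞ (y ⊛ x) ⊛ (B₀ ⊛ b₁) ≈ (u ⊛ B₁) ⊛ (v ⊛ b₀) ⊞ (y ⊛ B₀) ⊛ (x ⊛ b₁)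
    cross′ = solve 8 (λ x y u v b₀ b₁ B₀ B₁ → (u :* v) :* (B₁ :* b₀) :+ (y :* x) :* (B₀ :* b₁) := (u :* B₁) :* (v :* b₀) :+ (y :* B₀) :* (x :* b₁)) ≈-refl
    e₃ : ∀ N → + 2 * Z N + a′ N ≡ a N
    e₃ N = trans (cong₂ _+_ scaled (sym (cross′ Ra.G₁ Rb.G₀ Rb.G₁ Ra.G₀ b₀ b₁ B₀ B₁ N)))
      (trans (difference-product {mono 2 ⊛ (J₂.J ⊛ J₄.J)} {Rb.G₁ ⊛ Ra.G₀} {Rb.G₀ ⊛ Ra.G₁} {+ 2 · (η.T ⊛ η.T)} {B₀ ⊛ b₁} {B₁ ⊛ b₀} J₂J₄ T² N)
        (cross Ra.G₁ Rb.G₀ Rb.G₁ Ra.G₀ b₀ b₁ B₀ B₁ N))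
      where
      scaled : + 2 * Z N ≡ (mono 2 ⊛ (J₂.J ⊛ J₄.J) ⊛ (+ 2 · (η.T ⊛ η.T))) N
      scaled = trans (cong (+ 2 *_) (⊛-comm (mono 2 ⊛ (J₂.J ⊛ J₄.J)) (η.T ⊛ η.T) N))
        (trans (sym (⊛-scaleˡ (+ 2) (η.T ⊛ η.T) (mono 2 ⊛ (J₂.J ⊛ J₄.J)) N)) (⊛-comm (+ 2 · (η.T ⊛ η.T)) (mono 2 ⊛ (J₂.J ⊛ J₄.J)) N))
    combine : ∀ x y z c a a′ → x + c ≡ a → y + c ≡ a′ → z + a′ ≡ a → x ≡ y + z
    combine x y z c a a′ p q r = trans (lemma₁ x c) (trans (cong (_- c) (trans p (trans (sym r) (+-congʳ z (sym q))))) (lemma₂ z y c))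
      where
      lemma₁ : ∀ x c → x ≡ x + c - c
      lemma₁ = solve-∀
      lemma₂ : ∀ z y c → z + (y + c) - c ≡ y + z
      lemma₂ = solve-∀
    halve : ∀ x y z → + 2 * x ≡ + 2 * y + + 2 * z → x ≡ y + z
    halve x y z e = ℤP.*-cancelˡ-≡ (+ 2) x (y + z) (trans e (sym (ℤP.*-distribˡ-+ (+ 2) y z)))

  -- The theta product by comparison of logarithmic derivatives.

  module ψ = Positive 3 0 2 refl
  module ψ₅ = Positive 19 4 14 refl
  -- `A.Θ` and `B.Θ` are f(q, q⁴) and f(q², q³) in Ramanujan's notation; the arguments of `Positive`
  -- are α - 1, β - 1 and α - β - 1.
  module A = Positive 4 3 0 refl
  module B = Positive 4 2 1 refl

  refine : ∀ m a b N → R a b N ≡ sumL (λ i → R (a ℕ.+ m ℕ.* suc a) (b ℕ.+ i ℕ.* suc a) N) (upTo (suc m))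
  refine m a b = refineR m a b _ (λ i → b ℕ.+ i ℕ.* suc a) refl (λ _ → refl)

  refine₂ : ∀ a b N → R a b N ≡ R (a ℕ.+ 1 ℕ.* suc a) (b ℕ.+ 0) N + R (a ℕ.+ 1 ℕ.* suc a) (b ℕ.+ 1 ℕ.* suc a) N
  refine₂ a b N = trans (refine 1 a b N) (+-congʳ (R (a ℕ.+ 1 ℕ.* suc a) (b ℕ.+ 0) N) (ℤP.+-identityʳ (R (a ℕ.+ 1 ℕ.* suc a) (b ℕ.+ 1 ℕ.* suc a) N)))

  -- The logarithmic derivative of Σ q^(α n(n-1) + 2βn).
  theta-c : ℕ → ℕ → ℕ → Series
  theta-c a b g = ⊟ R a a ⊞ ⊟ (Rσ a b ⊞ Rσ a g)

  jacobi-c : ℕ → ℕ → ℕ → Series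
  jacobi-c a b g = ⊟ R a a ⊞ ⊟ (R a b ⊞ R a g)

  theta-c≡ : ∀ a b g N →
    theta-c a b g N ≡ R a b N + R a g N - R a a N - (R (1 ℕ.+ (a ℕ.+ a)) (1 ℕ.+ (b ℕ.+ b)) N + R (1 ℕ.+ (a ℕ.+ a)) (1 ℕ.+ (g ℕ.+ g)) N)
  theta-c≡ a b g N = trans (cong (λ z → - R a a N + - z) (cong₂ _+_ (signedR a b _ _ (twice a) (twice b) N) (signedR a g _ _ (twice a) (twice g) N)))
      (lemma (R a a N) (R a b N) (R a g N) (R (1 ℕ.+ (a ℕ.+ a)) (1 ℕ.+ (b ℕ.+ b)) N) (R (1 ℕ.+ (a ℕ.+ a)) (1 ℕ.+ (g ℕ.+ g)) N))
    where
    twice : ∀ a → suc (1 ℕ.+ (a ℕ.+ a)) ≡ 2 ℕ.* suc a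
    twice a = cong suc (trans (sym (ℕP.+-suc a a)) (cong (λ z → a ℕ.+ suc z) (sym (ℕP.+-identityʳ a))))
    lemma : ∀ x y z u v → - x + - (u + - y + (v + - z)) ≡ y + z - x - (u + v)
    lemma = solve-∀

  -- Every Lambert series is brought to the ten classes mod 10. There the identity between
  -- logarithmic derivatives is linear in `r 0`, ..., `r 9`.
  module Residues (N : ℕ) where

    r : ℕ → ℤ
    r i = R 9 i N

    odds evens : ℤ
    odds = r 0 + (r 2 + (r 4 + (r 6 + (r 8 + 0ℤ))))
    evens = r 1 + (r 3 + (r 5 + (r 7 + (r 9 + 0ℤ))))

    -- In product form this is Gauss's ψ(q) = ∏ (1 - q^(2m)) / (1 - q^(2m-1)): numerators count
    -- negatively, denominators positively.
    ψ-c : theta-c 3 0 2 N ≡ odds - evens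
    ψ-c = trans (theta-c≡ 3 0 2 N) (trans (cong₂ (λ x y → x - R 3 3 N - y) (sym (refine₂ 1 0 N)) (sym (refine₂ 3 1 N)))
      (trans (lemma (R 1 0 N) (R 3 3 N) (R 3 1 N)) (cong₂ _-_ (refine 4 1 0 N) (trans (sym (refine₂ 1 1 N)) (refine 4 1 1 N)))))
      where
      lemma : ∀ x y z → x - y - z ≡ x - (z + y)
      lemma = solve-∀

    ψ₅-c : theta-c 19 4 14 N ≡ r 4 - r 9
    ψ₅-c = trans (theta-c≡ 19 4 14 N) (trans (cong₂ (λ x y → x - R 19 19 N - y) (sym (refine₂ 9 4 N)) (sym (refine₂ 19 9 N)))
      (trans (lemma (R 9 4 N) (R 19 19 N) (R 19 9 N)) (cong (λ z → r 4 - z) (sym (refine₂ 9 9 N)))))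
      where
      lemma : ∀ x y z → x - y - z ≡ x - (z + y)
      lemma = solve-∀

    A-c : theta-c 4 3 0 N ≡ r 3 + r 8 + (r 0 + r 5) - (r 4 + r 9) - (r 7 + r 1)
    A-c = trans (theta-c≡ 4 3 0 N) (cong₂ (λ x y → x - y - (r 7 + r 1)) (cong₂ _+_ (refine₂ 4 3 N) (refine₂ 4 0 N)) (refine₂ 4 4 N))

    B-c : theta-c 4 2 1 N ≡ r 2 + r 7 + (r 1 + r 6) - (r 4 + r 9) - (r 5 + r 3)
    B-c = trans (theta-c≡ 4 2 1 N) (cong₂ (λ x y → x - y - (r 5 + r 3)) (cong₂ _+_ (refine₂ 4 2 N) (refine₂ 4 1 N)) (refine₂ 4 4 N))

    total : theta-c 3 0 2 N + theta-c 19 4 14 N + (theta-c 4 3 0 N + theta-c 4 2 1 N) + (jacobi-c 9 0 8 N + jacobi-c 9 0 8 N + (jacobi-c 9 2 6 N + jacobi-c 9 2 6 N)) ≡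
            jacobi-c 9 1 7 N + jacobi-c 9 3 5 N + (jacobi-c 9 9 9 N + jacobi-c 9 9 9 N)
    total = trans (cong₂ (λ x y → x + y + (jacobi-c 9 0 8 N + jacobi-c 9 0 8 N + (jacobi-c 9 2 6 N + jacobi-c 9 2 6 N))) (cong₂ _+_ ψ-c ψ₅-c) (cong₂ _+_ A-c B-c))
        (lemma (r 0) (r 1) (r 2) (r 3) (r 4) (r 5) (r 6) (r 7) (r 8) (r 9))
      where
      lemma : ∀ r0 r1 r2 r3 r4 r5 r6 r7 r8 r9 →
        (r0 + (r2 + (r4 + (r6 + (r8 + 0ℤ))))) - (r1 + (r3 + (r5 + (r7 + (r9 + 0ℤ))))) + (r4 - r9) +
        (r3 + r8 + (r0 + r5) - (r4 + r9) - (r7 + r1) + (r2 + r7 + (r1 + r6) - (r4 + r9) - (r5 + r3))) +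
        (- r9 + - (r0 + r8) + (- r9 + - (r0 + r8)) + (- r9 + - (r2 + r6) + (- r9 + - (r2 + r6)))) ≡
        - r9 + - (r1 + r7) + (- r9 + - (r3 + r5)) + (- r9 + - (r9 + r9) + (- r9 + - (r9 + r9)))
      lemma = solve-∀

  module ConstantTerm (a b g : ℕ) (eq : + suc a ≡ + b + + g) where
    open Theta a b g eq

    -- `thetaExp n` is at least |n| - 1 by `theta-bound`, so exponent 0 forces n to be 0, 1 or -1.
    constant-term : ∀ {w} (c : Cov w thetaExp) → gf c 0 ≡ sumL (λ i → w i * ind (thetaExp i) 0) (0ℤ ∷ 1ℤ ∷ -1ℤ ∷ [])
    constant-term c = sym (coef c 0 _ (((λ ()) ∷ (λ ()) ∷ []) ∷ ((λ ()) ∷ []) ∷ [] ∷ []) small)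
      where
      small : ∀ n → _ → thetaExp n ≡ 0ℤ → n ∈ 0ℤ ∷ 1ℤ ∷ -1ℤ ∷ []
      small n _ e with n ≟ 0ℤ
      ... | yes refl = here refl
      ... | no nz with theta-bound n nz
      ...   | m , y , s , f , (k , refl) with ℕP.m+n≡0⇒m≡0 m (ℤP.+-injective (trans (sym f) e))
      small (+ suc zero) _ e | no nz | zero , y , s , f , (k , refl) | refl = there (here refl)
      small -[1+ zero ] _ e  | no nz | zero , y , s , f , (k , refl) | refl = there (there (here refl))

  Thetas : Series
  Thetas = ψ.Θ ⊛ ψ₅.Θ ⊛ (A.Θ ⊛ B.Θ)

  product-formula : Thetas ⊛ (Ja² ⊛ Jb²) ≈ (J₂.J ⊛ J₄.J) ⊛ (η.T ⊛ η.T)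
  product-formula = logDer-unique (Thetas ⊛ (Ja² ⊛ Jb²)) ((J₂.J ⊛ J₄.J) ⊛ (η.T ⊛ η.T)) c (trans left0 (sym right0)) c0 left-logDer right-logDer
    where
    c : Series
    c = (jacobi-c 9 1 7 ⊞ jacobi-c 9 3 5) ⊞ (jacobi-c 9 9 9 ⊞ jacobi-c 9 9 9)
    right-logDer : D ((J₂.J ⊛ J₄.J) ⊛ (η.T ⊛ η.T)) ≈ ((J₂.J ⊛ J₄.J) ⊛ (η.T ⊛ η.T)) ⊛ c
    right-logDer = logDer-⊛ (logDer-⊛ J₂.J-logDer J₄.J-logDer) (logDer-⊛ η.T-logDer η.T-logDer)
    left-logDer : D (Thetas ⊛ (Ja² ⊛ Jb²)) ≈ (Thetas ⊛ (Ja² ⊛ Jb²)) ⊛ c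
    left-logDer N = trans (logDer-⊛ (logDer-⊛ (logDer-⊛ ψ.Θ-logDer ψ₅.Θ-logDer) (logDer-⊛ A.Θ-logDer B.Θ-logDer))
        (logDer-⊛ (logDer-⊛ J₁.J-logDer J₁.J-logDer) (logDer-⊛ J₃.J-logDer J₃.J-logDer)) N)
      (⊛-cong {Thetas ⊛ (Ja² ⊛ Jb²)} (λ _ → refl) (λ M → Residues.total M) N)
    product0 : ∀ {x y : ℤ} → x ≡ 1ℤ → y ≡ 1ℤ → x * y ≡ 1ℤ
    product0 refl refl = refl
    left0 : (Thetas ⊛ (Ja² ⊛ Jb²)) 0 ≡ 1ℤ
    left0 = product0 (product0 (product0 (ConstantTerm.constant-term 3 1 3 refl ψ.Θ-cov) (ConstantTerm.constant-term 19 5 15 refl ψ₅.Θ-cov))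
        (product0 (ConstantTerm.constant-term 4 4 1 refl A.Θ-cov) (ConstantTerm.constant-term 4 3 2 refl B.Θ-cov)))
      (product0 (product0 J₁0 J₁0) (product0 J₃0 J₃0))
      where
      J₁0 : J₁.J 0 ≡ 1ℤ
      J₁0 = ConstantTerm.constant-term 9 1 9 refl J₁.J-cov
      J₃0 : J₃.J 0 ≡ 1ℤ
      J₃0 = ConstantTerm.constant-term 9 3 7 refl J₃.J-cov
    right0 : ((J₂.J ⊛ J₄.J) ⊛ (η.T ⊛ η.T)) 0 ≡ 1ℤ
    right0 = product0 (product0 (ConstantTerm.constant-term 9 2 8 refl J₂.J-cov) (ConstantTerm.constant-term 9 4 6 refl J₄.J-cov))
      (cong₂ _*_ T0 T0)
      where
      -- For β = 0 both n = 0 and n = 1 have exponent 0; the first has weight 0 and the second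
      -- `par 1ℤ` = -1.
      T0 : η.T 0 ≡ -1ℤ
      T0 = ConstantTerm.constant-term 9 0 10 refl η.T-cov
    -- A derivative has constant term 0, so the logarithmic equation read at degree 0 already forces
    -- this.
    c0 : c 0 ≡ 0ℤ
    c0 = sym (trans (right-logDer 0) (trans (cong (_* c 0) right0) (ℤP.*-identityˡ (c 0))))

  -- Σ_(xy = M, x odd) (5/x) y as a product of theta functions.
  S-product : ∀ N → Sa N - Sb N ≡ (mono 2 ⊛ Thetas) N
  S-product = ⊛-cancelʳ (λ N → Sa N - Sb N) (mono 2 ⊛ Thetas) (Ja² ⊛ Jb²) K0 same
    where
    K0 : (Ja² ⊛ Jb²) 0 ≡ 1ℤ
    K0 = cong₂ _*_ (cong₂ _*_ J₁0 J₁0) (cong₂ _*_ J₃0 J₃0)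
      where
      J₁0 : J₁.J 0 ≡ 1ℤ
      J₁0 = ConstantTerm.constant-term 9 1 9 refl J₁.J-cov
      J₃0 : J₃.J 0 ≡ 1ℤ
      J₃0 = ConstantTerm.constant-term 9 3 7 refl J₃.J-cov
    open ≡-Reasoning
    same : (λ N → Sa N - Sb N) ⊛ (Ja² ⊛ Jb²) ≈ (mono 2 ⊛ Thetas) ⊛ (Ja² ⊛ Jb²)
    same N = begin
      ((Sa ⊞ ⊟ Sb) ⊛ (Ja² ⊛ Jb²)) N ≡⟨ trans (⊛-distribʳ (Ja² ⊛ Jb²) Sa (⊟ Sb) N) (+-congʳ ((Sa ⊛ (Ja² ⊛ Jb²)) N) (⊛-⊟ˡ Sb (Ja² ⊛ Jb²) N)) ⟩
      (Sa ⊛ (Ja² ⊛ Jb²)) N - (Sb ⊛ (Ja² ⊛ Jb²)) N ≡⟨ cong₂ _-_ (perm Sa Ja² Jb² N) (trans (⊛-cong {Sb} (λ _ → refl) (⊛-comm Ja² Jb²) N) (perm Sb Jb² Ja² N)) ⟩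
      (Ja² ⊛ Sa ⊛ Jb²) N - (Jb² ⊛ Sb ⊛ Ja²) N ≡⟨ cong (_- (Jb² ⊛ Sb ⊛ Ja²) N) (℘-difference N) ⟩
      (Jb² ⊛ Sb ⊛ Ja²) N + (mono 2 ⊛ (J₂.J ⊛ J₄.J) ⊛ (η.T ⊛ η.T)) N - (Jb² ⊛ Sb ⊛ Ja²) N ≡⟨ cancel ((Jb² ⊛ Sb ⊛ Ja²) N) _ ⟩
      (mono 2 ⊛ (J₂.J ⊛ J₄.J) ⊛ (η.T ⊛ η.T)) N ≡⟨ ⊛-assoc (mono 2) (J₂.J ⊛ J₄.J) (η.T ⊛ η.T) N ⟩
      (mono 2 ⊛ ((J₂.J ⊛ J₄.J) ⊛ (η.T ⊛ η.T))) N ≡⟨ ⊛-cong {mono 2} (λ _ → refl) (λ M → sym (product-formula M)) N ⟩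
      (mono 2 ⊛ (Thetas ⊛ (Ja² ⊛ Jb²))) N ≡⟨ sym (⊛-assoc (mono 2) Thetas (Ja² ⊛ Jb²) N) ⟩
      ((mono 2 ⊛ Thetas) ⊛ (Ja² ⊛ Jb²)) N ∎
      where
      cancel : ∀ x y → x + y - x ≡ y
      cancel = solve-∀
      perm : ∀ x y z → x ⊛ (y ⊛ z) ≈ y ⊛ x ⊛ z
      perm = solve 3 (λ x y z → x :* (y :* z) := y :* x :* z) ≈-refl

  -- Triangular numbers and the Gaussian integers.

  -- The theta function Σ q^(m x(x-1)), x ∈ ℤ, in the variable q^(1/2).
  triExp : ℕ → ℤ → ℤ
  triExp m x = + m * twoTri x

  tri-cov : ∀ m → Cov (λ _ → 1ℤ) (triExp (suc m))
  tri-cov m = cov-match T.cov-theta (bijection-match id id (λ _ → refl) (lemma (+ suc m)) (λ _ → refl) (λ _ → refl))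
    where
    module T = Theta m 0 (suc m) refl
    lemma : ∀ a x → a * (x * (x - 1ℤ)) ≡ a * (x * (x - 1ℤ)) + + 2 * (0ℤ * x)
    lemma = solve-∀

  opaque
    Ψ₁-cov : Cov (λ _ → 1ℤ) (triExp 1)
    Ψ₁-cov = tri-cov 0

    Ψ₅-cov : Cov (λ _ → 1ℤ) (triExp 5)
    Ψ₅-cov = tri-cov 4

  Ψ₁ Ψ₅ : Series
  Ψ₁ = gf Ψ₁-cov
  Ψ₅ = gf Ψ₅-cov

  -- Both x = 2t and x = 1 - 2t give the exponent of ψ.
  two-halves : {E F : ℤ → ℤ} (c : Cov (λ _ → 1ℤ) E) (d : Cov (λ _ → 1ℤ) F) →
               (∀ t → F t ≡ E (0ℤ + t * + 2)) → (∀ t → F (- t) ≡ E (1ℤ + t * + 2)) → gf c ≈ + 2 · gf d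
  two-halves {E} c d p q N = trans (coset-split (residues 1) c (λ _ → gf d) each N)
      (trans (+-congʳ (gf d N) (ℤP.+-identityʳ (gf d N))) (lemma (gf d N)))
    where
    lemma : ∀ x → x + x ≡ + 2 * x
    lemma = solve-∀
    each : ∀ i → i ℕ.< 2 → (e : Cov (λ _ → 1ℤ) (E ∘ Cosets.embed (residues 1) i)) → gf e ≈ gf d
    each zero          _ e = gf-match e (bijection-match id id (λ _ → refl) p (λ _ → refl) (λ _ → refl)) d
    each (suc zero)    _ e = gf-match e (neg-match (λ _ → refl) q) d
    each (suc (suc i)) (s≤s (s≤s ())) e

  Ψ₁≈ : Ψ₁ ≈ + 2 · ψ.Θ
  Ψ₁≈ = two-halves Ψ₁-cov ψ.Θ-cov p q
    where
    p : ∀ t → + 4 * (t * (t - 1ℤ)) + + 2 * (+ 1 * t) ≡ + 1 * ((0ℤ + t * + 2) * (0ℤ + t * + 2 - 1ℤ))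
    p = solve-∀
    q : ∀ t → + 4 * (- t * (- t - 1ℤ)) + + 2 * (+ 1 * - t) ≡ + 1 * ((1ℤ + t * + 2) * (1ℤ + t * + 2 - 1ℤ))
    q = solve-∀

  Ψ₅≈ : Ψ₅ ≈ + 2 · ψ₅.Θ
  Ψ₅≈ = two-halves Ψ₅-cov ψ₅.Θ-cov p q
    where
    p : ∀ t → + 20 * (t * (t - 1ℤ)) + + 2 * (+ 5 * t) ≡ + 5 * ((0ℤ + t * + 2) * (0ℤ + t * + 2 - 1ℤ))
    p = solve-∀
    q : ∀ t → + 20 * (- t * (- t - 1ℤ)) + + 2 * (+ 5 * - t) ≡ + 5 * ((1ℤ + t * + 2) * (1ℤ + t * + 2 - 1ℤ))
    q = solve-∀

  -- Multiplication by 2 + i on ℤ[i]: the class of (z , w) is z + 2w mod 5.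
  gauss : (ℤ × ℤ) ≅ (ℤ × ℤ)
  gauss = record { to = λ (z , w) → z + + 2 * w , w ; from = λ (v , w) → v - + 2 * w , w
                 ; from-to = λ (z , w) → cong (_, w) (lemma₁ z w) ; to-from = λ (v , w) → cong (_, w) (lemma₂ v w) }
    where
    lemma₁ : ∀ z w → z + + 2 * w - + 2 * w ≡ z
    lemma₁ = solve-∀
    lemma₂ : ∀ v w → v - + 2 * w + + 2 * w ≡ v
    lemma₂ = solve-∀

  gauss-cosets : Cosets (ℤ × ℤ) (ℤ × ℤ) 4
  gauss-cosets = residues-via 4 gauss

  module G = Cosets gauss-cosets

  pairExp : ℤ × ℤ → ℤ
  pairExp (z , w) = triExp 1 z + triExp 1 w

  -- Put Z = 2z - 1, W = 2w - 1, A = 2a - 1, B = 2b - 1. The substitution is Z + iW = (-2 + i)(A +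
  -- iB), so Z² + W² = 5(A² + B²); passing from squares to x(x - 1) leaves the constant 2.
  coset₄-match : Match (λ y → 1ℤ) (pairExp ∘ G.embed 4) (λ _ → 1ℤ) (λ (a , b) → + 2 + (triExp 5 a + triExp 5 b))
  coset₄-match = bijection-match (λ (n , w) → - (+ 2 * n - w + 1ℤ) , - n) (λ (a , b) → - b , + 2 * - b + a + 1ℤ)
      (λ _ → refl) (λ (n , w) → lemma n w) (λ (n , w) → cong₂ _,_ (ℤP.neg-involutive n) (lemma₁ n w)) (λ (a , b) → cong₂ _,_ (lemma₂ a b) (ℤP.neg-involutive b))
    where
    lemma : ∀ n w → + 2 + (+ 5 * (- (+ 2 * n - w + 1ℤ) * (- (+ 2 * n - w + 1ℤ) - 1ℤ)) + + 5 * (- n * (- n - 1ℤ))) ≡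
      + 1 * ((+ 4 + n * + 5 - + 2 * w) * (+ 4 + n * + 5 - + 2 * w - 1ℤ)) + + 1 * (w * (w - 1ℤ))
    lemma = solve-∀
    lemma₁ : ∀ n w → + 2 * - - n + - (+ 2 * n - w + 1ℤ) + 1ℤ ≡ w
    lemma₁ = solve-∀
    lemma₂ : ∀ a b → - (+ 2 * - b - (+ 2 * - b + a + 1ℤ) + 1ℤ) ≡ a
    lemma₂ = solve-∀

  -- In odd coordinates the class of Z + 2W mod 5 is doubled when Z + iW is multiplied by i, and 2
  -- generates the units mod 5. Hence the four nonzero classes contribute equally; class 4 is the
  -- one with Z + 2W ≡ 0.
  Ψ₁² : ∀ N → (Ψ₁ ⊛ Ψ₁) N ≡ + 4 * (A.Θ ⊛ B.Θ) N + (mono 2 ⊛ (Ψ₅ ⊛ Ψ₅)) N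
  Ψ₁² N = trans (sym (gf-⊗ Ψ₁-cov Ψ₁-cov N)) (trans (coset-split gauss-cosets (cov-⊗ Ψ₁-cov Ψ₁-cov) f each N)
      (lemma ((A.Θ ⊛ B.Θ) N) ((mono 2 ⊛ (Ψ₅ ⊛ Ψ₅)) N)))
    where
    lemma : ∀ x y → x + (x + (x + (x + (y + 0ℤ)))) ≡ + 4 * x + y
    lemma = solve-∀
    f : ℕ → Series
    f (suc (suc (suc (suc _)))) = mono 2 ⊛ (Ψ₅ ⊛ Ψ₅)
    f _ = A.Θ ⊛ B.Θ
    AB : Cov (λ _ → 1ℤ * 1ℤ) (λ (a , b) → A.thetaExp a + B.thetaExp b)
    AB = cov-⊗ A.Θ-cov B.Θ-cov
    via : ∀ i (to from : ℤ × ℤ → ℤ × ℤ) → (∀ y → A.thetaExp (proj₁ (to y)) + B.thetaExp (proj₂ (to y)) ≡ pairExp (G.embed i y)) →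
          (∀ y → from (to y) ≡ y) → (∀ y → to (from y) ≡ y) → (d : Cov (λ _ → 1ℤ * 1ℤ) (pairExp ∘ G.embed i)) → gf d ≈ A.Θ ⊛ B.Θ
    via i to from e l r d M = trans (gf-match d (bijection-match to from (λ _ → refl) e l r) AB M) (gf-⊗ A.Θ-cov B.Θ-cov M)
    each : ∀ i → i ℕ.< 5 → (d : Cov (λ _ → 1ℤ * 1ℤ) (pairExp ∘ G.embed i)) → gf d ≈ f i
    each 0 _ = via 0 (λ (n , w) → - n , - (+ 2 * n - w)) (λ (a , b) → - a , + 2 * - a + b) (λ (n , w) → e n w)
        (λ (n , w) → cong₂ _,_ (ℤP.neg-involutive n) (l n w)) (λ (a , b) → cong₂ _,_ (ℤP.neg-involutive a) (r a b))
      where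
      e : ∀ n w → + 5 * (- n * (- n - 1ℤ)) + + 2 * (+ 4 * - n) + (+ 5 * (- (+ 2 * n - w) * (- (+ 2 * n - w) - 1ℤ)) + + 2 * (+ 3 * - (+ 2 * n - w))) ≡
        + 1 * ((+ 0 + n * + 5 - + 2 * w) * (+ 0 + n * + 5 - + 2 * w - 1ℤ)) + + 1 * (w * (w - 1ℤ))
      e = solve-∀
      l : ∀ n w → + 2 * - - n + - (+ 2 * n - w) ≡ w
      l = solve-∀
      r : ∀ a b → - (+ 2 * - a - (+ 2 * - a + b)) ≡ b
      r = solve-∀
    each 1 _ = via 1 (λ (n , w) → + 2 * n - w , - n) (λ (a , b) → - b , + 2 * - b - a) (λ (n , w) → e n w)
        (λ (n , w) → cong₂ _,_ (ℤP.neg-involutive n) (l n w)) (λ (a , b) → cong₂ _,_ (r a b) (ℤP.neg-involutive b))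
      where
      e : ∀ n w → + 5 * ((+ 2 * n - w) * ((+ 2 * n - w) - 1ℤ)) + + 2 * (+ 4 * (+ 2 * n - w)) + (+ 5 * (- n * (- n - 1ℤ)) + + 2 * (+ 3 * - n)) ≡
        + 1 * ((+ 1 + n * + 5 - + 2 * w) * (+ 1 + n * + 5 - + 2 * w - 1ℤ)) + + 1 * (w * (w - 1ℤ))
      e = solve-∀
      l : ∀ n w → + 2 * - - n - (+ 2 * n - w) ≡ w
      l = solve-∀
      r : ∀ a b → + 2 * - b - (+ 2 * - b - a) ≡ a
      r = solve-∀
    each 2 _ = via 2 (λ (n , w) → - (+ 2 * n - w + 1ℤ) , n) (λ (a , b) → b , + 2 * b + a + 1ℤ) (λ (n , w) → e n w)
        (λ (n , w) → cong (n ,_) (l n w)) (λ (a , b) → cong (_, b) (r a b))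
      where
      e : ∀ n w → + 5 * (- (+ 2 * n - w + 1ℤ) * (- (+ 2 * n - w + 1ℤ) - 1ℤ)) + + 2 * (+ 4 * - (+ 2 * n - w + 1ℤ)) + (+ 5 * (n * (n - 1ℤ)) + + 2 * (+ 3 * n)) ≡
        + 1 * ((+ 2 + n * + 5 - + 2 * w) * (+ 2 + n * + 5 - + 2 * w - 1ℤ)) + + 1 * (w * (w - 1ℤ))
      e = solve-∀
      l : ∀ n w → + 2 * n + - (+ 2 * n - w + 1ℤ) + 1ℤ ≡ w
      l = solve-∀
      r : ∀ a b → - (+ 2 * b - (+ 2 * b + a + 1ℤ) + 1ℤ) ≡ a
      r = solve-∀
    each 3 _ = via 3 (λ (n , w) → n , + 2 * n - w + 1ℤ) (λ (a , b) → a , + 2 * a - b + 1ℤ) (λ (n , w) → e n w)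
        (λ (n , w) → cong (n ,_) (l n w)) (λ (a , b) → cong (a ,_) (l a b))
      where
      e : ∀ n w → + 5 * (n * (n - 1ℤ)) + + 2 * (+ 4 * n) + (+ 5 * ((+ 2 * n - w + 1ℤ) * (+ 2 * n - w + 1ℤ - 1ℤ)) + + 2 * (+ 3 * (+ 2 * n - w + 1ℤ))) ≡
        + 1 * ((+ 3 + n * + 5 - + 2 * w) * (+ 3 + n * + 5 - + 2 * w - 1ℤ)) + + 1 * (w * (w - 1ℤ))
      e = solve-∀
      l : ∀ n w → + 2 * n - (+ 2 * n - w + 1ℤ) + 1ℤ ≡ w
      l = solve-∀
    each 4 _ d M = trans (gf-match d coset₄-match (cov-shift 2 (cov-⊗ Ψ₅-cov Ψ₅-cov)) M)
      (trans (gf-shift 2 (cov-⊗ Ψ₅-cov Ψ₅-cov) M) (⊛-cong {mono 2} (λ _ → refl) (gf-⊗ Ψ₅-cov Ψ₅-cov) M))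
    each (suc (suc (suc (suc (suc i))))) (s≤s (s≤s (s≤s (s≤s (s≤s ())))))

  -- The shifts turn the exponents into quadratic forms: with X = 2x - 1 and so on they are a
  -- quarter of X² + 5Y² + Z² + W² for `ρ` and of X² + 5Y² + 5Z² + 5W² for `τ`.
  ρ τ : Series
  ρ = mono 2 ⊛ ((Ψ₁ ⊛ Ψ₅) ⊛ (Ψ₁ ⊛ Ψ₁))
  τ = mono 4 ⊛ ((Ψ₁ ⊛ Ψ₅) ⊛ (Ψ₅ ⊛ Ψ₅))

  -- 16 = 2 · 2 · 4: `Ψ₁` and `Ψ₅` are each twice a ψ, and four classes in `Ψ₁²` give the product of
  -- `A.Θ` and `B.Θ`. The remaining class turns `ρ` into `τ`.
  ρ-τ : ∀ N → ρ N ≡ + 16 * (Sa N - Sb N) + τ N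
  ρ-τ N = begin
    ρ N ≡⟨ ⊛-cong {mono 2} (λ _ → refl) (⊛-cong {Ψ₁ ⊛ Ψ₅} {Ψ₁ ⊛ Ψ₅} (λ _ → refl) Ψ₁²) N ⟩
    (mono 2 ⊛ ((Ψ₁ ⊛ Ψ₅) ⊛ (+ 4 · (A.Θ ⊛ B.Θ) ⊞ mono 2 ⊛ (Ψ₅ ⊛ Ψ₅)))) N ≡⟨ expand (mono 2) (Ψ₁ ⊛ Ψ₅) (+ 4 · (A.Θ ⊛ B.Θ)) (Ψ₅ ⊛ Ψ₅) N ⟩
    (mono 2 ⊛ ((Ψ₁ ⊛ Ψ₅) ⊛ (+ 4 · (A.Θ ⊛ B.Θ)))) N + (mono 2 ⊛ mono 2 ⊛ ((Ψ₁ ⊛ Ψ₅) ⊛ (Ψ₅ ⊛ Ψ₅))) N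
      ≡⟨ cong₂ _+_ (trans (⊛-cong {mono 2} (λ _ → refl) scale N) (trans (⊛-comm (mono 2) (+ 16 · Thetas) N) (trans (⊛-scaleˡ (+ 16) Thetas (mono 2) N)
           (cong (+ 16 *_) (⊛-comm Thetas (mono 2) N))))) (⊛-cong {g = (Ψ₁ ⊛ Ψ₅) ⊛ (Ψ₅ ⊛ Ψ₅)} (mono-⊛ 2 2) (λ _ → refl) N) ⟩
    + 16 * (mono 2 ⊛ Thetas) N + τ N ≡⟨ cong (λ z → + 16 * z + τ N) (sym (S-product N)) ⟩
    + 16 * (Sa N - Sb N) + τ N ∎
    where
    open ≡-Reasoning
    expand : ∀ m x y z → m ⊛ (x ⊛ (y ⊞ m ⊛ z)) ≈ m ⊛ (x ⊛ y) ⊞ m ⊛ m ⊛ (x ⊛ z)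
    expand = solve 4 (λ m x y z → m :* (x :* (y :+ m :* z)) := m :* (x :* y) :+ m :* m :* (x :* z)) ≈-refl
    ⊛-scales : ∀ k l f g → (k · f) ⊛ (l · g) ≈ (k * l) · (f ⊛ g)
    ⊛-scales k l f g M = trans (⊛-scaleˡ k f (l · g) M) (trans (cong (k *_) (trans (⊛-comm f (l · g) M) (trans (⊛-scaleˡ l g f M) (cong (l *_) (⊛-comm g f M)))))
      (sym (ℤP.*-assoc k l ((f ⊛ g) M))))
    scale : (Ψ₁ ⊛ Ψ₅) ⊛ (+ 4 · (A.Θ ⊛ B.Θ)) ≈ + 16 · Thetas
    scale M = trans (⊛-cong {g = + 4 · (A.Θ ⊛ B.Θ)} (λ K → trans (⊛-cong Ψ₁≈ Ψ₅≈ K) (⊛-scales (+ 2) (+ 2) ψ.Θ ψ₅.Θ K)) (λ _ → refl) M)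
      (⊛-scales (+ 4) (+ 4) (ψ.Θ ⊛ ψ₅.Θ) (A.Θ ⊛ B.Θ) M)

  -- Representation numbers compared modulo 5.

  module _ {I J : Set} {w E : I → ℤ} {v F : J → ℤ} (c : Cov w E) (d : Cov v F) (N M : ℕ) where

    private
      -- Only the terms of degree n are kept, and they are given exponent 0. Then `gf-match` also
      -- compares coefficients of different degrees N and M.
      at : {K : Set} {u X : K → ℤ} (k : Cov u X) (n : ℕ) → Cov (λ i → u i * ind (X i) n) (λ _ → 0ℤ)
      at {u = u} {X} k n = record
        { nonneg = λ _ _ → 0 , refl ; list = λ _ → Cov.list k n ; uniq = λ _ → Cov.uniq k n
        ; covers = λ _ i nz _ → Cov.covers k n i (≢0-*ˡ nz) (ℤP.≤-reflexive (ind-≢0 (X i) n (≢0-*ʳ {u i} nz))) }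

      at≡ : {K : Set} {u X : K → ℤ} (k : Cov u X) (n : ℕ) → gf (at k n) 0 ≡ gf k n
      at≡ {u = u} {X} k n = trans (gf-def (at k n) 0) (trans (sumL-cong (λ i → ℤP.*-identityʳ (u i * ind (X i) n)) (Cov.list k n)) (sym (gf-def k n)))

      at-weight : ∀ {u X : ℤ} n → X ≡ + n → u * ind X n ≡ u
      at-weight {u} {X} n e = trans (cong (u *_) (𝟙-yes (X ≟ + n) e)) (ℤP.*-identityʳ u)

    coef-match : (to : I → J) (from : J → I) →
      (∀ i → w i ≢ 0ℤ → E i ≡ + N → v (to i) ≡ w i × F (to i) ≡ + M × from (to i) ≡ i) →
      (∀ j → v j ≢ 0ℤ → F j ≡ + M → w (from j) ≡ v j × E (from j) ≡ + N × to (from j) ≡ j) → gf c N ≡ gf d M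
    coef-match to from to-ok from-ok = trans (sym (at≡ c N)) (trans (gf-match (at c N) m (at d M) 0) (at≡ d M))
      where
      m : Match (λ i → w i * ind (E i) N) (λ _ → 0ℤ) (λ j → v j * ind (F j) M) (λ _ → 0ℤ)
      m = record
        { to = to ; from = from
        ; to-ok = λ i nz → let e = ind-≢0 (E i) N (≢0-*ʳ {w i} nz) ; (p , q , r) = to-ok i (≢0-*ˡ nz) e in
            trans (at-weight M q) (trans p (sym (at-weight N e))) , refl , r
        ; from-ok = λ j nz → let e = ind-≢0 (F j) M (≢0-*ʳ {v j} nz) ; (p , q , r) = from-ok j (≢0-*ˡ nz) e in
            trans (at-weight N q) (trans p (sym (at-weight M e))) , r }

  coef-cong : {I : Set} {w E v : I → ℤ} (c : Cov w E) (d : Cov v E) (N : ℕ) → (∀ i → E i ≡ + N → w i ≡ v i) → gf c N ≡ gf d N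
  coef-cong c d N e = coef-match c d N N id id (λ i _ q → sym (e i q) , q , refl) (λ i _ q → e i q , q , refl)

  repExp : ℕ → ℕ → ℕ → ℕ → ℕ → ℤ × ℤ × ℤ × ℤ → ℤ
  repExp k a b c d (x , y , z , w) = + k + (triExp a x + triExp b y + (triExp c z + triExp d w))

  module _ {a b c d : ℕ} (k : ℕ) (ca : Cov (λ _ → 1ℤ) (triExp a)) (cb : Cov (λ _ → 1ℤ) (triExp b))
           (cc : Cov (λ _ → 1ℤ) (triExp c)) (cd : Cov (λ _ → 1ℤ) (triExp d)) where
    private
      product : Cov {(ℤ × ℤ) × ℤ × ℤ} (λ _ → 1ℤ) (λ (i , j) → + k + (triExp a (proj₁ i) + triExp b (proj₂ i) + (triExp c (proj₁ j) + triExp d (proj₂ j))))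
      product = cov-shift k (cov-⊗ (cov-⊗ ca cb) (cov-⊗ cc cd))

      flat : Match {(ℤ × ℤ) × ℤ × ℤ} {ℤ × ℤ × ℤ × ℤ} (λ _ → 1ℤ) _ (λ _ → 1ℤ) (repExp k a b c d)
      flat = bijection-match (λ ((x , y) , z , w) → x , y , z , w) (λ (x , y , z , w) → (x , y) , z , w) (λ _ → refl) (λ _ → refl) (λ _ → refl) (λ _ → refl)

    rep-cov : Cov (λ _ → 1ℤ) (repExp k a b c d)
    rep-cov = cov-match product flat

    gf-rep : gf rep-cov ≈ mono k ⊛ ((gf ca ⊛ gf cb) ⊛ (gf cc ⊛ gf cd))
    gf-rep N = trans (sym (gf-match product flat rep-cov N)) (trans (gf-shift k (cov-⊗ (cov-⊗ ca cb) (cov-⊗ cc cd)) N)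
      (⊛-cong {mono k} (λ _ → refl) (λ M → trans (gf-⊗ (cov-⊗ ca cb) (cov-⊗ cc cd) M) (⊛-cong (gf-⊗ ca cb) (gf-⊗ cc cd) M)) N))

  τ-cov : Cov (λ _ → 1ℤ) (repExp 4 1 5 5 5)
  τ-cov = rep-cov {1} {5} {5} {5} 4 Ψ₁-cov Ψ₅-cov Ψ₅-cov Ψ₅-cov

  ρ-cov : Cov (λ _ → 1ℤ) (repExp 2 1 5 1 1)
  ρ-cov = rep-cov {1} {5} {1} {1} 2 Ψ₁-cov Ψ₅-cov Ψ₁-cov Ψ₁-cov

  τ≡ : ∀ N → gf τ-cov N ≡ τ N
  τ≡ = gf-rep {1} {5} {5} {5} 4 Ψ₁-cov Ψ₅-cov Ψ₅-cov Ψ₅-cov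

  ρ≡ : ∀ N → gf ρ-cov N ≡ ρ N
  ρ≡ = gf-rep {1} {5} {1} {1} 2 Ψ₁-cov Ψ₅-cov Ψ₁-cov Ψ₁-cov

  %-cong : ∀ m N a K → + N ≡ + a + K * + suc m → N ℕ.% suc m ≡ a ℕ.% suc m
  %-cong m N a K e = proj₁ (div-unique m (N ℕ.% suc m) (a ℕ.% suc m) (+ (N ℕ./ suc m)) (+ (a ℕ./ suc m) + K) (ℕDM.m%n<n N (suc m)) (ℕDM.m%n<n a (suc m))
      (trans (sym (decompose N)) (trans e (trans (cong (_+ K * + suc m) (decompose a)) (lemma (+ (a ℕ.% suc m)) (+ (a ℕ./ suc m)) K (+ suc m))))))
    where
    decompose : ∀ n → + n ≡ + (n ℕ.% suc m) + + (n ℕ./ suc m) * + suc m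
    decompose n = trans (cong +_ (ℕDM.m≡m%n+[m/n]*n n (suc m))) (+-congʳ (+ (n ℕ.% suc m)) (ℤP.pos-* (n ℕ./ suc m) (suc m)))
    lemma : ∀ r q K m → r + q * m + K * m ≡ r + (q + K) * m
    lemma = solve-∀

  mod5 : ∀ N a K → + N ≡ + a + K * + 5 → N ℕ.% 5 ≡ a ℕ.% 5
  mod5 = %-cong 4

  record Residue (x : ℤ) : Set where
    constructor residue
    field
      rem  : ℕ
      quot : ℤ
      rem< : rem ℕ.< 5
      eq   : x ≡ + rem + quot * + 5

  residue5 : ∀ x → Residue x
  residue5 x = residue (x ℤDM.%ℕ 5) (x ℤDM./ℕ 5) (ℤDM.n%ℕd<d x 5) (ℤDM.a≡a%ℕn+[a/ℕn]*n x 5)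

  pronic : ℕ → ℕ
  pronic r = r ℕ.* (r ℕ.∸ 1)

  +pronic : ∀ r → + r * (+ r - 1ℤ) ≡ + pronic r
  +pronic zero    = refl
  +pronic (suc r) = sym (ℤP.pos-* (suc r) r)

  τ-residue : ∀ N x y z w → repExp 4 1 5 5 5 (x , y , z , w) ≡ + N → N ℕ.% 5 ≡ (4 ℕ.+ pronic (Residue.rem (residue5 x))) ℕ.% 5
  τ-residue N x y z w e = mod5 N (4 ℕ.+ pronic r) K (trans (sym e) (trans (cong (λ v → repExp 4 1 5 5 5 (v , y , z , w)) (Residue.eq (residue5 x)))
      (trans (lemma (+ r) t (twoTri y) (twoTri z) (twoTri w)) (cong (λ p → + 4 + p + K * + 5) (+pronic r)))))
    where
    r : ℕ
    r = Residue.rem (residue5 x)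
    t K : ℤ
    t = Residue.quot (residue5 x)
    K = + 2 * + r * t - t + + 5 * (t * t) + twoTri y + twoTri z + twoTri w
    lemma : ∀ r t y z w → + 4 + (+ 1 * ((r + t * + 5) * (r + t * + 5 - 1ℤ)) + + 5 * y + (+ 5 * z + + 5 * w)) ≡
      + 4 + r * (r - 1ℤ) + (+ 2 * r * t - t + + 5 * (t * t) + y + z + w) * + 5
    lemma = solve-∀

  -- 4 + x(x - 1) is 4, 4, 1, 0, 1 mod 5 for x = 0, ..., 4. The value 0 occurs only at x = 3, where
  -- 2x - 1 is divisible by 5.
  τ-residues : ∀ r → r ℕ.< 5 → ∀ {n} → n ≡ (4 ℕ.+ pronic r) ℕ.% 5 → (n ≡ 0 → r ≡ 3) × n ≢ 2 × n ≢ 3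
  τ-residues 0 _ refl = (λ ()) , (λ ()) , (λ ())
  τ-residues 1 _ refl = (λ ()) , (λ ()) , (λ ())
  τ-residues 2 _ refl = (λ ()) , (λ ()) , (λ ())
  τ-residues 3 _ refl = (λ _ → refl) , (λ ()) , (λ ())
  τ-residues 4 _ refl = (λ ()) , (λ ()) , (λ ())
  τ-residues (suc (suc (suc (suc (suc _))))) (s≤s (s≤s (s≤s (s≤s (s≤s ())))))

  τ-zero : ∀ N → N ℕ.% 5 ≡ 2 ⊎ N ℕ.% 5 ≡ 3 → τ N ≡ 0ℤ
  τ-zero N c = trans (sym (τ≡ N)) (sym (coef τ-cov N [] [] none))
    where
    none : ∀ i → 1ℤ ≢ 0ℤ → repExp 4 1 5 5 5 i ≡ + N → i ∈ []
    none (x , y , z , w) _ e with τ-residues _ (Residue.rem< (residue5 x)) (τ-residue N x y z w e)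
    ... | _ , n2 , n3 = [ (λ p → contradiction p n2) , (λ p → contradiction p n3) ]′ c

  -- If 5 divides X² + 5(Y² + Z² + W²), then X = 5X′ and the form is 5(5X′² + Y² + Z² + W²). For x =
  -- 3 + 5t one has X′ = 2t + 1, and X′² is also the square of 2(-t) - 1, whence the coordinate -t.
  τ-dilate : ∀ N → τ (5 ℕ.* N) ≡ ρ N
  τ-dilate N = trans (sym (τ≡ (5 ℕ.* N))) (trans (coef-match τ-cov ρ-cov (5 ℕ.* N) N to from to-ok from-ok) (ρ≡ N))
    where
    to from : ℤ × ℤ × ℤ × ℤ → ℤ × ℤ × ℤ × ℤ
    to (x , y , z , w) = y , - (x ℤDM./ℕ 5) , z , w
    from (y , u , z , w) = + 3 + - u * + 5 , y , z , w
    exp-ok : ∀ t y z w → + 4 + (+ 1 * ((+ 3 + t * + 5) * (+ 3 + t * + 5 - 1ℤ)) + + 5 * y + (+ 5 * z + + 5 * w)) ≡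
      + 5 * (+ 2 + (+ 1 * y + + 5 * (- t * (- t - 1ℤ)) + (+ 1 * z + + 1 * w)))
    exp-ok = solve-∀
    three : ∀ x y z w → repExp 4 1 5 5 5 (x , y , z , w) ≡ + (5 ℕ.* N) → + 3 + (x ℤDM./ℕ 5) * + 5 ≡ x
    three x y z w e = trans (cong (λ r → + r + (x ℤDM./ℕ 5) * + 5) (sym r≡3)) (sym (Residue.eq (residue5 x)))
      where
      r≡3 : Residue.rem (residue5 x) ≡ 3
      r≡3 = proj₁ (τ-residues _ (Residue.rem< (residue5 x)) (τ-residue (5 ℕ.* N) x y z w e)) (trans (cong (ℕ._% 5) (ℕP.*-comm 5 N)) (ℕDM.m*n%n≡0 N 5))
    to-ok : ∀ i → 1ℤ ≢ 0ℤ → repExp 4 1 5 5 5 i ≡ + (5 ℕ.* N) → 1ℤ ≡ 1ℤ × repExp 2 1 5 1 1 (to i) ≡ + N × from (to i) ≡ i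
    to-ok (x , y , z , w) _ e = refl ,
      ℤP.*-cancelˡ-≡ (+ 5) _ (+ N) (trans (sym (exp-ok (x ℤDM./ℕ 5) (twoTri y) (twoTri z) (twoTri w)))
        (trans (cong (λ v → repExp 4 1 5 5 5 (v , y , z , w)) (three x y z w e)) (trans e (ℤP.pos-* 5 N)))) ,
      cong (_, y , z , w) (trans (cong (λ v → + 3 + v * + 5) (ℤP.neg-involutive (x ℤDM./ℕ 5))) (three x y z w e))
    from-ok : ∀ j → 1ℤ ≢ 0ℤ → repExp 2 1 5 1 1 j ≡ + N → 1ℤ ≡ 1ℤ × repExp 4 1 5 5 5 (from j) ≡ + (5 ℕ.* N) × to (from j) ≡ j
    from-ok (y , u , z , w) _ e = refl ,
      trans (exp-ok (- u) (twoTri y) (twoTri z) (twoTri w)) (trans (cong (λ v → + 5 * (+ 2 + (+ 1 * twoTri y + + 5 * twoTri v + (+ 1 * twoTri z + + 1 * twoTri w)))) (ℤP.neg-involutive u))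
        (trans (cong (+ 5 *_) e) (sym (ℤP.pos-* 5 N)))) ,
      cong (λ v → y , v , z , w) (trans (cong -_ (proj₂ (%-point 4 3 (- u) (s≤s (s≤s (s≤s (s≤s z≤n))))))) (ℤP.neg-involutive u))

  -- Isotropic lines over 𝔽₅.

  isotropic : ℤ → ℤ → ℤ
  -- p + 2q ≡ 4 is the equation P + 2Q ≡ 0 mod 5 for P = 2p - 1 and Q = 2q - 1.
  isotropic p q = 𝟙 ((p + + 2 * q) ℤDM.%ℕ 5 ℕP.≟ 4)

  -- The six isotropic lines of x² + z² + w² over 𝔽₅ and the vectors orthogonal to them; recall that x stands for 2x - 1.
  line : ℕ → ℤ × ℤ × ℤ × ℤ → ℤ
  line 0 (x , y , z , w) = isotropic z w
  line 1 (x , y , z , w) = isotropic z (1ℤ - w)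
  line 2 (x , y , z , w) = isotropic x z
  line 3 (x , y , z , w) = isotropic x (1ℤ - z)
  line 4 (x , y , z , w) = isotropic x w
  line _ (x , y , z , w) = isotropic x (1ℤ - w)

  line-cov : ∀ i → Cov (line i) (repExp 2 1 5 1 1)
  line-cov i = cov-sub ρ-cov (λ _ ())

  -- Orthogonality to (0, 1, 2) says that Z + iW is divisible by -2 + i. By `coset₄-match`, Z² + W²
  -- then becomes 5(A² + B²), which changes the form of `ρ` into that of `τ`.
  line₀ : ∀ N → gf (line-cov 0) N ≡ τ N
  line₀ N = trans (gf-match (line-cov 0) m τ-cov N) (τ≡ N)
    where
    module C = Match coset₄-match
    to from : ℤ × ℤ × ℤ × ℤ → ℤ × ℤ × ℤ × ℤ
    to (x , y , z , w) = x , y , C.to (G.coord (z , w))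
    from (x , y , z , w) = x , y , G.embed 4 (C.from (z , w))
    4<5 : 4 ℕ.< 5
    4<5 = s≤s (s≤s (s≤s (s≤s (s≤s z≤n))))
    rearrange : ∀ a b p s → + 2 + s ≡ p → + 4 + (a + b + s) ≡ + 2 + (a + b + p)
    rearrange a b p s refl = lemma a b s
      where
      lemma : ∀ a b s → + 4 + (a + b + s) ≡ + 2 + (a + b + (+ 2 + s))
      lemma = solve-∀
    m : Match (line 0) (repExp 2 1 5 1 1) (λ _ → 1ℤ) (repExp 4 1 5 5 5)
    m = record { to = to ; from = from ; to-ok = to-ok ; from-ok = from-ok }
      where
      to-ok : ∀ i → line 0 i ≢ 0ℤ → 1ℤ ≡ line 0 i × repExp 4 1 5 5 5 (to i) ≡ repExp 2 1 5 1 1 i × from (to i) ≡ i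
      to-ok (x , y , z , w) nz = sym (𝟙-yes (_ ℕP.≟ 4) c≡4) ,
          rearrange (triExp 1 x) (triExp 5 y) (pairExp (z , w)) _ (trans (proj₁ (proj₂ (C.to-ok (G.coord (z , w)) (λ ())))) (cong pairExp back)) ,
          cong (λ p → x , y , p) (trans (cong (G.embed 4) (proj₂ (proj₂ (C.to-ok (G.coord (z , w)) (λ ()))))) back)
        where
        c≡4 : (z + + 2 * w) ℤDM.%ℕ 5 ≡ 4
        c≡4 = 𝟙-≢0 ((z + + 2 * w) ℤDM.%ℕ 5 ℕP.≟ 4) nz
        back : G.embed 4 (G.coord (z , w)) ≡ (z , w)
        back = trans (cong (λ c → G.embed c (G.coord (z , w))) (sym c≡4)) (G.embed-coord (z , w))
      from-ok : ∀ j → 1ℤ ≢ 0ℤ → line 0 (from j) ≡ 1ℤ × to (from j) ≡ j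
      from-ok (x , y , z , w) _ = 𝟙-yes (_ ℕP.≟ 4) (G.class-embed 4 (C.from (z , w)) 4<5) ,
        cong (λ p → x , y , p) (trans (cong C.to (G.coord-embed 4 (C.from (z , w)) 4<5)) (proj₂ (C.from-ok (z , w) (λ ()))))

  -- Permutations of x, z, w and the sign change w ↦ 1 - w preserve the form and carry each of the
  -- six lines to the first one.
  lines : ∀ i → i ℕ.< 6 → ∀ N → gf (line-cov i) N ≡ τ N
  lines i i< N = trans (gf-match (line-cov i) (m i i<) (line-cov 0) N) (line₀ N)
    where
    reflect : ∀ x → twoTri (1ℤ - x) ≡ twoTri x
    reflect = lemma
      where
      lemma : ∀ x → (1ℤ - x) * (1ℤ - x - 1ℤ) ≡ x * (x - 1ℤ)
      lemma = solve-∀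
    invol : ∀ x → 1ℤ - (1ℤ - x) ≡ x
    invol = solve-∀
    swap₁ : ∀ a b c d → + 2 + (+ 1 * d + + 5 * b + (+ 1 * a + + 1 * c)) ≡ + 2 + (+ 1 * a + + 5 * b + (+ 1 * c + + 1 * d))
    swap₁ = solve-∀
    swap₂ : ∀ a b c d → + 2 + (+ 1 * c + + 5 * b + (+ 1 * a + + 1 * d)) ≡ + 2 + (+ 1 * a + + 5 * b + (+ 1 * c + + 1 * d))
    swap₂ = solve-∀
    m : ∀ i → i ℕ.< 6 → Match (line i) (repExp 2 1 5 1 1) (line 0) (repExp 2 1 5 1 1)
    m 0 _ = bijection-match id id (λ _ → refl) (λ _ → refl) (λ _ → refl) (λ _ → refl)
    m 1 _ = bijection-match (λ (x , y , z , w) → x , y , z , 1ℤ - w) (λ (x , y , z , w) → x , y , z , 1ℤ - w) (λ _ → refl)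
      (λ (x , y , z , w) → cong (λ v → + 2 + (triExp 1 x + triExp 5 y + (triExp 1 z + + 1 * v))) (reflect w))
      (λ (x , y , z , w) → cong (λ v → x , y , z , v) (invol w)) (λ (x , y , z , w) → cong (λ v → x , y , z , v) (invol w))
    m 2 _ = bijection-match (λ (x , y , z , w) → w , y , x , z) (λ (w , y , x , z) → x , y , z , w) (λ _ → refl)
      (λ (x , y , z , w) → swap₁ (twoTri x) (twoTri y) (twoTri z) (twoTri w)) (λ _ → refl) (λ _ → refl)
    m 3 _ = bijection-match (λ (x , y , z , w) → w , y , x , 1ℤ - z) (λ (w , y , x , z) → x , y , 1ℤ - z , w) (λ _ → refl)
      (λ (x , y , z , w) → trans (cong (λ v → + 2 + (triExp 1 w + triExp 5 y + (triExp 1 x + + 1 * v))) (reflect z)) (swap₁ (twoTri x) (twoTri y) (twoTri z) (twoTri w)))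
      (λ (x , y , z , w) → cong (λ v → x , y , v , w) (invol z)) (λ (w , y , x , z) → cong (λ v → w , y , x , v) (invol z))
    m 4 _ = bijection-match (λ (x , y , z , w) → z , y , x , w) (λ (z , y , x , w) → x , y , z , w) (λ _ → refl)
      (λ (x , y , z , w) → swap₂ (twoTri x) (twoTri y) (twoTri z) (twoTri w)) (λ _ → refl) (λ _ → refl)
    m 5 _ = bijection-match (λ (x , y , z , w) → z , y , x , 1ℤ - w) (λ (z , y , x , w) → x , y , z , 1ℤ - w) (λ _ → refl)
      (λ (x , y , z , w) → trans (cong (λ v → + 2 + (triExp 1 z + triExp 5 y + (triExp 1 x + + 1 * v))) (reflect w)) (swap₂ (twoTri x) (twoTri y) (twoTri z) (twoTri w)))
      (λ (x , y , z , w) → cong (λ v → x , y , z , v) (invol w)) (λ (z , y , x , w) → cong (λ v → z , y , x , v) (invol w))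
    m (suc (suc (suc (suc (suc (suc _)))))) (s≤s (s≤s (s≤s (s≤s (s≤s (s≤s ()))))))

  %-shift : ∀ a K → (+ a + K * + 5) ℤDM.%ℕ 5 ≡ a ℕ.% 5
  %-shift a K = mod-eq ((+ a + K * + 5) ℤDM.%ℕ 5) a (K - (+ a + K * + 5) ℤDM./ℕ 5) (ℤDM.n%ℕd<d (+ a + K * + 5) 5)
      (trans (lemma (+ ((+ a + K * + 5) ℤDM.%ℕ 5)) ((+ a + K * + 5) ℤDM./ℕ 5) K) (trans (cong (_- (+ a + K * + 5) ℤDM./ℕ 5 * + 5) (sym (ℤDM.a≡a%ℕn+[a/ℕn]*n (+ a + K * + 5) 5)))
        (lemma₂ (+ a) K ((+ a + K * + 5) ℤDM./ℕ 5))))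
    where
    lemma : ∀ r q K → r ≡ r + q * + 5 - q * + 5
    lemma = solve-∀
    lemma₂ : ∀ a K q → a + K * + 5 - q * + 5 ≡ a + (K - q) * + 5
    lemma₂ = solve-∀
    mod-eq : ∀ r a K → r ℕ.< 5 → + r ≡ + a + K * + 5 → r ≡ a ℕ.% 5
    mod-eq r a K r< e = trans (sym (ℕDM.m<n⇒m%n≡m r<)) (mod5 r a K e)

  -- Each vector whose norm is a nonzero square mod 5 is orthogonal to exactly two of the six lines.
  lineCount : ℕ → ℕ → ℕ → ℤ
  lineCount x z w = e z w + (e′ z w + (e x z + (e′ x z + (e x w + (e′ x w + 0ℤ)))))
    where
    e e′ : ℕ → ℕ → ℤ
    e p q = 𝟙 ((p ℕ.+ 2 ℕ.* q) ℕ.% 5 ℕP.≟ 4)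
    e′ p q = 𝟙 ((p ℕ.+ 2 ℕ.+ 3 ℕ.* q) ℕ.% 5 ℕP.≟ 4)

  -- The plane orthogonal to a vector of nonzero norm has, up to squares, that norm as its
  -- discriminant. Since -1 is a square mod 5, the plane contains two isotropic lines when the norm
  -- is a square and none otherwise. The finite check runs over all residues; the tested number is
  -- minus the norm, which is a square together with it.
  two-lines : ∀ (x z w : Fin 5) → (2 ℕ.+ (pronic (Fin.toℕ x) ℕ.+ pronic (Fin.toℕ z) ℕ.+ pronic (Fin.toℕ w))) ℕ.% 5 ≢ 0 →
              (2 ℕ.+ (pronic (Fin.toℕ x) ℕ.+ pronic (Fin.toℕ z) ℕ.+ pronic (Fin.toℕ w))) ℕ.% 5 ≢ 2 →
              (2 ℕ.+ (pronic (Fin.toℕ x) ℕ.+ pronic (Fin.toℕ z) ℕ.+ pronic (Fin.toℕ w))) ℕ.% 5 ≢ 3 →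
              lineCount (Fin.toℕ x) (Fin.toℕ z) (Fin.toℕ w) ≡ + 2
  two-lines = toWitness {a? = FinP.all? λ x → FinP.all? λ z → FinP.all? λ w → ¬? (_ ℕP.≟ 0) →-dec (¬? (_ ℕP.≟ 2) →-dec (¬? (_ ℕP.≟ 3) →-dec (_ ≟ + 2)))} tt

  line-sum : ∀ N i → N ℕ.% 5 ≢ 0 → N ℕ.% 5 ≢ 2 → N ℕ.% 5 ≢ 3 → repExp 2 1 5 1 1 i ≡ + N → sumL (λ c → line c i) (upTo 6) ≡ + 2
  line-sum N (x , y , z , w) n0 n2 n3 e =
      trans (cong₂ _+_ (iso z w) (cong₂ _+_ (iso′ z w) (cong₂ _+_ (iso x z) (cong₂ _+_ (iso′ x z) (cong₂ _+_ (iso x w) (cong (_+ 0ℤ) (iso′ x w)))))))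
        (trans (sym (cong₃ lineCount (toℕ-rem x) (toℕ-rem z) (toℕ-rem w)))
          (two-lines (fin x) (fin z) (fin w) (n0 ∘ trans N≡) (n2 ∘ trans N≡) (n3 ∘ trans N≡)))
    where
    rem : ℤ → ℕ
    rem x = Residue.rem (residue5 x)
    quot : ℤ → ℤ
    quot x = Residue.quot (residue5 x)
    fin : ℤ → Fin 5
    fin x = Fin.fromℕ< (Residue.rem< (residue5 x))
    toℕ-rem : ∀ x → Fin.toℕ (fin x) ≡ rem x
    toℕ-rem x = FinP.toℕ-fromℕ< (Residue.rem< (residue5 x))
    cong₃ : ∀ {A : Set} (f : ℕ → ℕ → ℕ → A) {a b c a′ b′ c′} → a ≡ a′ → b ≡ b′ → c ≡ c′ → f a b c ≡ f a′ b′ c′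
    cong₃ f refl refl refl = refl
    iso : ∀ p q → isotropic p q ≡ 𝟙 ((rem p ℕ.+ 2 ℕ.* rem q) ℕ.% 5 ℕP.≟ 4)
    iso p q = cong (λ v → 𝟙 (v ℕP.≟ 4)) (trans (cong (ℤDM._%ℕ 5) (trans (cong₂ (λ a b → a + + 2 * b) (Residue.eq (residue5 p)) (Residue.eq (residue5 q)))
        (trans (lemma (+ rem p) (quot p) (+ rem q) (quot q)) (cong (λ v → + rem p + v + (quot p + + 2 * quot q) * + 5) (sym (ℤP.pos-* 2 (rem q)))))))
      (%-shift (rem p ℕ.+ 2 ℕ.* rem q) (quot p + + 2 * quot q)))
      where
      lemma : ∀ a s b t → a + s * + 5 + + 2 * (b + t * + 5) ≡ a + + 2 * b + (s + + 2 * t) * + 5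
      lemma = solve-∀
    iso′ : ∀ p q → isotropic p (1ℤ - q) ≡ 𝟙 ((rem p ℕ.+ 2 ℕ.+ 3 ℕ.* rem q) ℕ.% 5 ℕP.≟ 4)
    iso′ p q = cong (λ v → 𝟙 (v ℕP.≟ 4)) (trans (cong (ℤDM._%ℕ 5) (trans (cong₂ (λ a b → a + + 2 * (1ℤ - b)) (Residue.eq (residue5 p)) (Residue.eq (residue5 q)))
        (trans (lemma (+ rem p) (quot p) (+ rem q) (quot q)) (cong (λ v → + rem p + + 2 + v + (quot p - + 2 * quot q - + rem q) * + 5) (sym (ℤP.pos-* 3 (rem q)))))))
      (%-shift (rem p ℕ.+ 2 ℕ.+ 3 ℕ.* rem q) (quot p - + 2 * quot q - + rem q)))
      where
      lemma : ∀ a s b t → a + s * + 5 + + 2 * (1ℤ - (b + t * + 5)) ≡ a + + 2 + + 3 * b + (s - + 2 * t - b) * + 5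
      lemma = solve-∀
    total : ℕ
    total = 2 ℕ.+ (pronic (rem x) ℕ.+ pronic (rem z) ℕ.+ pronic (rem w))
    part : ℤ → ℤ
    part v = + 2 * + rem v * quot v - quot v + + 5 * (quot v * quot v)
    part≡ : ∀ v → twoTri v ≡ + pronic (rem v) + part v * + 5
    part≡ v = trans (cong twoTri (Residue.eq (residue5 v))) (trans (lemma (+ rem v) (quot v)) (cong (_+ part v * + 5) (+pronic (rem v))))
      where
      lemma : ∀ r t → (r + t * + 5) * (r + t * + 5 - 1ℤ) ≡ r * (r - 1ℤ) + (+ 2 * r * t - t + + 5 * (t * t)) * + 5
      lemma = solve-∀
    N≡ : N ℕ.% 5 ≡ (2 ℕ.+ (pronic (Fin.toℕ (fin x)) ℕ.+ pronic (Fin.toℕ (fin z)) ℕ.+ pronic (Fin.toℕ (fin w)))) ℕ.% 5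
    N≡ = trans (mod5 N total (part x + twoTri y + part z + part w) (trans (sym e)
        (trans (cong₃ℤ (part≡ x) (part≡ z) (part≡ w)) (lemma (+ pronic (rem x)) (+ pronic (rem z)) (+ pronic (rem w)) (part x) (part z) (part w) (twoTri y)))))
      (sym (cong₃ (λ a b c → (2 ℕ.+ (pronic a ℕ.+ pronic b ℕ.+ pronic c)) ℕ.% 5) (toℕ-rem x) (toℕ-rem z) (toℕ-rem w)))
      where
      cong₃ℤ : ∀ {a b c a′ b′ c′} → a ≡ a′ → b ≡ b′ → c ≡ c′ →
        + 2 + (+ 1 * a + + 5 * twoTri y + (+ 1 * b + + 1 * c)) ≡ + 2 + (+ 1 * a′ + + 5 * twoTri y + (+ 1 * b′ + + 1 * c′))
      cong₃ℤ refl refl refl = refl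
      lemma : ∀ a b c p q r y → + 2 + (+ 1 * (a + p * + 5) + + 5 * y + (+ 1 * (b + q * + 5) + + 1 * (c + r * + 5))) ≡ + 2 + (a + b + c) + (p + y + q + r) * + 5
      lemma = solve-∀

  -- Pairs of a solution and an isotropic line orthogonal to it are counted twice: six lines with
  -- `τ N` solutions each, and two lines for each solution.
  ρ-triple : ∀ N → N ℕ.% 5 ≢ 0 → N ℕ.% 5 ≢ 2 → N ℕ.% 5 ≢ 3 → ρ N ≡ + 3 * τ N
  ρ-triple N n0 n2 n3 = ℤP.*-cancelˡ-≡ (+ 2) (ρ N) (+ 3 * τ N) (begin
    + 2 * ρ N                            ≡⟨ cong (+ 2 *_) (sym (ρ≡ N)) ⟩
    + 2 * gf ρ-cov N                     ≡⟨ sym (gf-scale (+ 2) ρ-cov twice (λ _ → refl) N) ⟩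
    gf twice N                           ≡⟨ sym (coef-cong all twice N (λ i e → line-sum N i n0 n2 n3 e)) ⟩
    gf all N                             ≡⟨ gf-sums ρ-cov (upTo 6) line-cov all (λ _ _ ()) (λ _ → refl) N ⟩
    sumL (λ i → gf (line-cov i) N) (upTo 6) ≡⟨ cong₂ _+_ (l 0) (cong₂ _+_ (l 1) (cong₂ _+_ (l 2) (cong₂ _+_ (l 3) (cong₂ _+_ (l 4) (cong (_+ 0ℤ) (l 5)))))) ⟩
    τ N + (τ N + (τ N + (τ N + (τ N + (τ N + 0ℤ))))) ≡⟨ lemma (τ N) ⟩
    + 2 * (+ 3 * τ N)                    ∎)
    where
    open ≡-Reasoning
    twice : Cov (λ _ → + 2 * 1ℤ) (repExp 2 1 5 1 1)
    twice = cov-sub ρ-cov (λ _ ())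
    all : Cov (λ i → sumL (λ c → line c i) (upTo 6)) (repExp 2 1 5 1 1)
    all = cov-sub ρ-cov (λ _ ())
    l : ∀ i {i< : True (i ℕP.<? 6)} → gf (line-cov i) N ≡ τ N
    l i {i<} = lines i (toWitness i<) N
    lemma : ∀ t → t + (t + (t + (t + (t + (t + 0ℤ))))) ≡ + 2 * (+ 3 * t)
    lemma = solve-∀

  -- Divisor sums as sums over factorisations.

  -- Sums over the factorisations N = x y, indexed by (x - 1 , y - 1).
  factorExp : ℕ × ℕ → ℤ
  factorExp (i , j) = + (suc i ℕ.* suc j)

  opaque
    factor-cov : ∀ {w} → Cov w factorExp
    factor-cov = cov-bounded (enum× enumℕ enumℕ) λ (i , j) _ →
      i ℕ.+ j , _ , ℕP.≤-trans (ℕP.m⊔n≤m+n i j) (ℕP.n≤1+n _) , trans (ℤP.pos-* (suc i) (suc j)) (lemma (+ i) (+ j)) , nn 1 ⊹ nn i ⊠ nn j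
      where
      lemma : ∀ i j → (1ℤ + i) * (1ℤ + j) ≡ i + j + (1ℤ + i * j)
      lemma = solve-∀

  weightOf : (ℕ → ℕ → ℤ) → ℕ × ℕ → ℤ
  weightOf g (i , j) = g (suc i) (suc j)

  factor-family : (g : ℕ → ℕ → ℤ) → Cov (weightOf g) factorExp
  factor-family g = factor-cov

  opaque
    factors : (ℕ → ℕ → ℤ) → ℕ → ℤ
    factors g = gf (factor-family g)

    factors-def : ∀ g N → factors g N ≡ gf (factor-family g) N
    factors-def g N = refl

    factors-cong : ∀ {g h} N → (∀ x y → x ℕ.* y ≡ N → g x y ≡ h x y) → factors g N ≡ factors h N
    factors-cong {g} {h} N e = coef-cong (factor-family g) (factor-family h) N (λ (i , j) p → e (suc i) (suc j) (ℤP.+-injective p))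

    factors-+ : ∀ {f g h} → (∀ x y → f x y ≡ g x y + h x y) → ∀ N → factors f N ≡ factors g N + factors h N
    factors-+ {f} {g} {h} e = gf-sum factor-unit (factor-family g) (factor-family h) (factor-family f) (λ _ ()) (λ _ ()) (λ (i , j) → e (suc i) (suc j))
      where
      factor-unit : Cov (λ _ → 1ℤ) factorExp
      factor-unit = factor-cov

    factors-* : ∀ {g h} k → (∀ x y → g x y ≡ k * h x y) → ∀ N → factors g N ≡ k * factors h N
    factors-* {g} {h} k e = gf-scale k (factor-family h) (factor-family g) (λ (i , j) → e (suc i) (suc j))

    factors-zero : ∀ {g} → (∀ x y → g x y ≡ 0ℤ) → ∀ N → factors g N ≡ 0ℤ
    factors-zero {g} e = gf-zero (factor-family g) (λ (i , j) → e (suc i) (suc j))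

    factors-swap : ∀ g N → factors g N ≡ factors (λ x y → g y x) N
    factors-swap g N = gf-match (factor-family g) (bijection-match (λ (i , j) → j , i) (λ (i , j) → j , i) (λ _ → refl)
      (λ (i , j) → cong +_ (ℕP.*-comm (suc j) (suc i))) (λ _ → refl) (λ _ → refl)) (factor-family (λ x y → g y x)) N

  if-yes : {P A : Set} {a b : A} (d : Dec P) → P → (if does d then a else b) ≡ a
  if-yes (yes _) p = refl
  if-yes (no n)  p = contradiction p n

  if-no : {P A : Set} {a b : A} (d : Dec P) → ¬ P → (if does d then a else b) ≡ b
  if-no (yes p) n = contradiction p n
  if-no (no _)  n = refl

  opaque
    [_∤_]_ : ℕ → ℕ → ℤ → ℤ
    [ p ∤ x ] v = if does (p ℕDiv.∣? x) then 0ℤ else v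

    ∤-yes : ∀ {p x} v → ¬ (p ℕDiv.∣ x) → [ p ∤ x ] v ≡ v
    ∤-yes {p} {x} v = if-no (p ℕDiv.∣? x)

    ∤-no : ∀ {p x} v → p ℕDiv.∣ x → [ p ∤ x ] v ≡ 0ℤ
    ∤-no {p} {x} v = if-yes (p ℕDiv.∣? x)

    ∤-* : ∀ p x k a → [ p ∤ x ] (k * a) ≡ k * [ p ∤ x ] a
    ∤-* p x k a with does (p ℕDiv.∣? x)
    ... | true  = sym (ℤP.*-zeroʳ k)
    ... | false = refl

    ∤-+ : ∀ p x a b → [ p ∤ x ] (a + b) ≡ [ p ∤ x ] a + [ p ∤ x ] b
    ∤-+ p x a b with does (p ℕDiv.∣? x)
    ... | true  = refl
    ... | false = refl

  ∤-zero : ∀ p x → [ p ∤ x ] 0ℤ ≡ 0ℤ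
  ∤-zero p x = ∤-* p x 0ℤ 0ℤ

  ∤-elim : ∀ {p x a b} → (p ℕDiv.∣ x → 0ℤ ≡ b) → (¬ (p ℕDiv.∣ x) → a ≡ b) → [ p ∤ x ] a ≡ b
  ∤-elim {p} {x} {a} f g = decide (p ℕDiv.∣? x)
    where
    decide : Dec (p ℕDiv.∣ x) → [ p ∤ x ] a ≡ _
    decide (yes d) = trans (∤-no a d) (f d)
    decide (no n)  = trans (∤-yes a n) (g n)

  ∤-≢0 : ∀ {p x} v → [ p ∤ x ] v ≢ 0ℤ → ¬ (p ℕDiv.∣ x)
  ∤-≢0 v nz d = nz (∤-no v d)

  -- If p divides the product x y, then it divides x, or else y but not x.
  opaque
    unfolding factors

    factors-prime : ∀ p → Prime (suc p) → ∀ g N →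
      factors g (suc p ℕ.* N) ≡ factors (λ x y → g (suc p ℕ.* x) y) N + factors (λ x y → [ suc p ∤ x ] g x (suc p ℕ.* y)) N
    factors-prime p pr g N = trans (factors-+ {g} {div} {nodiv} split (suc p ℕ.* N)) (cong₂ _+_
        (sym (coef-match (factor-family (λ x y → g (q ℕ.* x) y)) (factor-family div) N (suc p ℕ.* N) up down to-div from-div))
        (sym (coef-match (factor-family (λ x y → [ q ∤ x ] g x (q ℕ.* y))) (factor-family nodiv) N (suc p ℕ.* N) up′ down′ to-nodiv from-nodiv)))
      where
      q : ℕ
      q = suc p
      up down up′ down′ : ℕ × ℕ → ℕ × ℕ
      up (i , j) = ℕ.pred (q ℕ.* suc i) , j
      down (i , j) = ℕ.pred (suc i ℕ./ q) , j
      up′ (i , j) = i , ℕ.pred (q ℕ.* suc j)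
      down′ (i , j) = i , ℕ.pred (suc j ℕ./ q)
      div nodiv : ℕ → ℕ → ℤ
      div x y = g x y - [ q ∤ x ] g x y
      nodiv x y = [ q ∤ x ] g x y
      split : ∀ x y → g x y ≡ div x y + nodiv x y
      split x y = lemma (g x y) ([ q ∤ x ] g x y)
        where
        lemma : ∀ a b → a ≡ a - b + b
        lemma = solve-∀
      div-yes : ∀ x y → q ℕDiv.∣ x → div x y ≡ g x y
      div-yes x y d = trans (cong (λ z → g x y - z) (∤-no (g x y) d)) (ℤP.+-identityʳ (g x y))
      div-∣ : ∀ x y → div x y ≢ 0ℤ → q ℕDiv.∣ x
      div-∣ x y nz = decide (q ℕDiv.∣? x)
        where
        decide : Dec (q ℕDiv.∣ x) → q ℕDiv.∣ x
        decide (yes d) = d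
        decide (no n)  = contradiction (trans (cong (λ z → g x y - z) (∤-yes (g x y) n)) (ℤP.+-inverseʳ (g x y))) nz
      exact : ∀ n → q ℕDiv.∣ suc n → q ℕ.* suc (ℕ.pred (suc n ℕ./ q)) ≡ suc n
      exact n d@(ℕDiv.divides (suc k) e) = trans (cong (λ z → q ℕ.* suc (ℕ.pred z)) (trans (cong (ℕ._/ q) e) (ℕDM.m*n/n≡m (suc k) q))) (trans (ℕP.*-comm q (suc k)) (sym e))
      cancel-pred : ∀ i → ℕ.pred (suc (ℕ.pred (q ℕ.* suc i)) ℕ./ q) ≡ i
      cancel-pred i = cong ℕ.pred (trans (cong (ℕ._/ q) (ℕP.*-comm q (suc i))) (ℕDM.m*n/n≡m (suc i) q))
      to-div : ∀ i → weightOf (λ x y → g (q ℕ.* x) y) i ≢ 0ℤ → factorExp i ≡ + N → weightOf div (up i) ≡ weightOf (λ x y → g (q ℕ.* x) y) i × factorExp (up i) ≡ + (q ℕ.* N) × down (up i) ≡ i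
      to-div (i , j) _ e = div-yes (q ℕ.* suc i) (suc j) (ℕDiv.m∣m*n (suc i)) ,
        cong +_ (trans (ℕP.*-assoc q (suc i) (suc j)) (cong (q ℕ.*_) (ℤP.+-injective e))) , cong (_, j) (cancel-pred i)
      from-div : ∀ j → weightOf div j ≢ 0ℤ → factorExp j ≡ + (q ℕ.* N) → weightOf (λ x y → g (q ℕ.* x) y) (down j) ≡ weightOf div j × factorExp (down j) ≡ + N × up (down j) ≡ j
      from-div (i , j) nz e = trans (cong (λ z → g z (suc j)) ex) (sym (div-yes (suc i) (suc j) d)) ,
          cong +_ (ℕP.*-cancelˡ-≡ _ N q (trans (sym (ℕP.*-assoc q (suc (ℕ.pred (suc i ℕ./ q))) (suc j))) (trans (cong (ℕ._* suc j) ex) (ℤP.+-injective e)))) ,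
          cong (λ z → ℕ.pred z , j) ex
        where
        d : q ℕDiv.∣ suc i
        d = div-∣ (suc i) (suc j) nz
        ex : q ℕ.* suc (ℕ.pred (suc i ℕ./ q)) ≡ suc i
        ex = exact i d
      to-nodiv : ∀ i → weightOf (λ x y → [ q ∤ x ] g x (q ℕ.* y)) i ≢ 0ℤ → factorExp i ≡ + N → weightOf nodiv (up′ i) ≡ weightOf (λ x y → [ q ∤ x ] g x (q ℕ.* y)) i × factorExp (up′ i) ≡ + (q ℕ.* N) × down′ (up′ i) ≡ i
      to-nodiv (i , j) _ e = refl ,
        cong +_ (trans (trans (sym (ℕP.*-assoc (suc i) q (suc j))) (trans (cong (ℕ._* suc j) (ℕP.*-comm (suc i) q)) (ℕP.*-assoc q (suc i) (suc j)))) (cong (q ℕ.*_) (ℤP.+-injective e))) ,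
        cong (i ,_) (cancel-pred j)
      from-nodiv : ∀ j → weightOf nodiv j ≢ 0ℤ → factorExp j ≡ + (q ℕ.* N) → weightOf (λ x y → [ q ∤ x ] g x (q ℕ.* y)) (down′ j) ≡ weightOf nodiv j × factorExp (down′ j) ≡ + N × up′ (down′ j) ≡ j
      from-nodiv (i , j) nz e = cong (λ z → [ q ∤ suc i ] g (suc i) z) ex ,
          cong +_ (ℕP.*-cancelˡ-≡ _ N q (trans (shuffle (suc i) (suc (ℕ.pred (suc j ℕ./ q)))) (trans (cong (suc i ℕ.*_) ex) (ℤP.+-injective e)))) ,
          cong (λ z → i , ℕ.pred z) ex
        where
        shuffle : ∀ a b → q ℕ.* (a ℕ.* b) ≡ a ℕ.* (q ℕ.* b)
        shuffle a b = trans (sym (ℕP.*-assoc q a b)) (trans (cong (ℕ._* b) (ℕP.*-comm q a)) (ℕP.*-assoc a q b))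
        d : q ℕDiv.∣ suc j
        d with euclidsLemma (suc i) (suc j) pr (subst (q ℕDiv.∣_) (sym (ℤP.+-injective e)) (ℕDiv.m∣m*n N))
        ... | inj₁ x = contradiction x (∤-≢0 (g (suc i) (suc j)) nz)
        ... | inj₂ y = y
        ex : q ℕ.* suc (ℕ.pred (suc j ℕ./ q)) ≡ suc j
        ex = exact j d

  factors-prime′ : ∀ p → Prime (suc p) → ∀ g N →
    factors g (suc p ℕ.* N) ≡ factors (λ x y → g x (suc p ℕ.* y)) N + factors (λ x y → [ suc p ∤ y ] g (suc p ℕ.* x) y) N
  factors-prime′ p pr g N = trans (factors-swap g (suc p ℕ.* N)) (trans (factors-prime p pr (λ x y → g y x) N)
    (cong₂ _+_ (factors-swap (λ x y → g y (suc p ℕ.* x)) N) (factors-swap (λ x y → [ suc p ∤ x ] g (suc p ℕ.* y) x) N)))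

  -- The quadratic character mod 5 and the divisor sums of the theorem.

  χ₅ : ℕ → ℤ
  χ₅ 0 = 0ℤ
  χ₅ 1 = 1ℤ
  χ₅ 2 = -1ℤ
  χ₅ 3 = -1ℤ
  χ₅ 4 = 1ℤ
  χ₅ (suc (suc (suc (suc (suc _))))) = 0ℤ

  -- The symbol (n/5). Its equality with (5/n) is quadratic reciprocity, supplied by `kronecker≡χ`.
  χ : ℕ → ℤ
  χ n = χ₅ (n ℕ.% 5)

  χ-* : ∀ m n → χ (m ℕ.* n) ≡ χ m * χ n
  χ-* m n = trans (cong χ₅ (ℕDM.%-distribˡ-* m n 5)) (trans (sym (cong₂ (λ a b → χ₅ ((a ℕ.* b) ℕ.% 5)) (FinP.toℕ-fromℕ< (ℕDM.m%n<n m 5)) (FinP.toℕ-fromℕ< (ℕDM.m%n<n n 5))))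
    (trans (table (Fin.fromℕ< (ℕDM.m%n<n m 5)) (Fin.fromℕ< (ℕDM.m%n<n n 5))) (cong₂ (λ a b → χ₅ a * χ₅ b) (FinP.toℕ-fromℕ< (ℕDM.m%n<n m 5)) (FinP.toℕ-fromℕ< (ℕDM.m%n<n n 5)))))
    where
    table : ∀ (a b : Fin 5) → χ₅ ((Fin.toℕ a ℕ.* Fin.toℕ b) ℕ.% 5) ≡ χ₅ (Fin.toℕ a) * χ₅ (Fin.toℕ b)
    table = toWitness {a? = FinP.all? λ a → FinP.all? λ b → _ ≟ _} tt

  2-prime : Prime 2
  2-prime = prime[2]

  5-prime : Prime 5
  5-prime = toWitness {a? = prime? 5} tt

  -- Because χ 2 = -1, doubling x or y exchanges `u` with the function `v`, which has the opposite
  -- sign between the characters, up to a factor -1 or 2. All powers of 2 are handled by this pair.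
  u s-weight s₂-weight : ℕ → ℕ → ℤ
  u x y = + y * (χ x - χ y)
  s-weight x y = [ 2 ∤ x ] (+ y * χ x)
  s₂-weight x y = [ 2 ∤ x ] (+ y * χ y)

  v : ℕ → ℕ → ℤ
  v x y = + y * (χ x + χ y)

  ∤-cong : ∀ p x {a b} → a ≡ b → [ p ∤ x ] a ≡ [ p ∤ x ] b
  ∤-cong p x refl = refl

  u-2x : ∀ x y → u (2 ℕ.* x) y ≡ -1ℤ * v x y
  u-2x x y = trans (cong (λ z → + y * (z - χ y)) (χ-* 2 x)) (lemma (+ y) (χ x) (χ y))
    where
    lemma : ∀ y a b → y * (-1ℤ * a - b) ≡ -1ℤ * (y * (a + b))
    lemma = solve-∀

  u-2y : ∀ x y → u x (2 ℕ.* y) ≡ + 2 * v x y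
  u-2y x y = trans (cong₂ (λ n z → n * (χ x - z)) (ℤP.pos-* 2 y) (χ-* 2 y)) (lemma (+ y) (χ x) (χ y))
    where
    lemma : ∀ y a b → + 2 * y * (a - -1ℤ * b) ≡ + 2 * (y * (a + b))
    lemma = solve-∀

  v-2x : ∀ x y → v (2 ℕ.* x) y ≡ -1ℤ * u x y
  v-2x x y = trans (cong (λ z → + y * (z + χ y)) (χ-* 2 x)) (lemma (+ y) (χ x) (χ y))
    where
    lemma : ∀ y a b → y * (-1ℤ * a + b) ≡ -1ℤ * (y * (a - b))
    lemma = solve-∀

  v-2y : ∀ x y → v x (2 ℕ.* y) ≡ + 2 * u x y
  v-2y x y = trans (cong₂ (λ n z → n * (χ x + z)) (ℤP.pos-* 2 y) (χ-* 2 y)) (lemma (+ y) (χ x) (χ y))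
    where
    lemma : ∀ y a b → + 2 * y * (a + -1ℤ * b) ≡ + 2 * (y * (a - b))
    lemma = solve-∀

  -- The summand of the theorem, for the factorisation x y with divisor y.
  summand : ℕ → ℕ → ℤ
  summand x y = sgnPow y * (χ y + χ x) * + y

  -- A quarter of the theorem's right-hand side, at M = n + 2.
  K : ℕ → ℤ
  K = factors (λ x y → [ 2 ∤ x ] u x y)

  -- For y = 2y′ the sign is 1 and χ 2 = -1 gives χ x - χ y′. For odd y the cofactor is x = 2x′, and
  -- the sign -1 together with χ 2 = -1 gives χ x′ - χ y. Both are terms of `u`.
  summand-even : ∀ N → factors summand (2 ℕ.* N) ≡ + 2 * factors u N + factors (λ x y → [ 2 ∤ y ] u x y) N
  summand-even N = trans (factors-prime′ 1 2-prime summand N) (cong₂ _+_ (factors-* (+ 2) even N) (factors-cong N (λ x y _ → odd x y)))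
    where
    sgn-even : ∀ y → 2 ℕDiv.∣ y → sgnPow y ≡ 1ℤ
    sgn-even y = if-yes (2 ℕDiv.∣? y)
    sgn-odd : ∀ y → ¬ (2 ℕDiv.∣ y) → sgnPow y ≡ -1ℤ
    sgn-odd y = if-no (2 ℕDiv.∣? y)
    even : ∀ x y → summand x (2 ℕ.* y) ≡ + 2 * u x y
    even x y = trans (cong₂ (λ s z → s * (z + χ x) * + (2 ℕ.* y)) (sgn-even (2 ℕ.* y) (ℕDiv.m∣m*n y)) (χ-* 2 y))
      (trans (cong (λ n → 1ℤ * (-1ℤ * χ y + χ x) * n) (ℤP.pos-* 2 y)) (lemma (+ y) (χ x) (χ y)))
      where
      lemma : ∀ y a b → 1ℤ * (-1ℤ * b + a) * (+ 2 * y) ≡ + 2 * (y * (a - b))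
      lemma = solve-∀
    odd : ∀ x y → [ 2 ∤ y ] summand (2 ℕ.* x) y ≡ [ 2 ∤ y ] u x y
    odd x y = ∤-elim (λ d → sym (∤-no (u x y) d)) λ n → trans (trans (cong₂ (λ s z → s * (χ y + z) * + y) (sgn-odd y n) (χ-* 2 x)) (lemma (+ y) (χ x) (χ y))) (sym (∤-yes (u x y) n))
      where
      lemma : ∀ y a b → -1ℤ * (b + -1ℤ * a) * y ≡ y * (a - b)
      lemma = solve-∀

  odd-y-double : ∀ (g : ℕ → ℕ → ℤ) N → factors (λ x y → [ 2 ∤ y ] g x y) (2 ℕ.* N) ≡ factors (λ x y → [ 2 ∤ y ] g (2 ℕ.* x) y) N
  odd-y-double g N = trans (factors-prime′ 1 2-prime (λ x y → [ 2 ∤ y ] g x y) N) (trans (cong₂ _+_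
      (factors-zero (λ x y → ∤-no (g x (2 ℕ.* y)) (ℕDiv.m∣m*n y)) N)
      (factors-cong N (λ x y _ → twice y (g (2 ℕ.* x) y)))) (ℤP.+-identityˡ _))
    where
    twice : ∀ y a → [ 2 ∤ y ] ([ 2 ∤ y ] a) ≡ [ 2 ∤ y ] a
    twice y a = ∤-elim (λ d → sym (∤-no a d)) (λ _ → refl)

  odd-x-double : ∀ (g : ℕ → ℕ → ℤ) N → factors (λ x y → [ 2 ∤ x ] g x y) (2 ℕ.* N) ≡ factors (λ x y → [ 2 ∤ x ] g x (2 ℕ.* y)) N
  odd-x-double g N = trans (factors-swap (λ x y → [ 2 ∤ x ] g x y) (2 ℕ.* N)) (trans (odd-y-double (λ x y → g y x) N)
    (factors-swap (λ x y → [ 2 ∤ y ] g y (2 ℕ.* x)) N))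

  -- With y odd, each factor 2 must go into x and costs χ 2 = -1; two such factors cost nothing.
  o-quadruple : ∀ N → factors (λ x y → [ 2 ∤ y ] u x y) (2 ℕ.* (2 ℕ.* N)) ≡ factors (λ x y → [ 2 ∤ y ] u x y) N
  o-quadruple N = begin
    factors (λ x y → [ 2 ∤ y ] u x y) (2 ℕ.* (2 ℕ.* N)) ≡⟨ odd-y-double u (2 ℕ.* N) ⟩
    factors (λ x y → [ 2 ∤ y ] u (2 ℕ.* x) y) (2 ℕ.* N)
      ≡⟨ factors-* {h = λ x y → [ 2 ∤ y ] v x y} -1ℤ (λ x y → trans (∤-cong 2 y (u-2x x y)) (∤-* 2 y -1ℤ (v x y))) (2 ℕ.* N) ⟩
    -1ℤ * factors (λ x y → [ 2 ∤ y ] v x y) (2 ℕ.* N) ≡⟨ cong (-1ℤ *_) (odd-y-double v N) ⟩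
    -1ℤ * factors (λ x y → [ 2 ∤ y ] v (2 ℕ.* x) y) N
      ≡⟨ cong (-1ℤ *_) (factors-* {h = λ x y → [ 2 ∤ y ] u x y} -1ℤ (λ x y → trans (∤-cong 2 y (v-2x x y)) (∤-* 2 y -1ℤ (u x y))) N) ⟩
    -1ℤ * (-1ℤ * factors (λ x y → [ 2 ∤ y ] u x y) N) ≡⟨ lemma _ ⟩
    factors (λ x y → [ 2 ∤ y ] u x y) N ∎
    where
    open ≡-Reasoning
    lemma : ∀ a → -1ℤ * (-1ℤ * a) ≡ a
    lemma = solve-∀

  -- A factor 2 goes into x or, if x is odd, into y. Two factors into x restore `u`; the two ways of
  -- ending with odd x contribute -2 `K` and 4 `K`.
  k-quadruple : ∀ N → factors u (2 ℕ.* (2 ℕ.* N)) ≡ factors u N + + 2 * K N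
  k-quadruple N = begin
    factors u (2 ℕ.* (2 ℕ.* N)) ≡⟨ factors-prime 1 2-prime u (2 ℕ.* N) ⟩
    factors (λ x y → u (2 ℕ.* x) y) (2 ℕ.* N) + factors (λ x y → [ 2 ∤ x ] u x (2 ℕ.* y)) (2 ℕ.* N)
      ≡⟨ cong₂ _+_ (factors-* {h = v} -1ℤ u-2x (2 ℕ.* N))
           (factors-* {h = λ x y → [ 2 ∤ x ] v x y} (+ 2) (λ x y → trans (∤-cong 2 x (u-2y x y)) (∤-* 2 x (+ 2) (v x y))) (2 ℕ.* N)) ⟩
    -1ℤ * factors v (2 ℕ.* N) + + 2 * factors (λ x y → [ 2 ∤ x ] v x y) (2 ℕ.* N)
      ≡⟨ cong₂ (λ a b → -1ℤ * a + + 2 * b) V (trans (odd-x-double v N) V′) ⟩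
    -1ℤ * (-1ℤ * factors u N + + 2 * K N) + + 2 * (+ 2 * K N) ≡⟨ lemma (factors u N) (K N) ⟩
    factors u N + + 2 * K N ∎
    where
    open ≡-Reasoning
    lemma : ∀ a b → -1ℤ * (-1ℤ * a + + 2 * b) + + 2 * (+ 2 * b) ≡ a + + 2 * b
    lemma = solve-∀
    V′ : factors (λ x y → [ 2 ∤ x ] v x (2 ℕ.* y)) N ≡ + 2 * K N
    V′ = factors-* {h = λ x y → [ 2 ∤ x ] u x y} (+ 2) (λ x y → trans (∤-cong 2 x (v-2y x y)) (∤-* 2 x (+ 2) (u x y))) N
    V : factors v (2 ℕ.* N) ≡ -1ℤ * factors u N + + 2 * K N
    V = trans (factors-prime 1 2-prime v N) (cong₂ _+_ (factors-* {h = u} -1ℤ v-2x N) V′)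

  summand-difference : ∀ M → factors summand (2 ℕ.* (2 ℕ.* (2 ℕ.* M))) - factors summand (2 ℕ.* M) ≡ + 4 * K M
  summand-difference M = trans (cong₂ _-_ (trans (summand-even (2 ℕ.* (2 ℕ.* M))) (cong₂ (λ a b → + 2 * a + b) (k-quadruple M) (o-quadruple M))) (summand-even M))
      (lemma (factors u M) (K M) (factors (λ x y → [ 2 ∤ y ] u x y) M))
    where
    lemma : ∀ a b o → + 2 * (a + + 2 * b) + o - (+ 2 * a + o) ≡ + 4 * b
    lemma = solve-∀

  s s₂ : ℕ → ℤ
  s = factors s-weight
  s₂ = factors s₂-weight

  K≡ : ∀ N → K N ≡ s N - s₂ N
  K≡ N = trans (factors-+ {h = λ x y → -1ℤ * s₂-weight x y} split N) (+-congʳ (s N) (trans (factors-* {h = s₂-weight} -1ℤ (λ _ _ → refl) N) (ℤP.-1*i≡-i (s₂ N))))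
    where
    split : ∀ x y → [ 2 ∤ x ] u x y ≡ s-weight x y + -1ℤ * s₂-weight x y
    split x y = trans (∤-cong 2 x (lemma (+ y) (χ x) (χ y))) (trans (∤-+ 2 x (+ y * χ x) (-1ℤ * (+ y * χ y))) (+-congʳ (s-weight x y) (∤-* 2 x -1ℤ (+ y * χ y))))
      where
      lemma : ∀ y a b → y * (a - b) ≡ y * a + -1ℤ * (y * b)
      lemma = solve-∀

  χ-5 : ∀ x → χ (5 ℕ.* x) ≡ 0ℤ
  χ-5 x = χ-* 5 x

  -- χ vanishes on multiples of 5. For `s` the factor 5 must therefore go into y, where it
  -- multiplies the term by 5; for `s₂` it goes into x and changes nothing.
  s-5 : ∀ N → s (5 ℕ.* N) ≡ + 5 * s N
  s-5 N = trans (factors-prime 4 5-prime s-weight N) (trans (cong₂ _+_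
      (factors-zero (λ x y → trans (∤-cong 2 (5 ℕ.* x) (trans (cong (+ y *_) (χ-5 x)) (ℤP.*-zeroʳ (+ y)))) (∤-zero 2 (5 ℕ.* x))) N)
      (factors-* {h = s-weight} (+ 5) five N)) (ℤP.+-identityˡ _))
    where
    scale : ∀ y a → + (5 ℕ.* y) * a ≡ + 5 * (+ y * a)
    scale y a = trans (cong (_* a) (ℤP.pos-* 5 y)) (ℤP.*-assoc (+ 5) (+ y) a)
    five : ∀ x y → [ 5 ∤ x ] s-weight x (5 ℕ.* y) ≡ + 5 * s-weight x y
    five x y = ∤-elim div (λ _ → trans (∤-cong 2 x (scale y (χ x))) (∤-* 2 x (+ 5) (+ y * χ x)))
      where
      div : 5 ℕDiv.∣ x → 0ℤ ≡ + 5 * s-weight x y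
      div (ℕDiv.divides k refl) = sym (trans (cong (+ 5 *_) (trans (∤-cong 2 (k ℕ.* 5) (trans (cong (λ z → + y * χ z) (ℕP.*-comm k 5)) (trans (cong (+ y *_) (χ-5 k)) (ℤP.*-zeroʳ (+ y))))) (∤-zero 2 (k ℕ.* 5)))) refl)

  s₂-5 : ∀ N → s₂ (5 ℕ.* N) ≡ s₂ N
  s₂-5 N = trans (factors-prime′ 4 5-prime s₂-weight N) (trans (cong₂ _+_
      (factors-zero (λ x y → trans (∤-cong 2 x (trans (cong (+ (5 ℕ.* y) *_) (χ-5 y)) (ℤP.*-zeroʳ (+ (5 ℕ.* y))))) (∤-zero 2 x)) N)
      (factors-cong N (λ x y _ → one x y))) (ℤP.+-identityˡ _))
    where
    parity : ∀ x a → [ 2 ∤ 5 ℕ.* x ] a ≡ [ 2 ∤ x ] a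
    parity x a = sym (∤-elim (λ d → sym (∤-no a (ℕDiv.∣n⇒∣m*n 5 d))) λ n → sym (∤-yes a λ d → [ (λ e → contradiction e (toWitness {a? = ¬? (2 ℕDiv.∣? 5)} tt)) , n ]′ (euclidsLemma 5 x 2-prime d)))
    one : ∀ x y → [ 5 ∤ y ] s₂-weight (5 ℕ.* x) y ≡ s₂-weight x y
    one x y = ∤-elim div (λ _ → parity x (+ y * χ y))
      where
      div : 5 ℕDiv.∣ y → 0ℤ ≡ s₂-weight x y
      div (ℕDiv.divides k refl) = sym (trans (∤-cong 2 x (trans (cong (+ (k ℕ.* 5) *_) (trans (cong χ (ℕP.*-comm k 5)) (χ-5 k))) (ℤP.*-zeroʳ (+ (k ℕ.* 5))))) (∤-zero 2 x))

  χ-square : ∀ x y → χ x * χ y ≢ 0ℤ → χ y ≡ χ (x ℕ.* y) * χ x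
  χ-square x y nz = trans (lemma (χ y) (χ x * χ x) (square (ℕDM.m%n<n x 5) (≢0-*ˡ {χ x} nz))) (trans (rearrange (χ x) (χ y)) (cong (_* χ x) (sym (χ-* x y))))
    where
    rearrange : ∀ a b → b * (a * a) ≡ a * b * a
    rearrange = solve-∀
    lemma : ∀ a b → b ≡ 1ℤ → a ≡ a * b
    lemma a _ refl = sym (ℤP.*-identityʳ a)
    square : ∀ {r} → r ℕ.< 5 → χ₅ r ≢ 0ℤ → χ₅ r * χ₅ r ≡ 1ℤ
    square {0} _ nz = contradiction refl nz
    square {1} _ _ = refl
    square {2} _ _ = refl
    square {3} _ _ = refl
    square {4} _ _ = refl
    square {suc (suc (suc (suc (suc _))))} _ nz = contradiction refl nz

  -- If 5 does not divide N = x y, then χ x = ±1, so χ y = χ N · χ x for every factorisation.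
  s₂≡ : ∀ N → χ N ≢ 0ℤ → s₂ N ≡ χ N * s N
  s₂≡ N nz = trans (factors-cong N e) (factors-* {λ x y → χ N * s-weight x y} {s-weight} (χ N) (λ _ _ → refl) N)
    where
    e : ∀ x y → x ℕ.* y ≡ N → s₂-weight x y ≡ χ N * s-weight x y
    e x y refl = trans (∤-cong 2 x (trans (cong (+ y *_) (χ-square x y (λ z → nz (trans (χ-* x y) z)))) (lemma (+ y) (χ (x ℕ.* y)) (χ x)))) (∤-* 2 x (χ (x ℕ.* y)) (+ y * χ x))
      where
      lemma : ∀ y c a → y * (c * a) ≡ c * (y * a)
      lemma = solve-∀

  -- The Gauss sum in the group ring and Euler's criterion.

  absorption : ∀ n k → suc k ℕ.* (suc n choose suc k) ≡ suc n ℕ.* (n choose k)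
  absorption zero    zero    = refl
  absorption zero    (suc k) = ℕP.*-zeroʳ k
  absorption (suc n) zero    = begin
    1 ℕ.* (suc (suc n) choose 1)           ≡⟨ cong (1 ℕ.*_) (sym (nCk+nC[k+1]≡[n+1]C[k+1] (suc n) 0)) ⟩
    1 ℕ.* (1 ℕ.+ (suc n choose 1))         ≡⟨ lemma (suc n choose 1) ⟩
    1 ℕ.+ 1 ℕ.* (suc n choose 1)           ≡⟨ cong (1 ℕ.+_) (absorption n 0) ⟩
    1 ℕ.+ suc n ℕ.* 1                 ∎
    where
    open ≡-Reasoning
    lemma : ∀ c → 1 ℕ.* (1 ℕ.+ c) ≡ 1 ℕ.+ 1 ℕ.* c
    lemma = ℕSolver.solve-∀
  absorption (suc n) (suc k) = begin
    suc (suc k) ℕ.* (suc (suc n) choose suc (suc k))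
      ≡⟨ cong (suc (suc k) ℕ.*_) (sym (nCk+nC[k+1]≡[n+1]C[k+1] (suc n) (suc k))) ⟩
    suc (suc k) ℕ.* ((suc n choose suc k) ℕ.+ (suc n choose suc (suc k)))
      ≡⟨ lemma₁ k (suc n choose suc k) (suc n choose suc (suc k)) ⟩
    (suc n choose suc k) ℕ.+ suc k ℕ.* (suc n choose suc k) ℕ.+ suc (suc k) ℕ.* (suc n choose suc (suc k))
      ≡⟨ cong₂ (λ x y → (suc n choose suc k) ℕ.+ x ℕ.+ y) (absorption n k) (absorption n (suc k)) ⟩
    (suc n choose suc k) ℕ.+ suc n ℕ.* (n choose k) ℕ.+ suc n ℕ.* (n choose suc k)
      ≡⟨ lemma₂ (suc n choose suc k) (suc n) (n choose k) (n choose suc k) ⟩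
    (suc n choose suc k) ℕ.+ suc n ℕ.* ((n choose k) ℕ.+ (n choose suc k))
      ≡⟨ cong (λ z → (suc n choose suc k) ℕ.+ suc n ℕ.* z) (nCk+nC[k+1]≡[n+1]C[k+1] n k) ⟩
    suc (suc n) ℕ.* (suc n choose suc k) ∎
    where
    open ≡-Reasoning
    lemma₁ : ∀ k x y → (2 ℕ.+ k) ℕ.* (x ℕ.+ y) ≡ x ℕ.+ (1 ℕ.+ k) ℕ.* x ℕ.+ (2 ℕ.+ k) ℕ.* y
    lemma₁ = ℕSolver.solve-∀
    lemma₂ : ∀ c n x y → c ℕ.+ n ℕ.* x ℕ.+ n ℕ.* y ≡ c ℕ.+ n ℕ.* (x ℕ.+ y)
    lemma₂ = ℕSolver.solve-∀

  prime∣C : ∀ {m} → Prime (suc m) → ∀ k → k ℕ.< m → suc m ℕDiv.∣ (suc m choose suc k)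
  prime∣C {m} pr k k< = [ (λ d → contradiction (ℕDiv.∣⇒≤ d) (ℕP.<⇒≱ (s≤s k<))) , id ]′
    (euclidsLemma (suc k) (suc m choose suc k) pr (subst (suc m ℕDiv.∣_) (sym (absorption m k)) (ℕDiv.m∣m*n (m choose k))))

  -- The group ring instead of the cyclotomic ring: its elements are 5-tuples subject to no
  -- relation, so single coefficients can be compared.
  record ℤ[C₅] : Set where
    constructor ⟪_,_,_,_,_⟫
    field c₀ c₁ c₂ c₃ c₄ : ℤ

  open ℤ[C₅] public

  ⟪⟫-cong : ∀ {a b c d e a′ b′ c′ d′ e′} → a ≡ a′ → b ≡ b′ → c ≡ c′ → d ≡ d′ → e ≡ e′ → ⟪ a , b , c , d , e ⟫ ≡ ⟪ a′ , b′ , c′ , d′ , e′ ⟫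
  ⟪⟫-cong refl refl refl refl refl = refl

  infixl 6 _⊕_
  infixl 7 _⊗_
  _⊕_ _⊗_ : ℤ[C₅] → ℤ[C₅] → ℤ[C₅]
  ⟪ a , b , c , d , e ⟫ ⊕ ⟪ a′ , b′ , c′ , d′ , e′ ⟫ = ⟪ a + a′ , b + b′ , c + c′ , d + d′ , e + e′ ⟫
  ⟪ a , b , c , d , e ⟫ ⊗ ⟪ a′ , b′ , c′ , d′ , e′ ⟫ =
    ⟪ a * a′ + b * e′ + c * d′ + d * c′ + e * b′
    , a * b′ + b * a′ + c * e′ + d * d′ + e * c′
    , a * c′ + b * b′ + c * a′ + d * e′ + e * d′
    , a * d′ + b * c′ + c * b′ + d * a′ + e * e′
    , a * e′ + b * d′ + c * c′ + d * b′ + e * a′ ⟫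

  0c 1c : ℤ[C₅]
  0c = ⟪ 0ℤ , 0ℤ , 0ℤ , 0ℤ , 0ℤ ⟫
  1c = ⟪ 1ℤ , 0ℤ , 0ℤ , 0ℤ , 0ℤ ⟫

  groupRing : CommutativeSemiring _ _
  groupRing = record
    { Carrier = ℤ[C₅] ; _≈_ = _≡_ ; _+_ = _⊕_ ; _*_ = _⊗_ ; 0# = 0c ; 1# = 1c
    ; isCommutativeSemiring = record
      { isSemiring = record
        { isSemiringWithoutAnnihilatingZero = record
          { +-isCommutativeMonoid = record
            { isMonoid = record
              { isSemigroup = record
                { isMagma = record { isEquivalence = isEquivalence ; ∙-cong = cong₂ _⊕_ }
                ; assoc = λ x y z → ⟪⟫-cong (ℤP.+-assoc (c₀ x) _ _) (ℤP.+-assoc (c₁ x) _ _) (ℤP.+-assoc (c₂ x) _ _) (ℤP.+-assoc (c₃ x) _ _) (ℤP.+-assoc (c₄ x) _ _) }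
              ; identity = (λ x → ⟪⟫-cong (ℤP.+-identityˡ _) (ℤP.+-identityˡ _) (ℤP.+-identityˡ _) (ℤP.+-identityˡ _) (ℤP.+-identityˡ _))
                         , (λ x → ⟪⟫-cong (ℤP.+-identityʳ _) (ℤP.+-identityʳ _) (ℤP.+-identityʳ _) (ℤP.+-identityʳ _) (ℤP.+-identityʳ _)) }
            ; comm = λ x y → ⟪⟫-cong (ℤP.+-comm (c₀ x) _) (ℤP.+-comm (c₁ x) _) (ℤP.+-comm (c₂ x) _) (ℤP.+-comm (c₃ x) _) (ℤP.+-comm (c₄ x) _) }
          ; *-cong = cong₂ _⊗_
          ; *-assoc = assoc
          ; *-identity = identityˡ , (λ x → trans (comm x 1c) (identityˡ x))
          ; distrib = (λ x y z → trans (comm x (y ⊕ z)) (trans (distribʳ x y z) (cong₂ _⊕_ (comm y x) (comm z x)))) , distribʳ }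
        ; zero = zeroˡ , (λ x → trans (comm x 0c) (zeroˡ x)) }
      ; *-comm = comm } }
    where
    comm : ∀ x y → x ⊗ y ≡ y ⊗ x
    comm ⟪ a , b , c , d , e ⟫ ⟪ f , g , h , i , j ⟫ = ⟪⟫-cong (l₀ a b c d e f g h i j) (l₁ a b c d e f g h i j) (l₂ a b c d e f g h i j) (l₃ a b c d e f g h i j) (l₄ a b c d e f g h i j)
      where
      l₀ : ∀ a b c d e f g h i j → a * f + b * j + c * i + d * h + e * g ≡ f * a + g * e + h * d + i * c + j * b
      l₀ = solve-∀
      l₁ : ∀ a b c d e f g h i j → a * g + b * f + c * j + d * i + e * h ≡ f * b + g * a + h * e + i * d + j * c
      l₁ = solve-∀
      l₂ : ∀ a b c d e f g h i j → a * h + b * g + c * f + d * j + e * i ≡ f * c + g * b + h * a + i * e + j * d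
      l₂ = solve-∀
      l₃ : ∀ a b c d e f g h i j → a * i + b * h + c * g + d * f + e * j ≡ f * d + g * c + h * b + i * a + j * e
      l₃ = solve-∀
      l₄ : ∀ a b c d e f g h i j → a * j + b * i + c * h + d * g + e * f ≡ f * e + g * d + h * c + i * b + j * a
      l₄ = solve-∀
    distribʳ : ∀ x y z → (y ⊕ z) ⊗ x ≡ y ⊗ x ⊕ z ⊗ x
    distribʳ ⟪ f , g , h , i , j ⟫ ⟪ a , b , c , d , e ⟫ ⟪ a′ , b′ , c′ , d′ , e′ ⟫ =
        ⟪⟫-cong (l a b c d e a′ b′ c′ d′ e′ f j i h g) (l a b c d e a′ b′ c′ d′ e′ g f j i h) (l a b c d e a′ b′ c′ d′ e′ h g f j i)
                (l a b c d e a′ b′ c′ d′ e′ i h g f j) (l a b c d e a′ b′ c′ d′ e′ j i h g f)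
      where
      l : ∀ a b c d e a′ b′ c′ d′ e′ f g h i j → (a + a′) * f + (b + b′) * g + (c + c′) * h + (d + d′) * i + (e + e′) * j ≡
          a * f + b * g + c * h + d * i + e * j + (a′ * f + b′ * g + c′ * h + d′ * i + e′ * j)
      l = solve-∀
    assoc : ∀ x y z → (x ⊗ y) ⊗ z ≡ x ⊗ (y ⊗ z)
    assoc ⟪ a , b , c , d , e ⟫ ⟪ f , g , h , i , j ⟫ ⟪ k , l , m , n , o ⟫ =
        ⟪⟫-cong (L k o n m l) (L l k o n m) (L m l k o n) (L n m l k o) (L o n m l k)
      where
      L : ∀ k o n m l → (a * f + b * j + c * i + d * h + e * g) * k + (a * g + b * f + c * j + d * i + e * h) * o + (a * h + b * g + c * f + d * j + e * i) * n +
          (a * i + b * h + c * g + d * f + e * j) * m + (a * j + b * i + c * h + d * g + e * f) * l ≡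
          a * (f * k + g * o + h * n + i * m + j * l) + b * (f * o + g * n + h * m + i * l + j * k) + c * (f * n + g * m + h * l + i * k + j * o) +
          d * (f * m + g * l + h * k + i * o + j * n) + e * (f * l + g * k + h * o + i * n + j * m)
      L = lemma a b c d e f g h i j
        where
        lemma : ∀ a b c d e f g h i j k o n m l → (a * f + b * j + c * i + d * h + e * g) * k + (a * g + b * f + c * j + d * i + e * h) * o + (a * h + b * g + c * f + d * j + e * i) * n +
          (a * i + b * h + c * g + d * f + e * j) * m + (a * j + b * i + c * h + d * g + e * f) * l ≡
          a * (f * k + g * o + h * n + i * m + j * l) + b * (f * o + g * n + h * m + i * l + j * k) + c * (f * n + g * m + h * l + i * k + j * o) +
          d * (f * m + g * l + h * k + i * o + j * n) + e * (f * l + g * k + h * o + i * n + j * m)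
        lemma = solve-∀
    identityˡ : ∀ x → 1c ⊗ x ≡ x
    identityˡ ⟪ f , g , h , i , j ⟫ = ⟪⟫-cong (l f j i h g) (l g f j i h) (l h g f j i) (l i h g f j) (l j i h g f)
      where
      l : ∀ f g h i j → 1ℤ * f + 0ℤ * g + 0ℤ * h + 0ℤ * i + 0ℤ * j ≡ f
      l = solve-∀
    zeroˡ : ∀ x → 0c ⊗ x ≡ 0c
    zeroˡ x = refl

  module GR where
    open CommutativeSemiring groupRing public using (semiring)
    open Exp semiring public
    open Mult semiring public
    open Sum semiring public
    open Binomial groupRing public

  infix 4 _≡_mod_
  _≡_mod_ : ℤ[C₅] → ℤ[C₅] → ℕ → Set
  x ≡ y mod p = Σ ℤ[C₅] λ z → x ≡ y ⊕ p GR.× z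

  multiple-sum : ∀ p n (t : Fin n → ℤ[C₅]) → (∀ i → Σ ℤ[C₅] λ z → t i ≡ p GR.× z) → Σ ℤ[C₅] λ z → GR.sum t ≡ p GR.× z
  multiple-sum p zero    t e = 0c , sym (zero-multiple p)
    where
    zero-multiple : ∀ p → p GR.× 0c ≡ 0c
    zero-multiple zero    = refl
    zero-multiple (suc p) = cong (0c ⊕_) (zero-multiple p)
  multiple-sum p (suc n) t e with e Fin.zero | multiple-sum p n (t ∘ Fin.suc) (e ∘ Fin.suc)
  ... | z , f | z′ , f′ = z ⊕ z′ , trans (cong₂ _⊕_ f f′) (sym (CommutativeMonoidMult.×-distrib-+ (CommutativeSemiring.+-commutativeMonoid groupRing) z z′ p))

  opaque
    -- The inner binomial coefficients of a prime exponent are divisible by that prime.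
    frobenius : ∀ {m} → Prime (suc m) → ∀ x y → (x ⊕ y) GR.^ suc m ≡ x GR.^ suc m ⊕ y GR.^ suc m mod suc m
    frobenius {m} pr x y = z , (begin
      (x ⊕ y) GR.^ suc m                                     ≡⟨ GR.theorem (suc m) x y ⟩
      term Fin.zero ⊕ GR.sum (term ∘ Fin.suc)                ≡⟨ cong₂ _⊕_ first (GR.sum-init-last (term ∘ Fin.suc)) ⟩
      y GR.^ suc m ⊕ (GR.sum (λ i → term (Fin.suc (Fin.inject₁ i))) ⊕ term (Fin.suc (Fin.fromℕ m)))
        ≡⟨ cong₂ (λ a b → y GR.^ suc m ⊕ (a ⊕ b)) z≡ last ⟩
      y GR.^ suc m ⊕ (suc m GR.× z ⊕ x GR.^ suc m)           ≡⟨ shuffle (y GR.^ suc m) (suc m GR.× z) (x GR.^ suc m) ⟩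
      x GR.^ suc m ⊕ y GR.^ suc m ⊕ suc m GR.× z             ∎)
      where
      open ≡-Reasoning
      open CommutativeSemiring groupRing using (+-assoc; +-comm; *-identityˡ; *-identityʳ; +-identityʳ)
      term : Fin (suc (suc m)) → ℤ[C₅]
      term = GR.binomialTerm x y (suc m)
      shuffle : ∀ a b c → a ⊕ (b ⊕ c) ≡ c ⊕ a ⊕ b
      shuffle a b c = trans (sym (+-assoc a b c)) (trans (+-comm (a ⊕ b) c) (sym (+-assoc c a b)))
      one : ∀ a → 1 GR.× a ≡ a
      one a = +-identityʳ a
      first : term Fin.zero ≡ y GR.^ suc m
      first = trans (one _) (*-identityˡ (y GR.^ suc m))
      last : term (Fin.suc (Fin.fromℕ m)) ≡ x GR.^ suc m
      last = trans (cong (λ k → (suc m choose suc k) GR.× (x GR.^ suc k ⊗ y GR.^ (m ℕ.∸ k))) (FinP.toℕ-fromℕ m))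
        (trans (cong₂ (λ c k → c GR.× (x GR.^ suc m ⊗ y GR.^ k)) (nCn≡1 (suc m)) (ℕP.n∸n≡0 m)) (trans (one _) (*-identityʳ (x GR.^ suc m))))
      middle : ∀ i → Σ ℤ[C₅] λ z → term (Fin.suc (Fin.inject₁ i)) ≡ suc m GR.× z
      middle i with prime∣C pr (Fin.toℕ (Fin.inject₁ i)) (subst (ℕ._< m) (sym (FinP.toℕ-inject₁ i)) (FinP.toℕ<n i))
      ... | ℕDiv.divides q e = q GR.× b , trans (cong (GR._× b) (trans e (ℕP.*-comm q (suc m)))) (sym (GR.×-assocˡ b (suc m) q))
        where
        b : ℤ[C₅]
        b = GR.binomial x y (suc m) (Fin.suc (Fin.inject₁ i))
      z : ℤ[C₅]
      z = proj₁ (multiple-sum (suc m) m _ middle)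
      z≡ : GR.sum (λ i → term (Fin.suc (Fin.inject₁ i))) ≡ suc m GR.× z
      z≡ = proj₂ (multiple-sum (suc m) m _ middle)

  ζ gauss-sum : ℤ[C₅]
  ζ = ⟪ 0ℤ , 1ℤ , 0ℤ , 0ℤ , 0ℤ ⟫
  gauss-sum = ⟪ 0ℤ , 1ℤ , -1ℤ , -1ℤ , 1ℤ ⟫

  ζ-power : ∀ n → ζ GR.^ n ≡ ζ GR.^ (n ℕ.% 5)
  ζ-power n = begin
    ζ GR.^ n                                            ≡⟨ cong (ζ GR.^_) (ℕDM.m≡m%n+[m/n]*n n 5) ⟩
    ζ GR.^ (n ℕ.% 5 ℕ.+ n ℕ./ 5 ℕ.* 5)                  ≡⟨ GR.^-homo-* ζ (n ℕ.% 5) (n ℕ./ 5 ℕ.* 5) ⟩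
    ζ GR.^ (n ℕ.% 5) ⊗ ζ GR.^ (n ℕ./ 5 ℕ.* 5)           ≡⟨ cong (λ k → ζ GR.^ (n ℕ.% 5) ⊗ ζ GR.^ k) (ℕP.*-comm (n ℕ./ 5) 5) ⟩
    ζ GR.^ (n ℕ.% 5) ⊗ ζ GR.^ (5 ℕ.* (n ℕ./ 5))         ≡⟨ cong (ζ GR.^ (n ℕ.% 5) ⊗_) (sym (GR.^-assocʳ ζ 5 (n ℕ./ 5))) ⟩
    ζ GR.^ (n ℕ.% 5) ⊗ 1c GR.^ (n ℕ./ 5)                ≡⟨ cong (ζ GR.^ (n ℕ.% 5) ⊗_) (ones (n ℕ./ 5)) ⟩
    ζ GR.^ (n ℕ.% 5) ⊗ 1c                               ≡⟨ CommutativeSemiring.*-identityʳ groupRing (ζ GR.^ (n ℕ.% 5)) ⟩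
    ζ GR.^ (n ℕ.% 5)                                    ∎
    where
    open ≡-Reasoning
    ones : ∀ k → 1c GR.^ k ≡ 1c
    ones zero    = refl
    ones (suc k) = cong (1c ⊗_) (ones k)

  -- g² = 5 - (1 + ζ + ζ² + ζ³ + ζ⁴), and the bracket annihilates g because the coefficients of g
  -- sum to 0. So g³ = 5g, although g² differs from 5 in the group ring.
  gauss-power : ∀ h → gauss-sum GR.^ (1 ℕ.+ 2 ℕ.* h) ≡ ⟪ 0ℤ , + (5 ℕ.^ h) , - + (5 ℕ.^ h) , - + (5 ℕ.^ h) , + (5 ℕ.^ h) ⟫
  gauss-power h = trans (cong (gauss-sum ⊗_) (sym (GR.^-assocʳ gauss-sum 2 h))) (trans (CommutativeSemiring.*-comm groupRing gauss-sum ((gauss-sum GR.^ 2) GR.^ h)) (squares h))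
    where
    squares : ∀ h → (gauss-sum GR.^ 2) GR.^ h ⊗ gauss-sum ≡ ⟪ 0ℤ , + (5 ℕ.^ h) , - + (5 ℕ.^ h) , - + (5 ℕ.^ h) , + (5 ℕ.^ h) ⟫
    squares zero    = refl
    squares (suc h) = trans (CommutativeSemiring.*-assoc groupRing (gauss-sum GR.^ 2) ((gauss-sum GR.^ 2) GR.^ h) gauss-sum)
        (trans (cong (gauss-sum GR.^ 2 ⊗_) (squares h)) (trans (⟪⟫-cong (l₀ a) (l₁ a) (l₂ a) (l₂′ a) (l₁′ a))
          (⟪⟫-cong refl (sym p) (cong -_ (sym p)) (cong -_ (sym p)) (sym p))))
      where
      a : ℤ
      a = + (5 ℕ.^ h)
      p : + (5 ℕ.* 5 ℕ.^ h) ≡ + 5 * a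
      p = ℤP.pos-* 5 (5 ℕ.^ h)
      l₀ : ∀ a → + 4 * 0ℤ + -1ℤ * a + -1ℤ * - a + -1ℤ * - a + -1ℤ * a ≡ 0ℤ
      l₀ = solve-∀
      l₁ : ∀ a → + 4 * a + -1ℤ * 0ℤ + -1ℤ * a + -1ℤ * - a + -1ℤ * - a ≡ + 5 * a
      l₁ = solve-∀
      l₂ : ∀ a → + 4 * - a + -1ℤ * a + -1ℤ * 0ℤ + -1ℤ * a + -1ℤ * - a ≡ - (+ 5 * a)
      l₂ = solve-∀
      l₂′ : ∀ a → + 4 * - a + -1ℤ * - a + -1ℤ * a + -1ℤ * 0ℤ + -1ℤ * a ≡ - (+ 5 * a)
      l₂′ = solve-∀
      l₁′ : ∀ a → + 4 * a + -1ℤ * - a + -1ℤ * - a + -1ℤ * a + -1ℤ * 0ℤ ≡ + 5 * a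
      l₁′ = solve-∀

  c₁-multiple : ∀ p z → c₁ (p GR.× z) ≡ + p * c₁ z
  c₁-multiple zero    z = sym (ℤP.*-zeroˡ (c₁ z))
  c₁-multiple (suc p) z = trans (+-congʳ (c₁ z) (c₁-multiple p z)) (lemma (+ p) (c₁ z))
    where
    lemma : ∀ p z → z + p * z ≡ (1ℤ + p) * z
    lemma = solve-∀

  -- Raise ζ + ζ⁴ = g + (ζ² + ζ³) to the power p and compare the coefficients of ζ.
  euler-criterion : ∀ h → Prime (1 ℕ.+ 2 ℕ.* h) → (1 ℕ.+ 2 ℕ.* h) ℕ.% 5 ≢ 0 → Σ ℤ λ κ → + (5 ℕ.^ h) ≡ χ (1 ℕ.+ 2 ℕ.* h) + κ * + (1 ℕ.+ 2 ℕ.* h)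
  euler-criterion h pr p≢0 = κ , solve-for (begin
      d 1 + d 4 + + p * c₁ z₁                        ≡⟨ cong₂ _+_ (cong₂ _+_ (trans (sym (coefficient 1)) (cong (λ n → c₁ (ζ GR.^ n)) (ℕP.*-identityˡ p))) (sym (trans (cong c₁ (GR.^-assocʳ ζ 4 p)) (coefficient 4)))) (sym (c₁-multiple p z₁)) ⟩
      c₁ (ζ GR.^ p ⊕ (ζ GR.^ 4) GR.^ p ⊕ p GR.× z₁)  ≡⟨ cong c₁ (trans (sym e₁) (trans (cong (GR._^ p) same) e₂)) ⟩
      c₁ (gauss-sum GR.^ p ⊕ (ζ GR.^ 2 ⊕ ζ GR.^ 3) GR.^ p ⊕ p GR.× z₂)
        ≡⟨ cong₂ _+_ (cong₂ _+_ (cong c₁ (gauss-power h)) (trans (cong c₁ e₃) (cong₂ _+_ (cong₂ _+_ (trans (cong c₁ (GR.^-assocʳ ζ 2 p)) (coefficient 2)) (trans (cong c₁ (GR.^-assocʳ ζ 3 p)) (coefficient 3))) (c₁-multiple p z₃)))) (c₁-multiple p z₂) ⟩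
      + (5 ℕ.^ h) + (d 2 + d 3 + + p * c₁ z₃) + + p * c₁ z₂ ∎)
    where
    open ≡-Reasoning
    p : ℕ
    p = 1 ℕ.+ 2 ℕ.* h
    f₁ = frobenius pr ζ (ζ GR.^ 4)
    f₂ = frobenius pr gauss-sum (ζ GR.^ 2 ⊕ ζ GR.^ 3)
    f₃ = frobenius pr (ζ GR.^ 2) (ζ GR.^ 3)
    z₁ z₂ z₃ : ℤ[C₅]
    z₁ = proj₁ f₁
    z₂ = proj₁ f₂
    z₃ = proj₁ f₃
    e₁ : (ζ ⊕ ζ GR.^ 4) GR.^ p ≡ ζ GR.^ p ⊕ (ζ GR.^ 4) GR.^ p ⊕ p GR.× z₁
    e₁ = proj₂ f₁
    e₂ : (gauss-sum ⊕ (ζ GR.^ 2 ⊕ ζ GR.^ 3)) GR.^ p ≡ gauss-sum GR.^ p ⊕ (ζ GR.^ 2 ⊕ ζ GR.^ 3) GR.^ p ⊕ p GR.× z₂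
    e₂ = proj₂ f₂
    e₃ : (ζ GR.^ 2 ⊕ ζ GR.^ 3) GR.^ p ≡ (ζ GR.^ 2) GR.^ p ⊕ (ζ GR.^ 3) GR.^ p ⊕ p GR.× z₃
    e₃ = proj₂ f₃
    -- Moving ζ² + ζ³ to the side of g avoids subtraction, which a semiring does not have.
    same : ζ ⊕ ζ GR.^ 4 ≡ gauss-sum ⊕ (ζ GR.^ 2 ⊕ ζ GR.^ 3)
    same = refl
    κ : ℤ
    κ = c₁ z₁ - c₁ z₂ - c₁ z₃
    r : ℕ
    r = p ℕ.% 5
    d : ℕ → ℤ
    d k = c₁ (ζ GR.^ ((k ℕ.* r) ℕ.% 5))
    coefficient : ∀ k → c₁ (ζ GR.^ (k ℕ.* p)) ≡ d k
    coefficient k = cong c₁ (trans (ζ-power (k ℕ.* p)) (cong (ζ GR.^_) (trans (ℕDM.%-distribˡ-* k p 5)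
      (trans (cong (λ z → (k ℕ.% 5 ℕ.* z) ℕ.% 5) (sym (ℕDM.m%n%n≡m%n p 5))) (sym (ℕDM.%-distribˡ-* k (p ℕ.% 5) 5))))))
    -- ζ^r + ζ^(4r) - ζ^(2r) - ζ^(3r) is χ(r) g, and the coefficient of ζ in g is 1.
    table : ∀ r → r ℕ.< 5 → r ≢ 0 →
      c₁ (ζ GR.^ ((1 ℕ.* r) ℕ.% 5)) + c₁ (ζ GR.^ ((4 ℕ.* r) ℕ.% 5)) - (c₁ (ζ GR.^ ((2 ℕ.* r) ℕ.% 5)) + c₁ (ζ GR.^ ((3 ℕ.* r) ℕ.% 5))) ≡ χ₅ r
    table 0 _ n = contradiction refl n
    table 1 _ _ = refl
    table 2 _ _ = refl
    table 3 _ _ = refl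
    table 4 _ _ = refl
    table (suc (suc (suc (suc (suc _))))) (s≤s (s≤s (s≤s (s≤s (s≤s ()))))) _
    solve-for : d 1 + d 4 + + p * c₁ z₁ ≡ + (5 ℕ.^ h) + (d 2 + d 3 + + p * c₁ z₃) + + p * c₁ z₂ → + (5 ℕ.^ h) ≡ χ p + κ * + p
    solve-for e = trans (lemma₁ (+ (5 ℕ.^ h)) (d 2 + d 3) (+ p) (c₁ z₂) (c₁ z₃)) (trans (cong (λ z → z - (d 2 + d 3) - + p * (c₁ z₂ + c₁ z₃)) (sym e))
        (trans (lemma₂ (d 1 + d 4) (d 2 + d 3) (+ p) (c₁ z₁) (c₁ z₂) (c₁ z₃)) (cong (_+ κ * + p) (table r (ℕDM.m%n<n p 5) p≢0))))
      where
      lemma₁ : ∀ f c p y z → f ≡ f + (c + p * z) + p * y - c - p * (y + z)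
      lemma₁ = solve-∀
      lemma₂ : ∀ b c p x y z → b + p * x - c - p * (y + z) ≡ b - c + (x - y - z) * p
      lemma₂ = solve-∀

  -- Legendre and Kronecker symbols.

  legendre-value : ∀ k {v} → (5 ℕ.^ ((2 ℕ.+ k) ℕ./ 2)) ℕ.% (3 ℕ.+ k) ≡ v → (v ≡ 1 → legendre 5 (3 ℕ.+ k) ≡ 1ℤ) × (v ≡ 2 ℕ.+ k → legendre 5 (3 ℕ.+ k) ≡ -1ℤ)
  legendre-value k e = (λ { refl → value₁ e }) , (λ { refl → value₂ e })
    where
    value₁ : (5 ℕ.^ ((2 ℕ.+ k) ℕ./ 2)) ℕ.% (3 ℕ.+ k) ≡ 1 → legendre 5 (3 ℕ.+ k) ≡ 1ℤ
    value₁ e rewrite e = refl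
    value₂ : (5 ℕ.^ ((2 ℕ.+ k) ℕ./ 2)) ℕ.% (3 ℕ.+ k) ≡ 2 ℕ.+ k → legendre 5 (3 ℕ.+ k) ≡ -1ℤ
    value₂ e rewrite e = refl

  legendre≡χ : ∀ p → Prime p → legendre 5 p ≡ χ p
  legendre≡χ 0 pr = contradiction pr Primality.¬prime[0]
  legendre≡χ 1 pr = contradiction pr Primality.¬prime[1]
  legendre≡χ 2 pr = refl
  legendre≡χ p@(suc (suc (suc k))) pr with p ℕP.≟ 5
  ... | yes refl = refl
  ... | no p≢5 = by-residue
    where
    irr : Primality.Irreducible p
    irr = Primality.prime⇒irreducible pr
    not-5 : p ℕ.% 5 ≢ 0
    not-5 e with irr (ℕDiv.m%n≡0⇒n∣m p 5 e)
    ... | inj₁ ()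
    ... | inj₂ q = p≢5 (sym q)
    odd : p ℕ.% 2 ≡ 1
    odd with p ℕ.% 2 in e | ℕDM.m%n<n p 2
    ... | 1 | _ = refl
    ... | suc (suc _) | s≤s (s≤s ())
    ... | 0 | _ with irr (ℕDiv.m%n≡0⇒n∣m p 2 e)
    ...   | inj₁ ()
    ...   | inj₂ ()
    h : ℕ
    h = p ℕ./ 2
    p≡ : p ≡ 1 ℕ.+ 2 ℕ.* h
    p≡ = trans (ℕDM.m≡m%n+[m/n]*n p 2) (cong₂ ℕ._+_ odd (ℕP.*-comm h 2))
    half : (2 ℕ.+ k) ℕ./ 2 ≡ h
    half = trans (cong (ℕ._/ 2) (trans (ℕP.suc-injective p≡) (ℕP.*-comm 2 h))) (ℕDM.m*n/n≡m h 2)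
    euler : Σ ℤ λ K → + (5 ℕ.^ h) ≡ χ p + K * + p
    euler = subst (λ q → Prime q → q ℕ.% 5 ≢ 0 → Σ ℤ λ K → + (5 ℕ.^ h) ≡ χ q + K * + q) (sym p≡) (euler-criterion h) pr not-5
    residue-of : ∀ a → + (5 ℕ.^ h) ≡ + a + proj₁ euler * + p → a ℕ.< p → (5 ℕ.^ ((2 ℕ.+ k) ℕ./ 2)) ℕ.% p ≡ a
    residue-of a e a< = trans (cong (λ z → (5 ℕ.^ z) ℕ.% p) half) (trans (%-cong (2 ℕ.+ k) (5 ℕ.^ h) a (proj₁ euler) e) (ℕDM.m<n⇒m%n≡m a<))
    range : ∀ r → r ≢ 0 → r ℕ.< 5 → χ₅ r ≡ 1ℤ ⊎ χ₅ r ≡ -1ℤ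
    range 0 n _ = contradiction refl n
    range 1 _ _ = inj₁ refl
    range 2 _ _ = inj₂ refl
    range 3 _ _ = inj₂ refl
    range 4 _ _ = inj₁ refl
    range (suc (suc (suc (suc (suc _))))) _ (s≤s (s≤s (s≤s (s≤s (s≤s ())))))
    by-residue : legendre 5 p ≡ χ p
    by-residue with range (p ℕ.% 5) not-5 (ℕDM.m%n<n p 5)
    ... | inj₁ e = trans (proj₁ (legendre-value k refl) (residue-of 1 (trans (proj₂ euler) (cong (_+ proj₁ euler * + p) e)) (s≤s (s≤s z≤n)))) (sym e)
    -- Residues are natural numbers, so -1 has to appear as p - 1; the multiple of p is lowered by
    -- one to compensate.
    ... | inj₂ e = trans (proj₂ (legendre-value k refl) (trans (cong (λ z → (5 ℕ.^ z) ℕ.% p) half)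
        (trans (%-cong (2 ℕ.+ k) (5 ℕ.^ h) (2 ℕ.+ k) (proj₁ euler - 1ℤ) (trans (proj₂ euler) (trans (cong (_+ proj₁ euler * + p) e) (lemma (+ (2 ℕ.+ k)) (proj₁ euler)))))
          (ℕDM.m<n⇒m%n≡m ℕP.≤-refl)))) (sym e)
      where
      lemma : ∀ q K → -1ℤ + K * (1ℤ + q) ≡ q + (K - 1ℤ) * (1ℤ + q)
      lemma = solve-∀

  -- `Rough` is the invariant that no number from 2 to i - 1 divides m, so the first divisor met is
  -- prime. The bound m < i + f keeps the fuel from running out before i reaches m.
  leastDivFrom-prime : ∀ f i m → i Primality.Rough m → ℕ.NonTrivial i → ℕ.NonTrivial m → m ℕ.< i ℕ.+ f → Prime (leastDivFrom f i m) × leastDivFrom f i m ℕDiv.∣ m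
  leastDivFrom-prime zero i m rough ni nm lt = contradiction (Primality.rough⇒≤ ⦃ nm ⦄ rough) (ℕP.<⇒≱ (subst (m ℕ.<_) (ℕP.+-identityʳ i) lt))
  leastDivFrom-prime (suc f) i m rough ni nm lt = decide (i ℕDiv.∣? m)
    where
    next : ¬ (i ℕDiv.∣ m) → Prime (leastDivFrom f (suc i) m) × leastDivFrom f (suc i) m ℕDiv.∣ m
    next n = leastDivFrom-prime f (suc i) m (Primality.∤⇒rough-suc n rough) (bigger i ni) nm (subst (m ℕ.<_) (ℕP.+-suc i f) lt)
      where
      bigger : ∀ i → ℕ.NonTrivial i → ℕ.NonTrivial (suc i)
      bigger (suc (suc _)) _ = _
    decide : Dec (i ℕDiv.∣ m) → Prime (leastDivFrom (suc f) i m) × leastDivFrom (suc f) i m ℕDiv.∣ m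
    decide (yes d) = subst (λ q → Prime q × q ℕDiv.∣ m) (sym (if-yes (i ℕDiv.∣? m) d)) (Primality.rough∧∣⇒prime ⦃ ni ⦄ rough d , d)
    decide (no n)  = subst (λ q → Prime q × q ℕDiv.∣ m) (sym (if-no (i ℕDiv.∣? m) n)) (next n)

  kroneckerFuel≡χ : ∀ f m → 1 ℕ.≤ m → m ℕ.≤ f → kroneckerFuel f 5 m ≡ χ m
  kroneckerFuel≡χ zero    zero    () _
  kroneckerFuel≡χ zero    (suc m) _ ()
  kroneckerFuel≡χ (suc f) 0 () _
  kroneckerFuel≡χ (suc f) 1 _ _ = refl
  kroneckerFuel≡χ (suc f) m@(suc (suc n)) _ (s≤s m≤) with leastDivFrom-prime m 2 m Primality.2-rough _ _ (s≤s (ℕP.n≤1+n m))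
  ... | pr , d = step (leastPrimeFactor m) pr d
    where
    step : ∀ q → Prime q → q ℕDiv.∣ m → legendre 5 q * kroneckerFuel f 5 (m ℕ./ suc (ℕ.pred q)) ≡ χ m
    step 0 pr _ = contradiction pr Primality.¬prime[0]
    step 1 pr _ = contradiction pr Primality.¬prime[1]
    step q@(suc (suc _)) pr (ℕDiv.divides (suc k) e) = trans (cong₂ _*_ (legendre≡χ q pr)
        (trans (cong (kroneckerFuel f 5) quot) (kroneckerFuel≡χ f (suc k) (s≤s z≤n) (ℕP.≤-trans (ℕP.≤-pred bound) m≤))))
      (trans (ℤP.*-comm (χ q) (χ (suc k))) (trans (sym (χ-* (suc k) q)) (cong χ (sym e))))
      where
      quot : m ℕ./ q ≡ suc k
      quot = trans (cong (ℕ._/ q) e) (ℕDM.m*n/n≡m (suc k) q)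
      bound : suc k ℕ.< m
      bound = subst (suc k ℕ.<_) (sym e) (ℕP.m<m*n (suc k) q (s≤s (s≤s z≤n)))

  kronecker≡χ : ∀ d → 1 ℕ.≤ d → kronecker 5 d ≡ χ d
  kronecker≡χ d d≥1 = kroneckerFuel≡χ d d d≥1 ℕP.≤-refl

  -- Counting solutions, and the formula for the number of representations.

  module _ {A : Set} where

    unique-lookup : ∀ {L : List A} → Unique L → ∀ i j → lookup L i ≡ lookup L j → i ≡ j
    unique-lookup (x∉ ∷ u) Fin.zero    Fin.zero    e = refl
    unique-lookup (x∉ ∷ u) Fin.zero    (Fin.suc j) e = contradiction e (All.lookup x∉ (MemP.∈-lookup j))
    unique-lookup (x∉ ∷ u) (Fin.suc i) Fin.zero    e = contradiction (sym e) (All.lookup x∉ (MemP.∈-lookup i))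
    unique-lookup (x∉ ∷ u) (Fin.suc i) (Fin.suc j) e = cong Fin.suc (unique-lookup u i j e)

    -- Proofs of `P` are unique, so a pair is determined by its first component and positions in `L`
    -- can serve as the finite index.
    enumeration : {P : A → Set} (L : List A) → Unique L → (∀ a → P a → a ∈ L) → (∀ a → a ∈ L → P a) →
                  (∀ {a} (p q : P a) → p ≡ q) → Σ A P ↔ Fin (length L)
    enumeration {P} L u complete sound irr = mk↔ₛ′ to from to-from from-to
      where
      to : Σ A P → Fin (length L)
      to (a , p) = Any.index (complete a p)
      from : Fin (length L) → Σ A P
      from i = lookup L i , sound (lookup L i) (MemP.∈-lookup i)
      pair≡ : ∀ {a b} {p : P a} {q : P b} → a ≡ b → (a , p) ≡ (b , q)
      pair≡ {p = p} {q} refl = cong (_ ,_) (irr p q)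
      to-from : ∀ i → to (from i) ≡ i
      to-from i = unique-lookup u _ i (sym (AnyP.lookup-index (complete (lookup L i) (sound (lookup L i) (MemP.∈-lookup i)))))
      from-to : ∀ s → from (to s) ≡ s
      from-to (a , p) = pair≡ (sym (AnyP.lookup-index (complete a p)))

    count-filter : {P : A → Set} (P? : ∀ a → Dec (P a)) (L : List A) → + length (filter P? L) ≡ sumL (λ a → 1ℤ * 𝟙 (P? a)) L
    count-filter P? []      = refl
    count-filter P? (a ∷ L) with P? a
    ... | yes _ = +-congʳ 1ℤ (count-filter P? L)
    ... | no _  = trans (count-filter P? L) (sym (ℤP.+-identityˡ _))

  solution-exp : ∀ n x y z w → (repExp 4 1 5 5 5 (x , y , z , w) ≡ + (2 ℕ.* (2 ℕ.+ n)) → + (2 ℕ.* n) ≡ + 1 * twoTri x + + 5 * twoTri y + + 5 * twoTri z + + 5 * twoTri w) ×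
                               (+ (2 ℕ.* n) ≡ + 1 * twoTri x + + 5 * twoTri y + + 5 * twoTri z + + 5 * twoTri w → repExp 4 1 5 5 5 (x , y , z , w) ≡ + (2 ℕ.* (2 ℕ.+ n)))
  solution-exp n x y z w = (λ e → trans (lemma₁ (+ (2 ℕ.* n))) (trans (cong (_- + 4) (trans (sym by-four) (sym e))) (lemma₂ (triExp 1 x) (triExp 5 y) (triExp 5 z) (triExp 5 w)))) ,
      (λ e → trans (lemma₃ (triExp 1 x) (triExp 5 y) (triExp 5 z) (triExp 5 w)) (trans (+-congʳ (+ 4) (sym e)) (sym by-four)))
    where
    by-four : + (2 ℕ.* (2 ℕ.+ n)) ≡ + 4 + + (2 ℕ.* n)
    by-four = cong +_ (ℕP.*-distribˡ-+ 2 2 n)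
    lemma₁ : ∀ n → n ≡ + 4 + n - + 4
    lemma₁ = solve-∀
    lemma₂ : ∀ a b c d → + 4 + (a + b + (c + d)) - + 4 ≡ a + b + c + d
    lemma₂ = solve-∀
    lemma₃ : ∀ a b c d → + 4 + (a + b + (c + d)) ≡ + 4 + (a + b + c + d)
    lemma₃ = solve-∀

  IsSolution : ℕ → ℤ × ℤ × ℤ × ℤ → Set
  IsSolution n (x , y , z , w) = + (2 ℕ.* n) ≡ + 1 * twoTri x + + 5 * twoTri y + + 5 * twoTri z + + 5 * twoTri w

  opaque
    -- The list that computes the coefficient of `τ` is filtered to the exact solutions, so that one
    -- list gives both the bijection and the value.
    solutions : ∀ n → Σ ℕ λ t → (Sol 1 5 5 5 n ↔ Fin t) × (+ t ≡ τ (2 ℕ.* (2 ℕ.+ n)))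
    solutions n = length L , enumeration {P = IsSolution n} L unique complete sound (λ p q → Decidable⇒UIP.≡-irrelevant _≟_ p q) ,
        trans (count-filter good? (Cov.list τ-cov N)) (trans (sym (gf-def τ-cov N)) (τ≡ N))
      where
      N : ℕ
      N = 2 ℕ.* (2 ℕ.+ n)
      good? : ∀ i → Dec (repExp 4 1 5 5 5 i ≡ + N)
      good? i = repExp 4 1 5 5 5 i ≟ + N
      L : List (ℤ × ℤ × ℤ × ℤ)
      L = filter good? (Cov.list τ-cov N)
      unique : Unique L
      unique = UniqueP.filter⁺ good? (Cov.uniq τ-cov N)
      complete : ∀ i → IsSolution n i → i ∈ L
      complete i@(x , y , z , w) p = MemP.∈-filter⁺ good? (Cov.covers τ-cov N i (λ ()) (ℤP.≤-reflexive e)) e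
        where
        e : repExp 4 1 5 5 5 i ≡ + N
        e = proj₂ (solution-exp n x y z w) p
      sound : ∀ i → i ∈ L → IsSolution n i
      sound (x , y , z , w) p = proj₁ (solution-exp n x y z w) (proj₂ (MemP.∈-filter⁻ good? {xs = Cov.list τ-cov N} p))

  class-weight : ℕ → ℤ
  class-weight i = [ 2 ∤ suc i ] χ (suc i)

  tens : Cosets (ℕ × ℕ) (ℕ × ℕ) 9
  tens = record
    { class = λ (x , y) → x ℕ.% 10 ; class< = λ (x , y) → ℕDM.m%n<n x 10
    ; coord = λ (x , y) → x ℕ./ 10 , y ; embed = λ i (j , y) → i ℕ.+ j ℕ.* 10 , y
    ; embed-coord = λ (x , y) → cong (_, y) (sym (ℕDM.m≡m%n+[m/n]*n x 10))
    ; class-embed = λ i (j , y) i< → trans (ℕDM.[m+kn]%n≡m%n i j 10) (ℕDM.m<n⇒m%n≡m i<)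
    ; coord-embed = λ i (j , y) i< → cong (_, y) (trans (ℕDM.+-distrib-/-∣ʳ i (ℕDiv.divides j refl)) (cong₂ ℕ._+_ (ℕDM.m<n⇒m/n≡0 i<) (ℕDM.m*n/n≡m j 10))) }

  -- Index i stands for the class x ≡ i + 1 mod 10. The odd classes prime to 5 are 1 and 9, with χ =
  -- 1, and 3 and 7, with χ = -1.
  Sa-Sb : ∀ M → Sa (2 ℕ.* M) - Sb (2 ℕ.* M) ≡ s M
  Sa-Sb M = sym (begin
    s M                                       ≡⟨ factors-def s-weight M ⟩
    gf (factor-family s-weight) M             ≡⟨ coef-match (factor-family s-weight) double M (2 ℕ.* M) id id
                                                   (λ i _ e → refl , trans (double-exp i) (trans (cong (+ 2 *_) e) (sym (ℤP.pos-* 2 M))) , refl)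
                                                   (λ i _ e → refl , ℤP.*-cancelˡ-≡ (+ 2) (factorExp i) (+ M) (trans (sym (double-exp i)) (trans e (ℤP.pos-* 2 M))) , refl) ⟩
    gf double (2 ℕ.* M)                       ≡⟨ coset-split tens double (λ i → class-weight i · S 9 i) each (2 ℕ.* M) ⟩
    sumL (λ i → class-weight i * S 9 i (2 ℕ.* M)) (upTo 10)
      ≡⟨ cong₂ _+_ (odd 0) (cong₂ _+_ (even 1) (cong₂ _+_ (odd 2) (cong₂ _+_ (even 3) (cong₂ _+_ (odd 4)
         (cong₂ _+_ (even 5) (cong₂ _+_ (odd 6) (cong₂ _+_ (even 7) (cong₂ _+_ (odd 8) (cong (_+ 0ℤ) (even 9)))))))))) ⟩
    1ℤ * r 0 + (0ℤ * r 1 + (-1ℤ * r 2 + (0ℤ * r 3 + (0ℤ * r 4 + (0ℤ * r 5 + (-1ℤ * r 6 + (0ℤ * r 7 + (1ℤ * r 8 + (0ℤ * r 9 + 0ℤ)))))))))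
      ≡⟨ lemma (r 0) (r 1) (r 2) (r 3) (r 4) (r 5) (r 6) (r 7) (r 8) (r 9) ⟩
    r 0 + r 8 - (r 2 + r 6)                   ∎)
    where
    open ≡-Reasoning
    r : ℕ → ℤ
    r i = S 9 i (2 ℕ.* M)
    odd : ∀ i → {n : True (¬? (2 ℕDiv.∣? suc i))} → class-weight i * r i ≡ χ (suc i) * r i
    odd i {n} = cong (_* r i) (∤-yes (χ (suc i)) (toWitness n))
    even : ∀ i → {d : True (2 ℕDiv.∣? suc i)} → class-weight i * r i ≡ 0ℤ * r i
    even i {d} = cong (_* r i) (∤-no (χ (suc i)) (toWitness d))
    lemma : ∀ a b c d e f g h i j → 1ℤ * a + (0ℤ * b + (-1ℤ * c + (0ℤ * d + (0ℤ * e + (0ℤ * f + (-1ℤ * g + (0ℤ * h + (1ℤ * i + (0ℤ * j + 0ℤ))))))))) ≡ a + i - (c + g)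
    lemma = solve-∀
    double : Cov (weightOf s-weight) (residueExp (+ 1) (+ 1))
    double = cov-residue 0 0
    double-exp : ∀ i → residueExp (+ 1) (+ 1) i ≡ + 2 * factorExp i
    double-exp (x , y) = trans (ring (+ x) (+ y)) (cong (+ 2 *_) (sym (ℤP.pos-* (suc x) (suc y))))
      where
      ring : ∀ x y → + 2 * ((1ℤ + y) * (+ 1 * x + + 1)) ≡ + 2 * ((1ℤ + x) * (1ℤ + y))
      ring = solve-∀
    each : ∀ i → i ℕ.< 10 → (d : Cov (λ y → weightOf s-weight (Cosets.embed tens i y)) (λ y → residueExp (+ 1) (+ 1) (Cosets.embed tens i y))) → gf d ≈ class-weight i · S 9 i
    each i _ d N = trans (gf-cong d d′ (λ (j , y) → weight j y) (λ (j , y) → exponent j y) N) (gf-scale (class-weight i) (S-cov 9 i) d′ (λ _ → refl) N)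
      where
      d′ : Cov (λ i′ → class-weight i * cofactor i′) (residueExp (+ 10) (+ suc i))
      d′ = cov-residue 9 i
      exponent : ∀ j y → residueExp (+ 1) (+ 1) (i ℕ.+ j ℕ.* 10 , y) ≡ residueExp (+ 10) (+ suc i) (j , y)
      exponent j y = trans (cong (λ z → + 2 * (+ suc y * (+ 1 * (+ i + z) + + 1))) (ℤP.pos-* j 10)) (ring (+ i) (+ j) (+ y))
        where
        ring : ∀ i j y → + 2 * ((1ℤ + y) * (+ 1 * (i + j * + 10) + + 1)) ≡ + 2 * ((1ℤ + y) * (+ 10 * j + (1ℤ + i)))
        ring = solve-∀
      weight : ∀ j y → [ 2 ∤ suc (i ℕ.+ j ℕ.* 10) ] (+ suc y * χ (suc (i ℕ.+ j ℕ.* 10))) ≡ class-weight i * + suc y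
      weight j y = trans (∤-* 2 (suc (i ℕ.+ j ℕ.* 10)) (+ suc y) (χ (suc (i ℕ.+ j ℕ.* 10)))) (trans (ℤP.*-comm (+ suc y) _)
          (cong (_* + suc y) (trans (∤-cong 2 (suc (i ℕ.+ j ℕ.* 10)) (cong χ₅ residue-eq)) parity)))
        where
        residue-eq : suc (i ℕ.+ j ℕ.* 10) ℕ.% 5 ≡ suc i ℕ.% 5
        residue-eq = trans (cong (λ z → (suc i ℕ.+ z) ℕ.% 5) (sym (ℕP.*-assoc j 2 5))) (ℕDM.[m+kn]%n≡m%n (suc i) (j ℕ.* 2) 5)
        2∣tens : 2 ℕDiv.∣ j ℕ.* 10
        2∣tens = ℕDiv.∣n⇒∣m*n j (ℕDiv.divides 5 refl)
        parity : [ 2 ∤ suc (i ℕ.+ j ℕ.* 10) ] χ (suc i) ≡ class-weight i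
        parity = ∤-elim (λ d → sym (∤-no (χ (suc i)) (ℕDiv.∣m+n∣m⇒∣n (subst (2 ℕDiv.∣_) (ℕP.+-comm (suc i) (j ℕ.* 10)) d) 2∣tens)))
                        (λ n → sym (∤-yes (χ (suc i)) (λ d → n (ℕDiv.∣m∣n⇒∣m+n d 2∣tens))))

  -- Since 2 is a nonsquare mod 5, M ≡ 1, 4 gives 2M ≡ 2, 3, where `τ` vanishes, while `s` = `s₂`.
  -- For M ≡ 2, 3 the relation 3τ = 16 s + τ gives τ = 8 s, while `s₂` = -`s`. Multiples of 5 are
  -- reduced by `τ-dilate`, and only there does the recursion on the fuel take place.
  τ-formula : ∀ fuel M → 1 ℕ.≤ M → M ℕ.≤ fuel → τ (2 ℕ.* M) ≡ + 4 * (s M - s₂ M)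
  τ-formula zero       zero () _
  τ-formula zero       (suc M) _ ()
  τ-formula (suc fuel) M M≥1 M≤ = by-residue (M ℕ.% 5) (ℕDM.m%n<n M 5) refl
    where
    N≡ : (2 ℕ.* M) ℕ.% 5 ≡ (2 ℕ.* (M ℕ.% 5)) ℕ.% 5
    N≡ = ℕDM.%-distribˡ-* 2 M 5
    square : ∀ c → M ℕ.% 5 ≡ c → χ₅ c ≡ 1ℤ → (2 ℕ.* c) ℕ.% 5 ≡ 2 ⊎ (2 ℕ.* c) ℕ.% 5 ≡ 3 → τ (2 ℕ.* M) ≡ + 4 * (s M - s₂ M)
    square c e χ≡ n = trans (τ-zero (2 ℕ.* M) ([ (λ p → inj₁ (trans N≡ (trans (cong (λ z → (2 ℕ.* z) ℕ.% 5) e) p))) , (λ p → inj₂ (trans N≡ (trans (cong (λ z → (2 ℕ.* z) ℕ.% 5) e) p))) ]′ n))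
        (sym (trans (cong (λ z → + 4 * (s M - z)) (trans (s₂≡ M (λ z → case trans (sym χM) z of λ ())) (trans (cong (_* s M) χM) (ℤP.*-identityˡ (s M))))) (lemma (s M))))
      where
      χM : χ M ≡ 1ℤ
      χM = trans (cong χ₅ e) χ≡
      lemma : ∀ x → + 4 * (x - x) ≡ 0ℤ
      lemma = solve-∀
    nonsquare : ∀ c → M ℕ.% 5 ≡ c → χ₅ c ≡ -1ℤ → (2 ℕ.* c) ℕ.% 5 ≢ 0 → (2 ℕ.* c) ℕ.% 5 ≢ 2 → (2 ℕ.* c) ℕ.% 5 ≢ 3 → τ (2 ℕ.* M) ≡ + 4 * (s M - s₂ M)
    nonsquare c e χ≡ n0 n2 n3 = trans (solve-for (τ (2 ℕ.* M)) (s M) (trans (sym (ρ-triple (2 ℕ.* M) (n0 ∘ trans (sym res)) (n2 ∘ trans (sym res)) (n3 ∘ trans (sym res))))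
        (trans (ρ-τ (2 ℕ.* M)) (cong (λ z → + 16 * z + τ (2 ℕ.* M)) (Sa-Sb M)))))
      (sym (trans (cong (λ z → + 4 * (s M - z)) (trans (s₂≡ M (λ z → case trans (sym χM) z of λ ())) (cong (_* s M) χM))) (lemma (s M))))
      where
      χM : χ M ≡ -1ℤ
      χM = trans (cong χ₅ e) χ≡
      res : (2 ℕ.* M) ℕ.% 5 ≡ (2 ℕ.* c) ℕ.% 5
      res = trans N≡ (cong (λ z → (2 ℕ.* z) ℕ.% 5) e)
      lemma : ∀ x → + 4 * (x - -1ℤ * x) ≡ + 8 * x
      lemma = solve-∀
      solve-for : ∀ t s → + 3 * t ≡ + 16 * s + t → t ≡ + 8 * s
      solve-for t s e = ℤP.*-cancelˡ-≡ (+ 2) t (+ 8 * s) (trans (l₁ t) (trans (cong (_- t) e) (l₂ s t)))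
        where
        l₁ : ∀ t → + 2 * t ≡ + 3 * t - t
        l₁ = solve-∀
        l₂ : ∀ s t → + 16 * s + t - t ≡ + 2 * (+ 8 * s)
        l₂ = solve-∀
    multiple : ∀ M′ → M ≡ 5 ℕ.* M′ → τ (2 ℕ.* M) ≡ + 4 * (s M - s₂ M)
    multiple zero     refl = case M≥1 of λ ()
    multiple (suc M′) refl = begin
      τ (2 ℕ.* (5 ℕ.* suc M′))              ≡⟨ cong τ (trans (sym (ℕP.*-assoc 2 5 (suc M′))) (ℕP.*-assoc 5 2 (suc M′))) ⟩
      τ (5 ℕ.* (2 ℕ.* suc M′))              ≡⟨ τ-dilate (2 ℕ.* suc M′) ⟩
      ρ (2 ℕ.* suc M′)                      ≡⟨ ρ-τ (2 ℕ.* suc M′) ⟩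
      + 16 * (Sa (2 ℕ.* suc M′) - Sb (2 ℕ.* suc M′)) + τ (2 ℕ.* suc M′)
        ≡⟨ cong₂ (λ a b → + 16 * a + b) (Sa-Sb (suc M′)) (τ-formula fuel (suc M′) (s≤s z≤n) (ℕP.≤-pred (ℕP.≤-trans smaller M≤))) ⟩
      + 16 * s (suc M′) + + 4 * (s (suc M′) - s₂ (suc M′)) ≡⟨ lemma (s (suc M′)) (s₂ (suc M′)) ⟩
      + 4 * (+ 5 * s (suc M′) - s₂ (suc M′)) ≡⟨ cong₂ (λ a b → + 4 * (a - b)) (sym (s-5 (suc M′))) (sym (s₂-5 (suc M′))) ⟩
      + 4 * (s (5 ℕ.* suc M′) - s₂ (5 ℕ.* suc M′)) ∎
      where
      open ≡-Reasoning
      lemma : ∀ a b → + 16 * a + + 4 * (a - b) ≡ + 4 * (+ 5 * a - b)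
      lemma = solve-∀
      smaller : suc (suc M′) ℕ.≤ 5 ℕ.* suc M′
      smaller = subst (suc M′ ℕ.<_) (ℕP.*-comm (suc M′) 5) (ℕP.m<m*n (suc M′) 5 (s≤s (s≤s z≤n)))
    by-residue : ∀ c → c ℕ.< 5 → M ℕ.% 5 ≡ c → τ (2 ℕ.* M) ≡ + 4 * (s M - s₂ M)
    by-residue 0 _ e = multiple (M ℕ./ 5) (trans (ℕDM.m≡m%n+[m/n]*n M 5) (trans (cong (ℕ._+ M ℕ./ 5 ℕ.* 5) e) (ℕP.*-comm (M ℕ./ 5) 5)))
    by-residue 1 _ e = square 1 e refl (inj₁ refl)
    by-residue 2 _ e = nonsquare 2 e refl (λ ()) (λ ()) (λ ())
    by-residue 3 _ e = nonsquare 3 e refl (λ ()) (λ ()) (λ ())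
    by-residue 4 _ e = square 4 e refl (inj₂ refl)
    by-residue (suc (suc (suc (suc (suc _))))) (s≤s (s≤s (s≤s (s≤s (s≤s ()))))) _

  divisorSum≡ : ∀ N → 1 ℕ.≤ N → divisorSum N summand5 ≡ factors summand N
  divisorSum≡ N N≥1 = trans (foldr-sum divisors) (trans (sumL-cong∈ divisors term)
      (trans (sym (sumL-map (λ i → weightOf summand i * ind (factorExp i) N) pair divisors))
        (trans (coef (factor-family summand) N (map pair divisors) unique covers) (sym (factors-def summand N)))))
    where
    divisors : List ℕ
    divisors = filter (λ k → suc k ℕDiv.∣? N) (upTo N)
    h : ℕ → ℤ
    h k = summand5 (suc k) (N ℕ./ suc k)
    pair : ℕ → ℕ × ℕ
    pair k = ℕ.pred (N ℕ./ suc k) , k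
    foldr-sum : ∀ L → foldr _+_ 0ℤ (map h L) ≡ sumL h L
    foldr-sum []      = refl
    foldr-sum (x ∷ L) = +-congʳ (h x) (foldr-sum L)
    unique : Unique (map pair divisors)
    unique = UniqueP.map⁺ (cong proj₂) (UniqueP.filter⁺ (λ k → suc k ℕDiv.∣? N) (UniqueP.upTo⁺ N))
    quotient : ∀ k → suc k ℕDiv.∣ N → Σ ℕ λ q → N ℕ./ suc k ≡ suc q × suc q ℕ.* suc k ≡ N
    quotient k (ℕDiv.divides zero e)    = contradiction e (λ z → case subst (1 ℕ.≤_) z N≥1 of λ ())
    quotient k (ℕDiv.divides (suc q) e) = q , trans (cong (ℕ._/ suc k) e) (ℕDM.m*n/n≡m (suc q) (suc k)) , sym e
    term : ∀ k → k ∈ divisors → h k ≡ weightOf summand (pair k) * ind (factorExp (pair k)) N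
    term k k∈ with quotient k (proj₂ (MemP.∈-filter⁻ (λ k → suc k ℕDiv.∣? N) {xs = upTo N} k∈))
    ... | q , e , f = trans (cong (summand5 (suc k)) e) (trans (cong₂ (λ a b → sgnPow (suc k) * (a + b) * + suc k) (kronecker≡χ (suc k) (s≤s z≤n)) (kronecker≡χ (suc q) (s≤s z≤n)))
        (trans (sym (ℤP.*-identityʳ (summand (suc q) (suc k)))) (trans (cong (summand (suc q) (suc k) *_) (sym (𝟙-yes (factorExp (q , k) ≟ + N) (cong +_ f))))
          (cong (λ p → weightOf summand (p , k) * ind (factorExp (p , k)) N) (sym (cong ℕ.pred e))))))
    covers : ∀ i → weightOf summand i ≢ 0ℤ → factorExp i ≡ + N → i ∈ map pair divisors
    covers (p , k) _ e = subst (_∈ map pair divisors) (cong (λ z → ℕ.pred z , k) (trans (cong (ℕ._/ suc k) (sym N≡)) (ℕDM.m*n/n≡m (suc p) (suc k))))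
        (MemP.∈-map⁺ pair (MemP.∈-filter⁺ (λ k → suc k ℕDiv.∣? N) (MemP.∈-upTo⁺ (subst (suc k ℕ.≤_) N≡ (ℕP.m≤n*m (suc k) (suc p)))) (ℕDiv.divides (suc p) (sym N≡))))
      where
      N≡ : suc p ℕ.* suc k ≡ N
      N≡ = ℤP.+-injective e

  representation-count : ∀ n → Σ ℕ λ t → (Sol 1 5 5 5 n ↔ Fin t) × (+ t ≡ divisorSum (8 ℕ.* n ℕ.+ 16) summand5 - divisorSum (2 ℕ.* n ℕ.+ 4) summand5)
  representation-count n = proj₁ (solutions n) , proj₁ (proj₂ (solutions n)) , (begin
    + proj₁ (solutions n)                                 ≡⟨ proj₂ (proj₂ (solutions n)) ⟩
    τ (2 ℕ.* M)                                           ≡⟨ τ-formula M M (s≤s z≤n) ℕP.≤-refl ⟩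
    + 4 * (s M - s₂ M)                                    ≡⟨ cong (+ 4 *_) (sym (K≡ M)) ⟩
    + 4 * K M                                             ≡⟨ sym (summand-difference M) ⟩
    factors summand (2 ℕ.* (2 ℕ.* (2 ℕ.* M))) - factors summand (2 ℕ.* M) ≡⟨ sym (cong₂ _-_ (trans (divisorSum≡ (8 ℕ.* n ℕ.+ 16) (ℕP.≤-trans (s≤s z≤n) (ℕP.m≤n+m 16 (8 ℕ.* n)))) (cong (factors summand) (eight n)))
                                                                                (trans (divisorSum≡ (2 ℕ.* n ℕ.+ 4) (ℕP.≤-trans (s≤s z≤n) (ℕP.m≤n+m 4 (2 ℕ.* n)))) (cong (factors summand) (two n)))) ⟩
    divisorSum (8 ℕ.* n ℕ.+ 16) summand5 - divisorSum (2 ℕ.* n ℕ.+ 4) summand5 ∎)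
    where
    open ≡-Reasoning
    M : ℕ
    -- The shift by 2 is the factor q² in `τ`; the two sums of the theorem are then taken at 8M and
    -- 2M.
    M = 2 ℕ.+ n
    eight : ∀ n → 8 ℕ.* n ℕ.+ 16 ≡ 2 ℕ.* (2 ℕ.* (2 ℕ.* (2 ℕ.+ n)))
    eight = ℕSolver.solve-∀
    two : ∀ n → 2 ℕ.* n ℕ.+ 4 ≡ 2 ℕ.* (2 ℕ.+ n)
    two = ℕSolver.solve-∀

open import Data.Nat using (ℕ; _+_; _*_; _≥_)
open import Data.Integer using (ℤ; +_; _-_)
open import Data.Product using (Σ; _×_)
open import Function.Bundles using (_↔_)
open import Data.Fin using (Fin)
open import Relation.Binary.PropositionalEquality using (_≡_)

theorem4p3 : (n : ℕ) → n ≥ 1 →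
    Σ ℕ λ t → (Sol 1 5 5 5 n ↔ Fin t)
    × (+ t ≡ divisorSum (8 * n + 16) summand5 - divisorSum (2 * n + 4) summand5)
theorem4p3 n _ = Proof.representation-count n
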